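{- Let $Z:\mathfrak{H}^0\to\mathbb{R}$ be a $\mathbb{Q}$-linear map satisfying the double shuffle relation. Then the following three properties of $Z$ are equivalent: (Reg) $Z_{\sqcup\!\sqcup}(\mathbf{k};T)=\rho_Z\bigl(Z_*(\mathbf{k};T)\bigr)$ for every index $\mathbf{k}$; (Reg$^\star$) $Z^\star_{\sqcup\!\sqcup}(\mathbf{k};T)=\rho^\star_Z\bigl(Z^\star_*(\mathbf{k};T)\bigr)$ for every index $\mathbf{k}$; (Int-Ser) $Z\bigl(\mu(\mathbf{k},\mathbf{l})\bigr)=Z\bigl(\mathbf{k}\circledast\mathbf{l}^\star\bigr)$ for all non-empty indices $\mathbf{k},\mathbf{l}$.
   Context: Let $\mathfrak{H}=\mathbb{Q}\langle e_0,e_1\rangle$, $\mathfrak{H}^1=\mathbb{Q}+e_1\mathfrak{H}$, $\mathfrak{H}^0=\mathbb{Q}+e_1\mathfrak{H}e_0$, $e_k=e_1e_0^{k-1}$ ($k\ge1$). An index is a finite (possibly empty) sequence $\mathbf{k}=(k_1,\dots,k_r)$ of positive integers, admissible if empty or $k_r\ge2$; indices are identified with words $e_{k_1}\cdots e_{k_r}$ (empty index $\leftrightarrow 1$), giving bases of $\mathfrak{H}^1$ resp. (admissible) $\mathfrak{H}^0$; maps on indices are extended $\mathbb{Q}$-linearly. Products: shuffle $\sqcup\!\sqcup$ on $\mathfrak{H}$ is $\mathbb{Q}$-bilinear with $1\sqcup\!\sqcup w=w\sqcup\!\sqcup 1=w$, $av\sqcup\!\sqcup bw=a(v\sqcup\!\sqcup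 bw)+b(av\sqcup\!\sqcup w)$ for $a,b\in\{e_0,e_1\}$; harmonic $*$ on $\mathfrak{H}^1$ with $1*w=w*1=w$, $e_kv*e_lw=e_k(v*e_lw)+e_l(e_kv*w)+e_{k+l}(v*w)$. $\mathfrak{H}^1,\mathfrak{H}^0$ are closed under both. $Z$ satisfies the double shuffle relation if $Z(v\sqcup\!\sqcup w)=Z(v*w)=Z(v)Z(w)$ for all $v,w\in\mathfrak{H}^0$. Then $Z_{\sqcup\!\sqcup},Z_*:\mathfrak{H}^1\to\mathbb{R}[T]$ are the unique $\mathbb{Q}$-algebra homomorphisms for $\sqcup\!\sqcup$, resp. $*$, extending $Z$ and sending $e_1\mapsto T$ (they exist since $\mathfrak{H}^1$ is the polynomial algebra over $\mathfrak{H}^0$ in $e_1$ for either product). Write $Z_\bullet(\mathbf{k};T)$ for the value on the word of $\mathbf{k}$. $\circledast:e_1\mathfrak{H}\times e_1\mathfrak{H}\to e_1\mathfrak{H}e_0$ is bilinear with $ve_k\circledast we_l=(v*w)e_{k+l}$. For non-empty $\mathbf{k}=(k_1,\dots,k_r)$, $\mathbf{k}^\star$ is the sum of the $2^{r-1}$ indices $(k_1\bigcirc\cdots\bigcirc k_r)$ with each $\bigcirc$ a comma or a plus sign; $\varnothing^\star=\varnothing$; extended linearly. A 2-poset is a finite poset $X$ with labels $\delta_X:X\to\{0,1\}$; $W(X)\in\mathfrak{H}$ is the sum over all linear extensions $x_1,\dots,x_n$ of the order of $e_{\delta_X(x_1)}\cdots e_{\delta_X(x_n)}$, $W(\emptyset)=1$.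 For non-empty $\mathbf{l}=(l_1,\dots,l_s)$ and $\delta\in\{0,1\}$, $P_\delta(\mathbf{l})$ is the 2-poset on elements $b_{j,i}$ ($1\le j\le s$, $1\le i\le l_j$) with order generated by $b_{j,1}<\cdots<b_{j,l_j}$ and $b_{j-1,1}<b_{j,l_j}$ ($2\le j\le s$), labels $\delta(b_{s,1})=\delta$, $\delta(b_{j,1})=1$ ($j<s$), $\delta(b_{j,i})=0$ ($i\ge2$); $P_1(\varnothing)=\emptyset$. For non-empty $\mathbf{k}$ of weight $K$ and non-empty $\mathbf{l}$, $\mu(\mathbf{k},\mathbf{l})=W(Q)$ where $Q$ is the disjoint union of a chain $a_1<\cdots<a_K$ (with $\delta(a_t)=1$ iff $t\in\{1,k_1+1,\dots,k_1+\dots+k_{r-1}+1\}$, else $0$) and $P_0(\mathbf{l})$, with the extra relation $a_K<b_{s,1}$. Star regularizations: $Z^\star_*(\mathbf{k};T)=Z_*(\mathbf{k}^\star;T)$ and $Z^\star_{\sqcup\!\sqcup}(\mathbf{k};T)=Z_{\sqcup\!\sqcup}\bigl(W(P_1(\mathbf{k}));T\bigr)$. Let $A_Z(u)=\exp\bigl(\sum_{n\ge2}\frac{(-1)^n}{n}Z(e_n)u^n\bigr)\in\mathbb{R}[[u]]$; $\rho_Z,\rho_Z^\star$ are the $\mathbb{R}$-linear maps on $\mathbb{R}[T]$ defined (coefficientwise in $u$) by $\rho_Z(e^{Tu})=A_Z(u)e^{Tu}$ and $\rho^\star_Z(e^{Tu})=A_Z(-u)^{ -1}e^{Tu}$. 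-}

module Defs where

open import Level using (Level; _⊔_)
open import Data.Nat using (ℕ; zero; suc; _+_; _∸_; _≤_; _<ᵇ_; _≡ᵇ_)
import Data.Nat as N
open import Data.Bool using (Bool; true; false; if_then_else_; _∧_)
open import Data.List using (List; []; _∷_; _++_; map; concatMap; replicate; upTo; length; foldr)
open import Data.List.Relation.Unary.All using (All)
open import Data.Maybe using (Maybe; just; nothing)
open import Data.Product using (_×_; _,_; proj₁; proj₂)
open import Data.Unit using (⊤)
open import Relation.Binary.PropositionalEquality using (_≡_)
open import Relation.Nullary using (¬_)
open import Algebra.Bundles using (CommutativeRing)

data Letter : Set where
  x0 x1 : Letter

Word : Set
Word = List Letter

-- An index is a list of naturals; its entries are required to be ≥ 1
-- (predicate Pos) wherever indices are quantified over.
Index : Set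
Index = List ℕ

Pos : Index → Set
Pos = All (λ k → 1 ≤ k)

Adm : Index → Set
Adm [] = ⊤
Adm (k ∷ []) = 2 ≤ k
Adm (k ∷ k' ∷ ks) = (1 ≤ k) × Adm (k' ∷ ks)

toWord : Index → Word
toWord [] = []
toWord (k ∷ ks) = x1 ∷ (replicate (k ∸ 1) x0 ++ toWord ks)

-- Formal ℕ-linear combinations are represented as lists (multiplicities).

sh : Word → Word → List Word
sh [] w = w ∷ []
sh (a ∷ v) [] = (a ∷ v) ∷ []
sh (a ∷ v) (b ∷ w) = map (a ∷_) (sh v (b ∷ w)) ++ map (b ∷_) (sh (a ∷ v) w)

har : Index → Index → List Index
har [] l = l ∷ []
har (a ∷ k) [] = (a ∷ k) ∷ []
har (a ∷ k) (b ∷ l) =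
  map (a ∷_) (har k (b ∷ l)) ++ (map (b ∷_) (har (a ∷ k) l) ++ map ((a + b) ∷_) (har k l))

-- star: k⋆ = sum of (k1 ○ ⋯ ○ kr), ○ ∈ {',' , '+'} ; ∅⋆ = ∅

starAux : ℕ → Index → List Index
starAux a [] = (a ∷ []) ∷ []
starAux a (b ∷ r) = map (a ∷_) (starAux b r) ++ starAux (a + b) r

star : Index → List Index
star [] = [] ∷ []
star (a ∷ r) = starAux a r

splitLast : Index → Maybe (Index × ℕ)
splitLast [] = nothing
splitLast (x ∷ []) = just ([] , x)
splitLast (x ∷ y ∷ r) with splitLast (y ∷ r)
... | nothing = nothing
... | just (i , l) = just (x ∷ i , l)

circ : Index → Index → List Index
circ k l with splitLast k | splitLast l
... | just (k' , a) | just (l' , b) = map (_++ ((a + b) ∷ [])) (har k' l')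
... | _ | _ = []

circL : Index → List Index → List Index
circL k ls = concatMap (circ k) ls

-- 2-posets on the elements 0 , … , n-1 (n = length labels);
-- the order is the one generated by the relations x < y for (x , y) ∈ rels.

record Poset2 : Set where
  constructor poset2
  field
    labels : List Letter
    rels   : List (ℕ × ℕ)

lookupD : {a : Level} {A : Set a} → A → List A → ℕ → A
lookupD d [] n = d
lookupD d (x ∷ xs) zero = x
lookupD d (x ∷ xs) (suc n) = lookupD d xs n

insertAll : {A : Set} → A → List A → List (List A)
insertAll x [] = (x ∷ []) ∷ []
insertAll x (y ∷ ys) = (x ∷ y ∷ ys) ∷ map (y ∷_) (insertAll x ys)

perms : {A : Set} → List A → List (List A)
perms [] = [] ∷ []
perms (x ∷ xs) = concatMap (insertAll x) (perms xs)

pos : ℕ → List ℕ → ℕ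
pos x [] = 0
pos x (y ∷ ys) = if x ≡ᵇ y then 0 else suc (pos x ys)

filterB : {A : Set} → (A → Bool) → List A → List A
filterB p [] = []
filterB p (x ∷ xs) = if p x then x ∷ filterB p xs else filterB p xs

-- a permutation is a linear extension iff it respects every generating relation
respects : List (ℕ × ℕ) → List ℕ → Bool
respects [] π = true
respects ((x , y) ∷ rs) π = (pos x π <ᵇ pos y π) ∧ respects rs π

linExt : Poset2 → List (List ℕ)
linExt P = filterB (respects (Poset2.rels P)) (perms (upTo (length (Poset2.labels P))))

W : Poset2 → List Word
W P = map (map (lookupD x0 (Poset2.labels P))) (linExt P)

letter : Bool → Letter
letter false = x0
letter true = x1

-- P_δ(l): element b_{j,i} is numbered off_j + (i - 1), off_j = l_1 + ⋯ + l_{j-1}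
isEmpty : Index → Bool
isEmpty [] = true
isEmpty (_ ∷ _) = false

Pgo : Letter → ℕ → Maybe ℕ → Index → List Letter × List (ℕ × ℕ)
Pgo δ off prev [] = [] , []
Pgo δ off prev (l ∷ rest) =
  let firstLab = if isEmpty rest then δ else x1
      labs  = firstLab ∷ replicate (l ∸ 1) x0
      chain = map (λ i → (off + i , off + suc i)) (upTo (l ∸ 1))
      cross = crossRel prev
      r     = Pgo δ (off + l) (just off) rest
  in (labs ++ proj₁ r) , (chain ++ (cross ++ proj₂ r))
  where
  crossRel : Maybe ℕ → List (ℕ × ℕ)
  crossRel nothing = []
  crossRel (just p) = (p , off + (l ∸ 1)) ∷ []

P : Letter → Index → Poset2
P δ l = poset2 (proj₁ (Pgo δ 0 nothing l)) (proj₂ (Pgo δ 0 nothing l))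

-- l_1 + ⋯ + l_{s-1}  (offset of the block s)
sumInit : Index → ℕ
sumInit [] = 0
sumInit (x ∷ []) = 0
sumInit (x ∷ y ∷ r) = x + sumInit (y ∷ r)

weight : Index → ℕ
weight = foldr _+_ 0

-- μ(k,l) = W(Q): chain a_1 < ⋯ < a_K (elements 0..K-1) labelled by the
-- word of k, disjoint union with P_0(l) shifted by K, plus a_K < b_{s,1}
mu : Index → Index → List Word
mu k l =
  let K = weight k
      Pl = P x0 l
      chainRels = map (λ t → (t , suc t)) (upTo (K ∸ 1))
      shifted = map (λ { (x , y) → (K + x , K + y) }) (Poset2.rels Pl)
      extra = (K ∸ 1 , K + sumInit l) ∷ []
  in W (poset2 (toWord k ++ Poset2.labels Pl) (chainRels ++ (shifted ++ extra)))

-- Ring-valued part. R is a commutative ring, inv n plays the role of 1/(n+1).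

module WithRing {c ℓ : Level} (R : CommutativeRing c ℓ) (inv : ℕ → CommutativeRing.Carrier R) where
  open CommutativeRing R renaming (_+_ to _+R_; _*_ to _*R_)

  natR : ℕ → Carrier
  natR zero = 0#
  natR (suc n) = 1# +R natR n

  QAlg : Set ℓ
  QAlg = ∀ n → (natR (suc n) *R inv n) ≈ 1#

  sumR : List Carrier → Carrier
  sumR = foldr _+R_ 0#

  -- polynomials in T: coefficient lists (constant term first)
  Poly : Set c
  Poly = List Carrier

  coeff : Poly → ℕ → Carrier
  coeff = lookupD 0#

  infix 4 _≈P_
  _≈P_ : Poly → Poly → Set ℓ
  p ≈P q = ∀ n → coeff p n ≈ coeff q n

  padd : Poly → Poly → Poly
  padd [] q = q
  padd (a ∷ p) [] = a ∷ p
  padd (a ∷ p) (b ∷ q) = (a +R b) ∷ padd p q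

  pscale : Carrier → Poly → Poly
  pscale a = map (a *R_)

  pmul : Poly → Poly → Poly
  pmul [] q = []
  pmul (a ∷ p) q = padd (pscale a q) (0# ∷ pmul p q)

  pconst : Carrier → Poly
  pconst a = a ∷ []

  Tpoly : Poly
  Tpoly = 0# ∷ 1# ∷ []

  sumP : List Poly → Poly
  sumP = foldr padd []

  ZΣ : (Word → Carrier) → List Word → Carrier
  ZΣ Z ws = sumR (map Z ws)

  PΣ : (Word → Poly) → List Word → Poly
  PΣ F ws = sumP (map F ws)

  PS : Set c
  PS = ℕ → Carrier

  psMul : PS → PS → PS
  psMul f g m = sumR (map (λ i → f i *R g (m ∸ i)) (upTo (suc m)))

  psOne : PS
  psOne zero = 1#
  psOne (suc _) = 0#

  psPow : PS → ℕ → PS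
  psPow f zero = psOne
  psPow f (suc j) = psMul f (psPow f j)

  invFact : ℕ → Carrier
  invFact zero = 1#
  invFact (suc j) = inv j *R invFact j

  -- exp(f) = Σ_j f^j / j!   (for f with zero constant term)
  psExp : PS → PS
  psExp f m = sumR (map (λ j → invFact j *R psPow f j m) (upTo (suc m)))

  sgn : ℕ → Carrier
  sgn zero = 1#
  sgn (suc n) = - sgn n

  psNeg : PS → PS
  psNeg f n = sgn n *R f n

  -- multiplicative inverse of a series with constant term 1
  invList : PS → ℕ → List Carrier
  invList g zero = 1# ∷ []
  invList g (suc n) =
    let bs = invList g n
    in bs ++ ((- sumR (map (λ k → g (suc k) *R lookupD 0# bs (n ∸ k)) (upTo (suc n)))) ∷ [])

  psInv : PS → PS
  psInv g n = lookupD 0# (invList g n) n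

  logA : (Word → Carrier) → PS
  logA Z zero = 0#
  logA Z (suc zero) = 0#
  logA Z (suc (suc n)) = sgn (suc (suc n)) *R (inv (suc n) *R Z (toWord (suc (suc n) ∷ [])))

  A : (Word → Carrier) → PS
  A Z = psExp (logA Z)

  Astar : (Word → Carrier) → PS
  Astar Z = psInv (psNeg (A Z))

  ff : ℕ → ℕ → ℕ
  ff m zero = 1
  ff zero (suc j) = 0
  ff (suc m) (suc j) = suc m N.* ff m j

  -- ρ_a(e^{Tu}) = a(u) e^{Tu}, i.e. ρ_a(T^m) = Σ_{j≤m} m!/(m-j)! a_j T^{m-j}
  rhoMono : PS → ℕ → Poly
  rhoMono a m = map (λ i → natR (ff m (m ∸ i)) *R a (m ∸ i)) (upTo (suc m))

  rhoGo : PS → ℕ → Poly → Poly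
  rhoGo a m [] = []
  rhoGo a m (c ∷ p) = padd (pscale c (rhoMono a m)) (rhoGo a (suc m) p)

  rho : PS → Poly → Poly
  rho a p = rhoGo a 0 p

  -- double shuffle relation (on the basis of admissible words)
  DoubleShuffle : (Word → Carrier) → Set ℓ
  DoubleShuffle Z =
    (∀ k l → Adm k → Adm l → ZΣ Z (sh (toWord k) (toWord l)) ≈ (Z (toWord k) *R Z (toWord l)))
    × (∀ k l → Adm k → Adm l → ZΣ Z (map toWord (har k l)) ≈ (Z (toWord k) *R Z (toWord l)))

  IsShReg : (Word → Carrier) → (Word → Poly) → Set ℓ
  IsShReg Z F =
    (F [] ≈P pconst 1#)
    × (F (x1 ∷ []) ≈P Tpoly)
    × (∀ k → Adm k → F (toWord k) ≈P pconst (Z (toWord k)))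
    × (∀ k l → Pos k → Pos l → PΣ F (sh (toWord k) (toWord l)) ≈P pmul (F (toWord k)) (F (toWord l)))

  IsStReg : (Word → Carrier) → (Word → Poly) → Set ℓ
  IsStReg Z F =
    (F [] ≈P pconst 1#)
    × (F (x1 ∷ []) ≈P Tpoly)
    × (∀ k → Adm k → F (toWord k) ≈P pconst (Z (toWord k)))
    × (∀ k l → Pos k → Pos l → PΣ F (map toWord (har k l)) ≈P pmul (F (toWord k)) (F (toWord l)))

  Reg : (Word → Carrier) → (Word → Poly) → (Word → Poly) → Set ℓ
  Reg Z Zsh Zst = ∀ k → Pos k → Zsh (toWord k) ≈P rho (A Z) (Zst (toWord k))

  -- Z⋆_⧢(k;T) = Zsh(W(P_1(k))),  Z⋆_*(k;T) = Zst(k⋆)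
  RegStar : (Word → Carrier) → (Word → Poly) → (Word → Poly) → Set ℓ
  RegStar Z Zsh Zst =
    ∀ k → Pos k → PΣ Zsh (W (P x1 k)) ≈P rho (Astar Z) (PΣ Zst (map toWord (star k)))

  IntSer : (Word → Carrier) → Set ℓ
  IntSer Z = ∀ k l → Pos k → Pos l → ¬ (k ≡ []) → ¬ (l ≡ []) →
    ZΣ Z (mu k l) ≈ ZΣ Z (map toWord (circL k (star l)))

{-# OPTIONS --safe #-}
-- Let m(k,l) be the regularised value of the poset made of the chain of k and the zigzag
-- P_1(l), joined as in Q (shuffle side), respectively of Σ_i (k * (l_1,…,l_i)^⋆)(l_{i+1}+⋯+l_s) (harmonic side).
-- With c(k) the regularised value of k, both satisfy c(k,n) m(∅,l) = m(k,(l,n)) + m((k,n),l); on the shuffle side this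
-- is the comparison of the top of the chain with the bottom of the last zigzag block. Moreover
-- μ((k,a),(l,b)) and (k,a) ⊛ (l,b)^⋆ have the values m(k,(l,a+b)), so (Int-Ser) says that the two systems m agree on
-- m(k,(l,n)) with n ≥ 2.
--
-- Summing the recurrence over trailing ones, with E(u) = Σ c({1}^p) u^p and H(u) = Σ m(∅,{1}^p) u^p, gives
--   E(-u) H(u) = 1,  Σ c(k,n,{1}^p)(-u)^p = E(-u) s(u),  Σ m(∅,(l,{1}^p)) u^p = H(u) t(u),
-- where s(u) = Σ m(k,({1}^p,n)) u^p and t(u) = Σ m({1}^p,l)(-u)^p, and hence
--   Σ m(k,(l,{1}^p,n)) u^p + Σ m((k,n,{1}^p),l)(-u)^p = s(u) t(u).
-- Since E(u) = e^{Tu} on the shuffle side and, by Newton's identities, E(u) = A(u)^{-1} e^{Tu} on the harmonic side,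
-- (Reg) says that the two series s agree and (Reg^⋆) that the two series t agree. The last displayed identity
-- propagates either agreement to all m(k,(l,n)) with n ≥ 2, by induction on the length of l, respectively of k.

module Submission where

open import Defs
open import Level using (Level)
open import Data.Nat as ℕ using (ℕ; zero; suc; _≤_; _<_; z≤n; s≤s; _∸_)
import Data.Nat.Properties as ℕₚ
open import Data.Bool using (Bool; true; false; if_then_else_; _∧_; not)
open import Data.List using (List; []; _∷_; _++_; map; concatMap; replicate; upTo; applyUpTo; length; foldr; reverse; _∷ʳ_; _ʳ++_; initLast; _∷ʳ′_)
import Data.List.Properties as Listₚ
open import Data.List.Relation.Unary.All as All using (All; []; _∷_)
import Data.List.Relation.Unary.All.Properties as Allₚ
open import Data.List.Relation.Unary.Any using (here; there)
open import Data.List.Membership.Propositional using (_∈_)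
import Data.List.Membership.Propositional.Properties as ∈ₚ
open import Data.List.Relation.Unary.AllPairs using ([]; _∷_)
open import Data.List.Relation.Unary.Unique.Propositional using (Unique)
open import Data.List.Relation.Binary.Permutation.Propositional as ↭ using (_↭_; prep; swap; ↭-refl; ↭-sym; ↭-trans)
import Data.List.Relation.Binary.Permutation.Propositional.Properties as ↭ₚ
open import Data.Maybe as Maybe using (Maybe; just; nothing)
open import Data.Product using (_×_; _,_; proj₁; proj₂; ∃-syntax)
open import Data.Sum using (_⊎_; inj₁; inj₂)
open import Data.Unit using (tt)
open import Relation.Nullary using (¬_; yes; no; contradiction)
open import Relation.Binary.PropositionalEquality as ≡ using (_≡_; _≢_)
open import Function using (_∘_; id)
open import Function.Bundles using (_⇔_; mk⇔)
open import Algebra.Bundles using (CommutativeRing; RawRing)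

-- The obstacle is that the two regularisations differ in every power of T, so values on single
-- indices cannot be compared directly. It is overcome because m(k,(l,n)) with n ≥ 2 involves
-- admissible words only and is therefore constant in T. Hence the series of the c(k,n,{1}^p) and of
-- the m(∅,(l,n,{1}^p)) over p are each a T-free series times e^{Tu}, and the T-free factor can be
-- read off at T = 0.
--
-- On the harmonic side the recurrence holds because the last entry of a term of (k,n) * (v,s) is s,
-- n or n+s. Since the recurrence determines m from c, m is defined by it for an arbitrary c, its
-- consequences are proved once, and the poset sums and the star sums are then recognised as its
-- solutions. All of this happens at the end of an index, which is why indices become reversed
-- lists.
--
-- The closed forms of E are not found by manipulating double sums: they follow from uniqueness of
-- the solution of θX = qX with θ = u d/du, the positive integers being invertible. Polynomials in T
-- are embedded in power series in T, so that no degrees have to be tracked and one construction of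
-- series rings serves for both T and u.

-- A ring solver with integer coefficients

module IntegerSolver {c ℓ : Level} (S : CommutativeRing c ℓ) where
  open CommutativeRing S hiding (zero)
  open import Algebra.Properties.Ring ring
  open import Algebra.Properties.Semiring.Mult semiring renaming (_×_ to _×′_)
  open import Relation.Binary.Reasoning.Setoid setoid
  open import Algebra.Solver.Ring.AlmostCommutativeRing
  import Algebra.Solver.Ring as Solver
  import Algebra.Solver.Ring.NaturalCoefficients.Default commutativeSemiring as SR

  -- Coefficients are formal differences of naturals, so that the solver recognises x - x as 0.
  private
    Diff : RawRing _ _
    Diff = record
      { Carrier = ℕ × ℕ
      ; _≈_ = _≡_
      ; _+_ = λ { (a , b) (c , d) → (a ℕ.+ c , b ℕ.+ d) }
      ; _*_ = λ { (a , b) (c , d) → (a ℕ.* c ℕ.+ b ℕ.* d , a ℕ.* d ℕ.+ b ℕ.* c) }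
      ; -_ = λ { (a , b) → (b , a) }
      ; 0# = (0 , 0)
      ; 1# = (1 , 0)
      }

    ⟦_⟧ᵈ : ℕ × ℕ → Carrier
    ⟦ (a , b) ⟧ᵈ = a ×′ 1# - b ×′ 1#

    add-eq : ∀ w x y z → (w + x) - (y + z) ≈ (w - y) + (x - z)
    add-eq w x y z = begin
      (w + x) - (y + z)        ≈⟨ +-congˡ (-‿+-comm y z) ⟨
      (w + x) + (- y + - z)    ≈⟨ SR.solve 4 (λ w x y z → (w SR.:+ x) SR.:+ (y SR.:+ z) SR.:= (w SR.:+ y) SR.:+ (x SR.:+ z)) refl w x (- y) (- z) ⟩
      (w - y) + (x - z)        ∎

    mul-eq : ∀ w x y z → (w * y + x * z) - (w * z + x * y) ≈ (w - x) * (y - z)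
    mul-eq w x y z = begin
      (w * y + x * z) - (w * z + x * y)          ≈⟨ +-congˡ (-‿+-comm _ _) ⟨
      (w * y + x * z) + (- (w * z) + - (x * y))  ≈⟨ +-cong (+-congˡ neg-neg) (+-cong (-‿distribʳ-* w z) (-‿distribˡ-* x y)) ⟩
      (w * y + - x * - z) + (w * - z + - x * y)  ≈⟨ SR.solve 4 (λ w x y z → (w SR.:* y SR.:+ x SR.:* z) SR.:+ (w SR.:* z SR.:+ x SR.:* y) SR.:= (w SR.:+ x) SR.:* (y SR.:+ z)) refl w (- x) y (- z) ⟩
      (w - x) * (y - z)                          ∎
      where
      neg-neg : x * z ≈ - x * - z
      neg-neg = begin
        x * z        ≈⟨ -‿involutive _ ⟨
        - - (x * z)  ≈⟨ -‿cong (-‿distribˡ-* x z) ⟩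
        - (- x * z)  ≈⟨ -‿distribʳ-* (- x) z ⟩
        - x * - z    ∎

    neg-eq : ∀ x y → y - x ≈ - (x - y)
    neg-eq x y = begin
      y - x        ≈⟨ +-congʳ (-‿involutive y) ⟨
      - - y - x    ≈⟨ -‿+-comm (- y) x ⟩
      - (- y + x)  ≈⟨ -‿cong (+-comm (- y) x) ⟩
      - (x - y)    ∎

    morphism : Diff -Raw-AlmostCommutative⟶ fromCommutativeRing S
    morphism = record
      { ⟦_⟧ = ⟦_⟧ᵈ
      ; +-homo = λ { (a , b) (c , d) → trans (+-cong (×-homo-+ 1# a c) (-‿cong (×-homo-+ 1# b d)))
                                             (add-eq (a ×′ 1#) (c ×′ 1#) (b ×′ 1#) (d ×′ 1#)) }
      ; *-homo = λ { (a , b) (c , d) → trans (+-cong (hom₂ a c b d) (-‿cong (hom₂ a d b c)))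
                                             (mul-eq (a ×′ 1#) (b ×′ 1#) (c ×′ 1#) (d ×′ 1#)) }
      ; -‿homo = λ { (a , b) → neg-eq (a ×′ 1#) (b ×′ 1#) }
      ; 0-homo = -‿inverseʳ 0#
      ; 1-homo = trans (+-congˡ -0#≈0#) (trans (+-identityʳ _) (+-identityʳ _))
      }
      where
      hom₂ : ∀ a b c d → (a ℕ.* b ℕ.+ c ℕ.* d) ×′ 1# ≈ a ×′ 1# * b ×′ 1# + c ×′ 1# * d ×′ 1#
      hom₂ a b c d = trans (×-homo-+ 1# (a ℕ.* b) (c ℕ.* d)) (+-cong (×1-homo-* a b) (×1-homo-* c d))

    -- Only cross sums of naturals are compared, so no decidable equality in the ring is needed.
    dec : ∀ p q → Maybe (⟦ p ⟧ᵈ ≈ ⟦ q ⟧ᵈ)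
    dec (a , b) (c , d) with (a ℕ.+ d) ℕ.≟ (c ℕ.+ b)
    ... | no _ = nothing
    ... | yes eq = just (begin
      A - B                    ≈⟨ +-identityʳ _ ⟨
      (A - B) + 0#             ≈⟨ +-congˡ (-‿inverseʳ D) ⟨
      (A - B) + (D - D)        ≈⟨ add-eq A D B D ⟨
      (A + D) - (B + D)        ≈⟨ +-cong AD≈CB (-‿cong (+-comm B D)) ⟩
      (C + B) - (D + B)        ≈⟨ add-eq C B D B ⟩
      (C - D) + (B - B)        ≈⟨ +-congˡ (-‿inverseʳ B) ⟩
      (C - D) + 0#             ≈⟨ +-identityʳ _ ⟩
      C - D                    ∎)
      where
      A = a ×′ 1#
      B = b ×′ 1#
      C = c ×′ 1#
      D = d ×′ 1#
      AD≈CB : A + D ≈ C + B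
      AD≈CB = begin
        A + D             ≈⟨ ×-homo-+ 1# a d ⟨
        (a ℕ.+ d) ×′ 1#   ≡⟨ ≡.cong (_×′ 1#) eq ⟩
        (c ℕ.+ b) ×′ 1#   ≈⟨ ×-homo-+ 1# c b ⟩
        C + B             ∎

  open Solver Diff (fromCommutativeRing S) morphism dec public
    using (solve; _:=_; _:+_; _:*_; _:-_; :-_)

-- Finite sums over lists

module Summation {c ℓ : Level} (S : CommutativeRing c ℓ) where
  open CommutativeRing S hiding (zero)
  open IntegerSolver S

  private variable
    A B : Set

  -- In this form `ZΣ` and the sums inside `psMul` and `psExp` are instances by definition.
  ∑ : List A → (A → Carrier) → Carrier
  ∑ xs f = foldr _+_ 0# (map f xs)

  ∑-cong : ∀ {f g : A → Carrier} xs → (∀ x → f x ≈ g x) → ∑ xs f ≈ ∑ xs g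
  ∑-cong [] f≈g = refl
  ∑-cong (x ∷ xs) f≈g = +-cong (f≈g x) (∑-cong xs f≈g)

  ∑-congᴬ : ∀ {f g : A → Carrier} {xs} → All (λ x → f x ≈ g x) xs → ∑ xs f ≈ ∑ xs g
  ∑-congᴬ [] = refl
  ∑-congᴬ (p ∷ ps) = +-cong p (∑-congᴬ ps)

  ∑-++ : ∀ xs ys (f : A → Carrier) → ∑ (xs ++ ys) f ≈ ∑ xs f + ∑ ys f
  ∑-++ [] ys f = sym (+-identityˡ _)
  ∑-++ (x ∷ xs) ys f = trans (+-congˡ (∑-++ xs ys f)) (sym (+-assoc _ _ _))

  ∑-map : ∀ (h : A → B) xs (f : B → Carrier) → ∑ (map h xs) f ≡ ∑ xs (f ∘ h)
  ∑-map h xs f = ≡.cong (foldr _+_ 0#) (≡.sym (Listₚ.map-∘ xs))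

  ∑-concatMap : ∀ (h : A → List B) xs (f : B → Carrier) →
    ∑ (concatMap h xs) f ≈ ∑ xs (λ x → ∑ (h x) f)
  ∑-concatMap h [] f = refl
  ∑-concatMap h (x ∷ xs) f = trans (∑-++ (h x) _ f) (+-congˡ (∑-concatMap h xs f))

  ∑-+ : ∀ xs (f g : A → Carrier) → ∑ xs (λ x → f x + g x) ≈ ∑ xs f + ∑ xs g
  ∑-+ [] f g = sym (+-identityˡ _)
  ∑-+ (x ∷ xs) f g = trans (+-congˡ (∑-+ xs f g))
    (solve 4 (λ a b c d → (a :+ b) :+ (c :+ d) := (a :+ c) :+ (b :+ d)) refl _ _ _ _)

  ∑-*ˡ : ∀ a xs (f : A → Carrier) → ∑ xs (λ x → a * f x) ≈ a * ∑ xs f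
  ∑-*ˡ a [] f = sym (zeroʳ a)
  ∑-*ˡ a (x ∷ xs) f = trans (+-congˡ (∑-*ˡ a xs f)) (sym (distribˡ a _ _))

  ∑-0 : ∀ (xs : List A) → ∑ xs (λ _ → 0#) ≈ 0#
  ∑-0 [] = refl
  ∑-0 (x ∷ xs) = trans (+-identityˡ _) (∑-0 xs)

  ∑-filterB : ∀ p xs (f : A → Carrier) →
    ∑ (filterB p xs) f ≈ ∑ xs (λ x → if p x then f x else 0#)
  ∑-filterB p [] f = refl
  ∑-filterB p (x ∷ xs) f with p x
  ... | true = +-congˡ (∑-filterB p xs f)
  ... | false = trans (∑-filterB p xs f) (sym (+-identityˡ _))

  ∑-upTo : ∀ n (f : ℕ → Carrier) → ∑ (upTo (suc n)) f ≡ f 0 + ∑ (upTo n) (f ∘ suc)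
  ∑-upTo n f = ≡.cong (λ l → f 0 + foldr _+_ 0# l)
    (≡.trans (Listₚ.map-applyUpTo suc f n) (≡.sym (Listₚ.map-applyUpTo id (f ∘ suc) n)))

  ∑-upTo-cong : ∀ n {f g : ℕ → Carrier} → (∀ i → i < n → f i ≈ g i) → ∑ (upTo n) f ≈ ∑ (upTo n) g
  ∑-upTo-cong zero h = refl
  ∑-upTo-cong (suc n) {f} {g} h = trans (reflexive (∑-upTo n f))
    (trans (+-cong (h 0 (s≤s z≤n)) (∑-upTo-cong n (λ i i<n → h (suc i) (s≤s i<n))))
           (reflexive (≡.sym (∑-upTo n g))))

  ∑-upTo-+ : ∀ m n (f : ℕ → Carrier) →
    ∑ (upTo (m ℕ.+ n)) f ≈ ∑ (upTo m) f + ∑ (upTo n) (λ i → f (m ℕ.+ i))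
  ∑-upTo-+ zero n f = sym (+-identityˡ _)
  ∑-upTo-+ (suc m) n f = trans (reflexive (∑-upTo (m ℕ.+ n) f))
    (trans (+-congˡ (∑-upTo-+ m n (f ∘ suc)))
    (trans (sym (+-assoc _ _ _)) (+-congʳ (reflexive (≡.sym (∑-upTo m f))))))

-- Formal power series, the substitution of -u for u, and the derivation u d/du

module PowerSeries {c ℓ : Level} (S : CommutativeRing c ℓ) where
  open CommutativeRing S hiding (zero)
  open import Algebra.Properties.Ring ring using (-0#≈0#)
  open import Relation.Binary.Reasoning.Setoid setoid
  open IntegerSolver S
  open Summation S

  infix 4 _≋_
  _≋_ : (ℕ → Carrier) → (ℕ → Carrier) → Set ℓ
  f ≋ g = ∀ n → f n ≈ g n

  -- The Cauchy product without truncated subtraction: inductions simply pass from `f` to `f ∘ suc`.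
  conv : (ℕ → Carrier) → (ℕ → Carrier) → ℕ → Carrier
  conv f g zero = f 0 * g 0
  conv f g (suc n) = f 0 * g (suc n) + conv (f ∘ suc) g n

  const : Carrier → ℕ → Carrier
  const a zero = a
  const a (suc _) = 0#

  conv-cong-≤ : ∀ {f f′ g g′} n → (∀ i → i ≤ n → f i ≈ f′ i) → (∀ i → i ≤ n → g i ≈ g′ i) →
    conv f g n ≈ conv f′ g′ n
  conv-cong-≤ zero p q = *-cong (p 0 z≤n) (q 0 z≤n)
  conv-cong-≤ (suc n) p q = +-cong (*-cong (p 0 z≤n) (q (suc n) ℕₚ.≤-refl))
    (conv-cong-≤ n (λ i i≤n → p (suc i) (s≤s i≤n)) (λ i i≤n → q i (ℕₚ.m≤n⇒m≤1+n i≤n)))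

  conv-cong : ∀ {f f′ g g′} → f ≋ f′ → g ≋ g′ → conv f g ≋ conv f′ g′
  conv-cong p q n = conv-cong-≤ n (λ i _ → p i) (λ i _ → q i)

  -- `conv` strips the constant term of the left factor; commutativity needs the same for the right
  -- factor.
  conv-right : ∀ f g n → conv f g (suc n) ≈ conv f (g ∘ suc) n + f (suc n) * g 0
  conv-right f g zero = refl
  conv-right f g (suc n) = trans (+-congˡ (conv-right (f ∘ suc) g n)) (sym (+-assoc _ _ _))

  conv-comm : ∀ f g → conv f g ≋ conv g f
  conv-comm f g zero = *-comm _ _
  conv-comm f g (suc n) = begin
    f 0 * g (suc n) + conv (f ∘ suc) g n  ≈⟨ +-cong (*-comm _ _) (conv-comm (f ∘ suc) g n) ⟩
    g (suc n) * f 0 + conv g (f ∘ suc) n  ≈⟨ +-comm _ _ ⟩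
    conv g (f ∘ suc) n + g (suc n) * f 0  ≈⟨ conv-right g f n ⟨
    conv g f (suc n)                      ∎

  conv-distribʳ : ∀ h f g → conv (λ i → f i + g i) h ≋ (λ n → conv f h n + conv g h n)
  conv-distribʳ h f g zero = distribʳ _ _ _
  conv-distribʳ h f g (suc n) = trans (+-congˡ (conv-distribʳ h (f ∘ suc) (g ∘ suc) n))
    (solve 5 (λ a b h x y → (a :+ b) :* h :+ (x :+ y) := (a :* h :+ x) :+ (b :* h :+ y)) refl _ _ _ _ _)

  conv-scale : ∀ a f g → conv (λ i → a * f i) g ≋ (λ n → a * conv f g n)
  conv-scale a f g zero = *-assoc _ _ _
  conv-scale a f g (suc n) = trans (+-congˡ (conv-scale a (f ∘ suc) g n))
    (solve 4 (λ a b c d → a :* b :* c :+ a :* d := a :* (b :* c :+ d)) refl _ _ _ _)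

  conv-assoc : ∀ f g h → conv (conv f g) h ≋ conv f (conv g h)
  conv-assoc f g h zero = *-assoc _ _ _
  conv-assoc f g h (suc n) = begin
    (f 0 * g 0) * h (suc n) + conv (λ i → f 0 * g (suc i) + conv (f ∘ suc) g i) h n
      ≈⟨ +-congˡ (conv-distribʳ h _ _ n) ⟩
    (f 0 * g 0) * h (suc n) + (conv (λ i → f 0 * g (suc i)) h n + conv (conv (f ∘ suc) g) h n)
      ≈⟨ +-congˡ (+-cong (conv-scale (f 0) (g ∘ suc) h n) (conv-assoc (f ∘ suc) g h n)) ⟩
    (f 0 * g 0) * h (suc n) + (f 0 * conv (g ∘ suc) h n + conv (f ∘ suc) (conv g h) n)
      ≈⟨ solve 5 (λ a b c d e → a :* b :* c :+ (a :* d :+ e) := a :* (b :* c :+ d) :+ e) refl _ _ _ _ _ ⟩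
    f 0 * conv g h (suc n) + conv (f ∘ suc) (conv g h) n ∎

  conv-zeroˡ : ∀ g → conv (λ _ → 0#) g ≋ (λ _ → 0#)
  conv-zeroˡ g zero = zeroˡ _
  conv-zeroˡ g (suc n) = trans (+-cong (zeroˡ _) (conv-zeroˡ g n)) (+-identityˡ 0#)

  conv-constˡ : ∀ a g → conv (const a) g ≋ (λ n → a * g n)
  conv-constˡ a g zero = refl
  conv-constˡ a g (suc n) = trans (+-congˡ (conv-zeroˡ g n)) (+-identityʳ _)

  conv-oneˡ : ∀ g → conv (const 1#) g ≋ g
  conv-oneˡ g n = trans (conv-constˡ 1# g n) (*-identityˡ _)

  -- Being a commutative ring again, it can be iterated (series in u over series in T), and the
  -- solver and the sums apply to it.
  seriesRing : CommutativeRing c ℓ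
  seriesRing = record
    { Carrier = ℕ → Carrier
    ; _≈_ = _≋_
    ; _+_ = λ f g n → f n + g n
    ; _*_ = conv
    ; -_ = λ f n → - f n
    ; 0# = λ _ → 0#
    ; 1# = const 1#
    ; isCommutativeRing = record
      { isRing = record
        { +-isAbelianGroup = record
          { isGroup = record
            { isMonoid = record
              { isSemigroup = record
                { isMagma = record
                  { isEquivalence = record
                    { refl = λ n → refl ; sym = λ p n → sym (p n) ; trans = λ p q n → trans (p n) (q n) }
                  ; ∙-cong = λ p q n → +-cong (p n) (q n) }
                ; assoc = λ f g h n → +-assoc _ _ _ }
              ; identity = (λ f n → +-identityˡ _) , (λ f n → +-identityʳ _) }
            ; inverse = (λ f n → -‿inverseˡ _) , (λ f n → -‿inverseʳ _)
            ; ⁻¹-cong = λ p n → -‿cong (p n) }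
          ; comm = λ f g n → +-comm _ _ }
        ; *-cong = conv-cong
        ; *-assoc = conv-assoc
        ; *-identity = conv-oneˡ , λ g n → trans (conv-comm g (const 1#) n) (conv-oneˡ g n)
        ; distrib = (λ h f g n → trans (conv-comm h _ n) (trans (conv-distribʳ h f g n) (+-cong (conv-comm f h n) (conv-comm g h n))))
                  , conv-distribʳ
        }
      ; *-comm = conv-comm
      }
    }

  open CommutativeRing seriesRing using () renaming (_+_ to _⊞_; _*_ to _⊠_; 0# to 𝟘; 1# to 𝟙)

  -- the substitution u ↦ -u
  alt : (ℕ → Carrier) → ℕ → Carrier
  alt f zero = f 0
  alt f (suc n) = - alt (f ∘ suc) n

  alt-cong : ∀ {f g} → f ≋ g → alt f ≋ alt g
  alt-cong p zero = p 0
  alt-cong p (suc n) = -‿cong (alt-cong (p ∘ suc) n)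

  alt-neg : ∀ f n → alt (λ i → - f i) n ≈ - alt f n
  alt-neg f zero = refl
  alt-neg f (suc n) = -‿cong (alt-neg (f ∘ suc) n)

  alt-involutive : ∀ f → alt (alt f) ≋ f
  alt-involutive f zero = refl
  alt-involutive f (suc n) = begin
    - alt (λ i → - alt (f ∘ suc) i) n  ≈⟨ -‿cong (alt-neg (alt (f ∘ suc)) n) ⟩
    - - alt (alt (f ∘ suc)) n          ≈⟨ solve 1 (λ x → :- (:- x) := x) refl _ ⟩
    alt (alt (f ∘ suc)) n              ≈⟨ alt-involutive (f ∘ suc) n ⟩
    f (suc n)                          ∎

  conv-negˡ : ∀ f g → conv (λ i → - f i) g ≋ (λ n → - conv f g n)
  conv-negˡ f g zero = solve 2 (λ a b → :- a :* b := :- (a :* b)) refl _ _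
  conv-negˡ f g (suc n) = trans (+-congˡ (conv-negˡ (f ∘ suc) g n))
    (solve 3 (λ a b c → :- a :* b :+ :- c := :- (a :* b :+ c)) refl _ _ _)

  alt-+ : ∀ f g → alt (f ⊞ g) ≋ alt f ⊞ alt g
  alt-+ f g zero = refl
  alt-+ f g (suc n) = trans (-‿cong (alt-+ (f ∘ suc) (g ∘ suc) n))
    (solve 2 (λ a b → :- (a :+ b) := :- a :+ :- b) refl _ _)

  alt-scale : ∀ a f → alt (λ i → a * f i) ≋ (λ n → a * alt f n)
  alt-scale a f zero = refl
  alt-scale a f (suc n) = trans (-‿cong (alt-scale a (f ∘ suc) n))
    (solve 2 (λ a b → :- (a :* b) := a :* :- b) refl _ _)

  alt-zero : alt 𝟘 ≋ 𝟘
  alt-zero zero = refl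
  alt-zero (suc n) = trans (-‿cong (alt-zero n)) -0#≈0#

  alt-const : ∀ a → alt (const a) ≋ const a
  alt-const a zero = refl
  alt-const a (suc n) = alt-zero (suc n)

  alt-* : ∀ f g → alt (f ⊠ g) ≋ alt f ⊠ alt g
  alt-* f g zero = refl
  alt-* f g (suc n) = begin
    - alt (λ i → f 0 * g (suc i) + conv (f ∘ suc) g i) n
      ≈⟨ -‿cong (alt-+ _ _ n) ⟩
    - (alt (λ i → f 0 * g (suc i)) n + alt (conv (f ∘ suc) g) n)
      ≈⟨ -‿cong (+-cong (alt-scale (f 0) (g ∘ suc) n) (alt-* (f ∘ suc) g n)) ⟩
    - (f 0 * alt (g ∘ suc) n + conv (alt (f ∘ suc)) (alt g) n)
      ≈⟨ solve 3 (λ a b c → :- (a :* b :+ c) := a :* :- b :+ :- c) refl _ _ _ ⟩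
    f 0 * - alt (g ∘ suc) n + - conv (alt (f ∘ suc)) (alt g) n
      ≈⟨ +-congˡ (conv-negˡ (alt (f ∘ suc)) (alt g) n) ⟨
    (alt f ⊠ alt g) (suc n) ∎

  nat : ℕ → Carrier
  nat zero = 0#
  nat (suc n) = 1# + nat n

  -- the derivation u d/du
  θ : (ℕ → Carrier) → ℕ → Carrier
  θ f n = nat n * f n

  θ-cong : ∀ {f g} → f ≋ g → θ f ≋ θ g
  θ-cong p n = *-congˡ (p n)

  -- The induction shifts `f`, and `θ f ∘ suc` exceeds `θ (f ∘ suc)` by `f ∘ suc`; the summand 1 of
  -- `nat (suc n)` pays for this.
  θ-* : ∀ f g → θ (f ⊠ g) ≋ (θ f ⊠ g) ⊞ (f ⊠ θ g)
  θ-* f g zero = begin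
    0# * (f 0 * g 0)                       ≈⟨ zeroˡ _ ⟩
    0#                                     ≈⟨ +-identityˡ 0# ⟨
    0# + 0#                                ≈⟨ +-cong (trans (*-congʳ (zeroˡ _)) (zeroˡ _)) (trans (*-congˡ (zeroˡ _)) (zeroʳ _)) ⟨
    0# * f 0 * g 0 + f 0 * (0# * g 0)      ∎
  θ-* f g (suc n) = begin
    (1# + nat n) * (f 0 * g (suc n) + conv (f ∘ suc) g n)
      ≈⟨ solve 5 (λ i k a b c → (i :+ k) :* (a :* b :+ c) := a :* ((i :+ k) :* b) :+ (k :* c :+ i :* c)) refl 1# (nat n) (f 0) (g (suc n)) _ ⟩
    f 0 * (nat (suc n) * g (suc n)) + (nat n * conv (f ∘ suc) g n + 1# * conv (f ∘ suc) g n)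
      ≈⟨ +-congˡ (+-cong (θ-* (f ∘ suc) g n) (*-identityˡ _)) ⟩
    f 0 * (nat (suc n) * g (suc n)) + ((conv (θ (f ∘ suc)) g n + conv (f ∘ suc) (θ g) n) + conv (f ∘ suc) g n)
      ≈⟨ solve 4 (λ a b c d → a :+ ((b :+ c) :+ d) := (d :+ b) :+ (a :+ c)) refl _ _ _ _ ⟩
    (conv (f ∘ suc) g n + conv (θ (f ∘ suc)) g n) + (f 0 * (nat (suc n) * g (suc n)) + conv (f ∘ suc) (θ g) n)
      ≈⟨ +-congʳ (conv-distribʳ g (f ∘ suc) (θ (f ∘ suc)) n) ⟨
    conv ((f ∘ suc) ⊞ θ (f ∘ suc)) g n + (f ⊠ θ g) (suc n)
      ≈⟨ +-congʳ (conv-cong (λ i → sym (trans (distribʳ _ _ _) (+-congʳ (*-identityˡ _)))) (λ _ → refl) n) ⟩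
    conv (θ f ∘ suc) g n + (f ⊠ θ g) (suc n)
      ≈⟨ +-congʳ (trans (sym (+-identityˡ _)) (+-congʳ (sym (trans (*-congʳ (zeroˡ _)) (zeroˡ _))))) ⟩
    (θ f ⊠ g) (suc n) + (f ⊠ θ g) (suc n) ∎

  θ-one : θ 𝟙 ≋ 𝟘
  θ-one zero = zeroˡ _
  θ-one (suc n) = zeroʳ _

  -- Coefficient n of `alt f` is f n up to sign. In `θ-alt` this allows the factor `nat n` to be
  -- treated as a fixed scalar.
  alt-pointwise : ∀ f {g} n → (f n ≈ g n) → alt f n ≈ alt g n
  alt-pointwise f zero p = p
  alt-pointwise f (suc n) p = -‿cong (alt-pointwise (f ∘ suc) n p)

  θ-alt : ∀ f → θ (alt f) ≋ alt (θ f)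
  θ-alt f n = trans (sym (alt-scale (nat n) f n)) (alt-pointwise (λ i → nat n * f i) n refl)

  module _ (natInv : ℕ → Carrier) (nat-inverse : ∀ n → nat (suc n) * natInv n ≈ 1#) where

    nat-cancel : ∀ n {x y} → nat (suc n) * x ≈ nat (suc n) * y → x ≈ y
    nat-cancel n {x} {y} p = begin
      x                              ≈⟨ *-identityˡ x ⟨
      1# * x                         ≈⟨ *-congʳ (nat-inverse n) ⟨
      nat (suc n) * natInv n * x     ≈⟨ solve 3 (λ a b x → a :* b :* x := b :* (a :* x)) refl _ _ _ ⟩
      natInv n * (nat (suc n) * x)   ≈⟨ *-congˡ p ⟩
      natInv n * (nat (suc n) * y)   ≈⟨ solve 3 (λ a b x → a :* b :* x := b :* (a :* x)) refl _ _ _ ⟨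
      nat (suc n) * natInv n * y     ≈⟨ *-congʳ (nat-inverse n) ⟩
      1# * y                         ≈⟨ *-identityˡ y ⟩
      y                              ∎

    -- As q has no constant term, the equation expresses `nat (suc n)` times the next coefficient
    -- through the earlier ones, and `nat (suc n)` cancels.
    θ-unique : ∀ q X Y → q 0 ≈ 0# → X 0 ≈ Y 0 → θ X ≋ q ⊠ X → θ Y ≋ q ⊠ Y → X ≋ Y
    θ-unique q X Y q0 XY0 eX eY n = below n n ℕₚ.≤-refl
      where
      step : ∀ V → θ V ≋ q ⊠ V → ∀ n → nat (suc n) * V (suc n) ≈ conv (q ∘ suc) V n
      step V eV n = trans (eV (suc n)) (trans (+-congʳ (trans (*-congʳ q0) (zeroˡ _))) (+-identityˡ _))
      below : ∀ n i → i ≤ n → X i ≈ Y i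
      below n zero _ = XY0
      below (suc n) (suc i) (s≤s i≤n) = nat-cancel i (begin
        nat (suc i) * X (suc i)  ≈⟨ step X eX i ⟩
        conv (q ∘ suc) X i       ≈⟨ conv-cong-≤ i (λ _ _ → refl) (λ j j≤i → below n j (ℕₚ.≤-trans j≤i i≤n)) ⟩
        conv (q ∘ suc) Y i       ≈⟨ step Y eY i ⟨
        nat (suc i) * Y (suc i)  ∎)

  conv-as-sum : ∀ f g n → ∑ (upTo (suc n)) (λ i → f i * g (n ∸ i)) ≈ conv f g n
  conv-as-sum f g zero = +-identityʳ _
  conv-as-sum f g (suc n) = trans (reflexive (∑-upTo (suc n) (λ i → f i * g (suc n ∸ i))))
    (+-congˡ (conv-as-sum (f ∘ suc) g n))

-- Reversed indices and their trailing ones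

-- ones p k is the reversed index of (k , {1}^p).
ones : ℕ → Index → Index
ones zero l = l
ones (suc p) l = ones p (1 ∷ l)

ones-∷ : ∀ p l → ones p (1 ∷ l) ≡ 1 ∷ ones p l
ones-∷ zero l = ≡.refl
ones-∷ (suc p) l = ones-∷ p (1 ∷ l)

length-ones : ∀ p l → length l ≤ length (ones p l)
length-ones zero l = ℕₚ.≤-refl
length-ones (suc p) l = ℕₚ.≤-trans (ℕₚ.n≤1+n _) (length-ones p (1 ∷ l))

ones-Pos : ∀ p {l} → Pos l → Pos (ones p l)
ones-Pos zero q = q
ones-Pos (suc p) q = ones-Pos p (s≤s z≤n ∷ q)

-- Every index is {1}^p or (k,n,{1}^p) with n ≥ 2. As p is the exponent of u in the generating
-- series, an identity of series settles all p at once.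
data TrailingOnes : Index → Set where
  only : ∀ p → TrailingOnes (ones p [])
  after : ∀ p n k → 2 ≤ n → Pos k → TrailingOnes (ones p (n ∷ k))

trailingOnes : ∀ {k} → Pos k → TrailingOnes k
trailingOnes {[]} [] = only 0
trailingOnes {suc (suc n) ∷ k} (_ ∷ ps) = after 0 _ k (s≤s (s≤s z≤n)) ps
trailingOnes {suc zero ∷ k} (_ ∷ ps) with trailingOnes ps
... | only p = ≡.subst TrailingOnes (ones-∷ p []) (only (suc p))
... | after p n k′ 2≤n pk = ≡.subst TrailingOnes (ones-∷ p (n ∷ k′)) (after (suc p) n k′ 2≤n pk)

-- Generating series attached to the recurrence

-- The recurrence c(k,n) m(∅,l) = m(k,(l,n)) + m((k,n),l) determines m from c = val. Both indices are stored reversed.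
module System {c ℓ : Level} (S : CommutativeRing c ℓ) (val : Index → CommutativeRing.Carrier S)
              (val-[] : CommutativeRing._≈_ S (val []) (CommutativeRing.1# S)) where
  open CommutativeRing S hiding (zero)
  open IntegerSolver S
  open PowerSeries S
  open import Relation.Binary.Reasoning.Setoid setoid
  private
    module Ser = CommutativeRing seriesRing
    module SerSolver = IntegerSolver seriesRing
  open Ser using () renaming (_+_ to _⊞_; _*_ to _⊠_; 1# to 𝟙)

  -- The value 0 at (k,∅) for non-empty k extends the recurrence to the empty zigzag: it then gives
  -- m(k,(n)) = c(k,n), the value of a bare chain.
  unit : Index → Carrier
  unit [] = 1#
  unit (_ ∷ _) = 0#

  m : Index → Index → Carrier
  m k [] = unit k
  m k (n ∷ l) = val (n ∷ k) * m [] l - m (n ∷ k) l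

  -- In the notation of the overview `C []` is E, `D []` is H, `Ξ k n []` is s(u) and `alt (Y [] l)`
  -- is t(u).
  C D : Index → ℕ → Carrier
  C k p = val (ones p k)
  D l p = m [] (ones p l)

  X Y : Index → Index → ℕ → Carrier
  X k l p = m k (ones p l)
  Y k l p = m (ones p k) l

  Ξ : Index → ℕ → Index → ℕ → Carrier
  Ξ k n l p = m k (n ∷ ones p l)

  -- Let a_i = m((k,{1}^i),(l,{1}^(p-i))). For i ≥ 1 the recurrence writes the i-th term of the
  -- product as (-1)^i (a_(i-1) + a_i), so the sum collapses to -a_0 and (-1)^p a_p. The term i = 0
  -- remains as it is.
  telescope : ∀ k l → alt (C k) ⊠ D l ≋ (λ p → (val k * D l p - X k l p) + alt (Y k l) p)
  telescope k l zero = solve 2 (λ a b → a := (a :- b) :+ b) refl _ _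
  telescope k l (suc p) = begin
    val k * D l (suc p) + conv (λ i → - alt (C (1 ∷ k)) i) (D l) p
      ≈⟨ +-congˡ (trans (conv-negˡ (alt (C (1 ∷ k))) (D l) p) (-‿cong (telescope (1 ∷ k) l p))) ⟩
    val k * D l (suc p) - ((val (1 ∷ k) * D l p - X (1 ∷ k) l p) + alt (Y (1 ∷ k) l) p)
      ≈⟨ solve 3 (λ a b c → a :- (b :+ c) := (a :- b) :+ (:- c)) refl _ _ _ ⟩
    (val k * D l (suc p) - m k (1 ∷ ones p l)) + - alt (Y (1 ∷ k) l) p
      ≈⟨ +-congʳ (+-congˡ (-‿cong (reflexive (≡.cong (m k) (ones-∷ p l))))) ⟨
    (val k * D l (suc p) - X k l (suc p)) + - alt (Y (1 ∷ k) l) p ∎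

  unit-ones-∷ : ∀ p n k → unit (ones p (n ∷ k)) ≈ 0#
  unit-ones-∷ zero n k = refl
  unit-ones-∷ (suc p) n k = unit-ones-∷ p 1 (n ∷ k)

  alt-Y-∷[] : ∀ n k → alt (Y (n ∷ k) []) ≋ (λ _ → 0#)
  alt-Y-∷[] n k p = trans (alt-cong (λ p → unit-ones-∷ p n k) p) (alt-zero p)

  -- Here the boundary term of `telescope` cancels, because val [] = 1 and `X [] l` is `D l`.
  C*D-[] : ∀ l → alt (C []) ⊠ D l ≋ alt (Y [] l)
  C*D-[] l p = begin
    (alt (C []) ⊠ D l) p                        ≈⟨ telescope [] l p ⟩
    (val [] * D l p - D l p) + alt (Y [] l) p   ≈⟨ +-congʳ (+-congʳ (trans (*-congʳ val-[]) (*-identityˡ _))) ⟩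
    (D l p - D l p) + alt (Y [] l) p            ≈⟨ solve 2 (λ a b → (a :- a) :+ b := b) refl _ _ ⟩
    alt (Y [] l) p                              ∎

  -- Here the boundary term of `telescope` is the defining expression of m(k,(l,{1}^p,n)).
  C*D-∷ : ∀ n k l → alt (C (n ∷ k)) ⊠ D l ≋ Ξ k n l ⊞ alt (Y (n ∷ k) l)
  C*D-∷ n k l = telescope (n ∷ k) l

  C*D-inverse : alt (C []) ⊠ D [] ≋ 𝟙
  C*D-inverse p = trans (C*D-[] [] p) (trans (alt-cong Y[][] p) (alt-const 1# p))
    where
    Y[][] : Y [] [] ≋ 𝟙
    Y[][] zero = refl
    Y[][] (suc p) = unit-ones-∷ p 1 []

  -- For empty l the Y-term of `C*D-∷` vanishes by `unit`; multiplication by `alt (C [])`, the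
  -- inverse of `D []`, then isolates the left factor.
  alt-C-∷ : ∀ n k → alt (C (n ∷ k)) ≋ alt (C []) ⊠ Ξ k n []
  alt-C-∷ n k = Ser.trans (Ser.sym (Ser.*-identityʳ _))
    (Ser.trans (Ser.*-congˡ {alt (C (n ∷ k))} (Ser.sym C*D-inverse))
    (Ser.trans (SerSolver.solve 3 (λ a b c → a SerSolver.:* (b SerSolver.:* c) SerSolver.:= b SerSolver.:* (a SerSolver.:* c)) Ser.refl
                 (alt (C (n ∷ k))) (alt (C [])) (D []))
    (Ser.*-congˡ {alt (C [])} (λ p → trans (C*D-∷ n k [] p) (trans (+-congˡ (alt-Y-∷[] n k p)) (+-identityʳ _))))))

  C-∷ : ∀ n k → C (n ∷ k) ≋ C [] ⊠ alt (Ξ k n [])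
  C-∷ n k = Ser.trans (Ser.sym (alt-involutive _)) (Ser.trans (alt-cong (alt-C-∷ n k))
    (Ser.trans (alt-* (alt (C [])) (Ξ k n [])) (Ser.*-congʳ {alt (Ξ k n [])} (alt-involutive (C [])))))

  D-factor : ∀ l → D l ≋ D [] ⊠ alt (Y [] l)
  D-factor l = Ser.trans (Ser.sym (Ser.*-identityʳ _))
    (Ser.trans (Ser.*-congˡ {D l} (Ser.sym C*D-inverse))
    (Ser.trans (SerSolver.solve 3 (λ a b c → a SerSolver.:* (b SerSolver.:* c) SerSolver.:= c SerSolver.:* (b SerSolver.:* a)) Ser.refl
                 (D l) (alt (C [])) (D []))
    (Ser.*-congˡ {D []} (C*D-[] l))))

  -- The product in `C*D-∷` is evaluated a second time by factoring both of its factors;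
  -- `alt (C [])` cancels against `D []`.
  factorisation : ∀ k n l → Ξ k n l ⊞ alt (Y (n ∷ k) l) ≋ Ξ k n [] ⊠ alt (Y [] l)
  factorisation k n l = Ser.trans (Ser.sym (C*D-∷ n k l))
    (Ser.trans (Ser.*-cong (alt-C-∷ n k) (D-factor l))
    (Ser.trans (SerSolver.solve 4 (λ a s h t → (a SerSolver.:* s) SerSolver.:* (h SerSolver.:* t) SerSolver.:= (a SerSolver.:* h) SerSolver.:* (s SerSolver.:* t)) Ser.refl
                 (alt (C [])) (Ξ k n []) (D []) (alt (Y [] l)))
    (Ser.trans (Ser.*-congʳ {Ξ k n [] ⊠ alt (Y [] l)} C*D-inverse) (Ser.*-identityˡ _))))

-- Propagation of agreement between two solutions of the recurrence

module Comparison {c ℓ : Level} (S : CommutativeRing c ℓ) (val₁ val₂ : Index → CommutativeRing.Carrier S)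
                  (val₁-[] : CommutativeRing._≈_ S (val₁ []) (CommutativeRing.1# S))
                  (val₂-[] : CommutativeRing._≈_ S (val₂ []) (CommutativeRing.1# S)) where
  open CommutativeRing S hiding (zero)
  open IntegerSolver S
  open PowerSeries S
  open import Relation.Binary.Reasoning.Setoid setoid
  private
    module S₁ = System S val₁ val₁-[]
    module S₂ = System S val₂ val₂-[]

  -- n ≥ 2 makes (l , n) admissible, so these values involve no regularisation.
  Agree : Set ℓ
  Agree = ∀ k n l → Pos k → 2 ≤ n → Pos l → S₁.m k (n ∷ l) ≈ S₂.m k (n ∷ l)

  private
    cancelʳ : ∀ a b a′ b′ → a + b ≈ a′ + b′ → b ≈ b′ → a ≈ a′
    cancelʳ a b a′ b′ p q = begin
      a              ≈⟨ solve 2 (λ a b → a := (a :+ b) :- b) refl a b ⟩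
      (a + b) - b    ≈⟨ +-cong p (-‿cong q) ⟩
      (a′ + b′) - b′ ≈⟨ solve 2 (λ a b → a := (a :+ b) :- b) refl a′ b′ ⟨
      a′             ∎

    factor-cong : ∀ k n l → S₁.Ξ k n [] ≋ S₂.Ξ k n [] → S₁.Y [] l ≋ S₂.Y [] l → ∀ p →
      S₁.Ξ k n l p + alt (S₁.Y (n ∷ k) l) p ≈ S₂.Ξ k n l p + alt (S₂.Y (n ∷ k) l) p
    factor-cong k n l e f p = trans (S₁.factorisation k n l p)
      (trans (conv-cong e (alt-cong f) p) (sym (S₂.factorisation k n l p)))

  -- Write l as (l′,n′,{1}^p). In `factorisation` for (l′,n′) the t-series and the Y-series only
  -- involve values with last zigzag entry n′ and shorter remainder l′, which are known by
  -- induction, and s is given; so the Ξ-series is determined. The bound N is needed because l′ is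
  -- reached through `trailingOnes`.
  agree-from-Ξ : (∀ k n → Pos k → 2 ≤ n → S₁.Ξ k n [] ≋ S₂.Ξ k n []) → Agree
  agree-from-Ξ hyp k n l pk 2≤n pl = go (length l) k n l ℕₚ.≤-refl pk 2≤n pl
    where
    go : ∀ N k n l → length l ≤ N → Pos k → 2 ≤ n → Pos l → S₁.m k (n ∷ l) ≈ S₂.m k (n ∷ l)
    go N k n l len pk 2≤n pl with trailingOnes pl
    ... | only p = hyp k n pk 2≤n p
    ... | after p n′ l′ 2≤n′ pl′ with N | ℕₚ.≤-trans (length-ones p (n′ ∷ l′)) len
    ...   | suc N | s≤s len′ = cancelʳ _ _ _ _ (factor-cong k n (n′ ∷ l′) (hyp k n pk 2≤n) (λ q → IH (ones-Pos q [])) p)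
                                     (alt-cong (λ q → IH (ones-Pos q (ℕₚ.≤-trans (s≤s z≤n) 2≤n ∷ pk))) p)
      where
      IH : ∀ {k′} → Pos k′ → S₁.m k′ (n′ ∷ l′) ≈ S₂.m k′ (n′ ∷ l′)
      IH pk′ = go N _ n′ l′ len′ pk′ 2≤n′ pl′

  -- The mirror image, with k written as (k′,n′,{1}^p): now t is given, the Ξ-series are known by
  -- induction on k, and the identity is solved for the Y-series, whose coefficient p is the wanted
  -- value up to sign.
  agree-from-Y : (∀ n l → 2 ≤ n → Pos l → S₁.Y [] (n ∷ l) ≋ S₂.Y [] (n ∷ l)) → Agree
  agree-from-Y hyp k n l pk 2≤n pl = go (length k) k n l ℕₚ.≤-refl pk 2≤n pl
    where
    go : ∀ N k n l → length k ≤ N → Pos k → 2 ≤ n → Pos l → S₁.m k (n ∷ l) ≈ S₂.m k (n ∷ l)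
    go N k n l len pk 2≤n pl with trailingOnes pk
    ... | only p = hyp n l 2≤n pl p
    ... | after p n′ k′ 2≤n′ pk′ with N | ℕₚ.≤-trans (length-ones p (n′ ∷ k′)) len
    ...   | suc N | s≤s len′ = trans (sym (alt-involutive (S₁.Y (n′ ∷ k′) (n ∷ l)) p))
                                 (trans (alt-cong eq p) (alt-involutive (S₂.Y (n′ ∷ k′) (n ∷ l)) p))
      where
      IH : ∀ {l′} → Pos l′ → S₁.m k′ (n′ ∷ l′) ≈ S₂.m k′ (n′ ∷ l′)
      IH pl′ = go N k′ n′ _ len′ pk′ 2≤n′ pl′
      eq : alt (S₁.Y (n′ ∷ k′) (n ∷ l)) ≋ alt (S₂.Y (n′ ∷ k′) (n ∷ l))
      eq q = cancelʳ _ _ _ _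
        (trans (+-comm _ _) (trans (factor-cong k′ n′ (n ∷ l) (λ r → IH (ones-Pos r [])) (hyp n l 2≤n pl) q) (+-comm _ _)))
        (IH (ones-Pos q (ℕₚ.≤-trans (s≤s z≤n) 2≤n ∷ pl)))

-- Coefficients of polynomials, of `rho`, and of exponentials and inverses of series

lookupD-++ˡ : ∀ {a} {A : Set a} (d : A) xs ys i → i < length xs → lookupD d (xs ++ ys) i ≡ lookupD d xs i
lookupD-++ˡ d (x ∷ xs) ys zero _ = ≡.refl
lookupD-++ˡ d (x ∷ xs) ys (suc i) (s≤s p) = lookupD-++ˡ d xs ys i p

lookupD-++ʳ : ∀ {a} {A : Set a} (d : A) xs ys i → lookupD d (xs ++ ys) (length xs ℕ.+ i) ≡ lookupD d ys i
lookupD-++ʳ d [] ys i = ≡.refl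
lookupD-++ʳ d (x ∷ xs) ys i = lookupD-++ʳ d xs ys i

module Coefficients {c ℓ : Level} (R : CommutativeRing c ℓ) (inv : ℕ → CommutativeRing.Carrier R) where
  open CommutativeRing R hiding (zero)
  open WithRing R inv
  open Summation R
  open PowerSeries R
  open IntegerSolver R

  coeff-padd : ∀ p q n → coeff (padd p q) n ≈ coeff p n + coeff q n
  coeff-padd [] q n = sym (+-identityˡ _)
  coeff-padd (a ∷ p) [] n = sym (+-identityʳ _)
  coeff-padd (a ∷ p) (b ∷ q) zero = refl
  coeff-padd (a ∷ p) (b ∷ q) (suc n) = coeff-padd p q n

  coeff-pscale : ∀ a p n → coeff (pscale a p) n ≈ a * coeff p n
  coeff-pscale a [] n = sym (zeroʳ a)
  coeff-pscale a (b ∷ p) zero = refl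
  coeff-pscale a (b ∷ p) (suc n) = coeff-pscale a p n

  coeff-pmul : ∀ p q → coeff (pmul p q) ≋ conv (coeff p) (coeff q)
  coeff-pmul [] q n = sym (conv-zeroˡ _ n)
  coeff-pmul (a ∷ p) q zero = trans (coeff-padd (pscale a q) _ 0) (trans (+-identityʳ _) (coeff-pscale a q 0))
  coeff-pmul (a ∷ p) q (suc n) = trans (coeff-padd (pscale a q) _ (suc n))
    (+-cong (coeff-pscale a q (suc n)) (coeff-pmul p q n))

  coeff-pconst : ∀ a → coeff (pconst a) ≋ const a
  coeff-pconst a zero = refl
  coeff-pconst a (suc n) = refl

  coeff-PΣ : ∀ F ws → coeff (PΣ F ws) ≋ Summation.∑ seriesRing ws (coeff ∘ F)
  coeff-PΣ F [] n = refl
  coeff-PΣ F (w ∷ ws) n = trans (coeff-padd (F w) _ n) (+-congˡ (coeff-PΣ F ws n))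

  coeff-beyond : ∀ p i → coeff p (length p ℕ.+ i) ≈ 0#
  coeff-beyond [] i = refl
  coeff-beyond (a ∷ p) i = coeff-beyond p i

  lookupD-applyUpTo : ∀ (f : ℕ → Carrier) n i → i < n → lookupD 0# (applyUpTo f n) i ≡ f i
  lookupD-applyUpTo f (suc n) zero _ = ≡.refl
  lookupD-applyUpTo f (suc n) (suc i) (s≤s p) = lookupD-applyUpTo (f ∘ suc) n i p

  lookupD-applyUpTo-≥ : ∀ (f : ℕ → Carrier) n i → n ≤ i → lookupD 0# (applyUpTo f n) i ≡ 0#
  lookupD-applyUpTo-≥ f zero i _ = ≡.refl
  lookupD-applyUpTo-≥ f (suc n) (suc i) (s≤s p) = lookupD-applyUpTo-≥ (f ∘ suc) n i p

  coeff-rhoMono : ∀ a m i → i ≤ m → coeff (rhoMono a m) i ≡ natR (ff m (m ∸ i)) * a (m ∸ i)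
  coeff-rhoMono a m i i≤m = ≡.trans
    (≡.cong (λ l → lookupD 0# l i) (Listₚ.map-applyUpTo id (λ i → natR (ff m (m ∸ i)) * a (m ∸ i)) (suc m)))
    (lookupD-applyUpTo (λ i → natR (ff m (m ∸ i)) * a (m ∸ i)) (suc m) i (s≤s i≤m))

  coeff-rhoMono-> : ∀ a m i → m < i → coeff (rhoMono a m) i ≡ 0#
  coeff-rhoMono-> a m i m<i = ≡.trans
    (≡.cong (λ l → lookupD 0# l i) (Listₚ.map-applyUpTo id (λ i → natR (ff m (m ∸ i)) * a (m ∸ i)) (suc m)))
    (lookupD-applyUpTo-≥ (λ i → natR (ff m (m ∸ i)) * a (m ∸ i)) (suc m) i m<i)

  coeff-rhoGo : ∀ a m p i →
    coeff (rhoGo a m p) i ≈ ∑ (upTo (length p)) (λ t → coeff p t * coeff (rhoMono a (m ℕ.+ t)) i)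
  coeff-rhoGo a m [] i = refl
  coeff-rhoGo a m (b ∷ p) i = trans (coeff-padd (pscale b (rhoMono a m)) (rhoGo a (suc m) p) i)
    (trans (+-cong (coeff-pscale b (rhoMono a m) i) (coeff-rhoGo a (suc m) p i))
    (trans (+-cong (*-congˡ (reflexive (≡.cong (λ j → coeff (rhoMono a j) i) (≡.sym (ℕₚ.+-identityʳ m)))))
                   (∑-cong (upTo (length p)) (λ t → *-congˡ (reflexive (≡.cong (λ j → coeff (rhoMono a j) i) (≡.sym (ℕₚ.+-suc m t)))))))
    (sym (reflexive (∑-upTo (length p) (λ t → coeff (b ∷ p) t * coeff (rhoMono a (m ℕ.+ t)) i))))))

  ∑-vanish : ∀ n {f : ℕ → Carrier} → (∀ i → i < n → f i ≈ 0#) → ∑ (upTo n) f ≈ 0#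
  ∑-vanish n h = trans (∑-upTo-cong n h) (∑-0 (upTo n))

  -- A coefficient list may be longer or shorter than n suggests, owing to trailing zeros. Both
  -- truncations are compared with the sum of length `length p + suc n`.
  coeff-rho : ∀ a p n i → (∀ t → n < t → coeff p t ≈ 0#) →
    coeff (rho a p) i ≈ ∑ (upTo (suc n)) (λ t → coeff p t * coeff (rhoMono a t) i)
  coeff-rho a p n i h = trans (coeff-rhoGo a 0 p i)
    (trans (sym (extend (length p) (suc n) (λ s → trans (*-congʳ (coeff-beyond p s)) (zeroˡ _))))
    (trans (reflexive (≡.cong (λ N → ∑ (upTo N) g) (ℕₚ.+-comm (length p) (suc n))))
    (extend (suc n) (length p) (λ s → trans (*-congʳ (h (suc n ℕ.+ s) (ℕₚ.m≤m+n (suc n) s))) (zeroˡ _)))))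
    where
    g : ℕ → Carrier
    g t = coeff p t * coeff (rhoMono a t) i
    extend : ∀ m d → (∀ s → g (m ℕ.+ s) ≈ 0#) → ∑ (upTo (m ℕ.+ d)) g ≈ ∑ (upTo m) g
    extend m d z = trans (∑-upTo-+ m d g) (trans (+-congˡ (∑-vanish d (λ s _ → z s))) (+-identityʳ _))

  natR-+ : ∀ m n → natR (m ℕ.+ n) ≈ natR m + natR n
  natR-+ zero n = sym (+-identityˡ _)
  natR-+ (suc m) n = trans (+-congˡ (natR-+ m n)) (sym (+-assoc _ _ _))

  natR-* : ∀ m n → natR (m ℕ.* n) ≈ natR m * natR n
  natR-* zero n = sym (zeroˡ _)
  natR-* (suc m) n = trans (natR-+ n (m ℕ.* n)) (trans (+-cong (sym (*-identityˡ _)) (natR-* m n)) (sym (distribʳ _ _ _)))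

  nat≡natR : ∀ n → nat n ≡ natR n
  nat≡natR zero = ≡.refl
  nat≡natR (suc n) = ≡.cong (1# +_) (nat≡natR n)

  alt≈psNeg : ∀ f → psNeg f ≋ alt f
  alt≈psNeg f zero = *-identityˡ _
  alt≈psNeg f (suc n) = trans (solve 2 (λ a b → :- a :* b := :- (a :* b)) refl _ _) (-‿cong (alt≈psNeg (f ∘ suc) n))

  psMul≈conv : ∀ f g → psMul f g ≋ conv f g
  psMul≈conv = conv-as-sum

  psOne≈const : psOne ≋ const 1#
  psOne≈const zero = refl
  psOne≈const (suc n) = refl

  length-invList : ∀ g n → length (invList g n) ≡ suc n
  length-invList g zero = ≡.refl
  length-invList g (suc n) = ≡.trans (Listₚ.length-++ (invList g n))
    (≡.trans (≡.cong (ℕ._+ 1) (length-invList g n)) (ℕₚ.+-comm (suc n) 1))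

  -- Each stage only appends to the previous one, so entries once computed never change.
  lookup-invList : ∀ g n i → i ≤ n → lookupD 0# (invList g n) i ≡ psInv g i
  lookup-invList g zero zero _ = ≡.refl
  lookup-invList g (suc n) i i≤ with i ℕ.≟ suc n
  ... | yes ≡.refl = ≡.refl
  ... | no i≢ = ≡.trans (lookupD-++ˡ 0# (invList g n) _ i (≡.subst (i <_) (≡.sym (length-invList g n)) i<))
                        (lookup-invList g n i (ℕₚ.≤-pred i<))
    where
    i< : i < suc n
    i< = ℕₚ.≤∧≢⇒< i≤ i≢

  psInv-suc : ∀ g n → psInv g (suc n) ≈ - conv (g ∘ suc) (psInv g) n
  psInv-suc g n = trans (reflexive last) (-‿cong (trans
    (∑-upTo-cong (suc n) (λ k _ → *-congˡ (reflexive (lookup-invList g n (n ∸ k) (ℕₚ.m∸n≤m n k)))))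
    (conv-as-sum (g ∘ suc) (psInv g) n)))
    where
    y : Carrier
    y = - ∑ (upTo (suc n)) (λ k → g (suc k) * lookupD 0# (invList g n) (n ∸ k))
    last : lookupD 0# (invList g n ++ y ∷ []) (suc n) ≡ y
    last = ≡.trans (≡.cong (lookupD 0# (invList g n ++ y ∷ []))
                     (≡.sym (≡.trans (ℕₚ.+-identityʳ _) (length-invList g n))))
                   (lookupD-++ʳ 0# (invList g n) (y ∷ []) 0)

  psInv-inverse : ∀ g → g 0 ≈ 1# → conv g (psInv g) ≋ const 1#
  psInv-inverse g g0 zero = trans (*-congʳ g0) (*-identityˡ _)
  psInv-inverse g g0 (suc n) = trans (+-congʳ (trans (*-congʳ g0) (trans (*-identityˡ _) (psInv-suc g n))))
    (-‿inverseˡ _)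

  conv-∑ : ∀ {A : Set} g (xs : List A) (h : A → ℕ → Carrier) n →
    conv g (λ i → ∑ xs (λ x → h x i)) n ≈ ∑ xs (λ x → conv g (h x) n)
  conv-∑ g [] h n = trans (conv-comm g _ n) (conv-zeroˡ g n)
  conv-∑ g (x ∷ xs) h n = trans (CommutativeRing.distribˡ seriesRing g (h x) _ n) (+-congˡ (conv-∑ g xs h n))

  conv-scaleʳ : ∀ a f g n → conv f (λ i → a * g i) n ≈ a * conv f g n
  conv-scaleʳ a f g n = trans (conv-comm f _ n) (trans (conv-scale a g f n) (*-congˡ (conv-comm g f n)))

  module Exponential (qalg : QAlg) (f : ℕ → Carrier) (f0 : f 0 ≈ 0#) where
    private module Ser = CommutativeRing seriesRing
    open import Relation.Binary.Reasoning.Setoid setoid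

    psPow-suc : ∀ j → psPow f (suc j) ≋ conv f (psPow f j)
    psPow-suc j = psMul≈conv f (psPow f j)

    -- f has no constant term, so f^j starts in degree j; this is why `psExp` may stop at j = n in
    -- degree n.
    psPow-vanish : ∀ j n → n < j → psPow f j n ≈ 0#
    psPow-vanish (suc j) zero _ = trans (psPow-suc j 0) (trans (*-congʳ f0) (zeroˡ _))
    psPow-vanish (suc j) (suc n) (s≤s n<j) = begin
      psPow f (suc j) (suc n)                                   ≈⟨ psPow-suc j (suc n) ⟩
      f 0 * psPow f j (suc n) + conv (f ∘ suc) (psPow f j) n    ≈⟨ +-cong (trans (*-congʳ f0) (zeroˡ _))
          (conv-cong-≤ n (λ _ _ → refl) (λ i i≤n → psPow-vanish j i (ℕₚ.≤-<-trans i≤n n<j))) ⟩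
      0# + conv (f ∘ suc) (λ _ → 0#) n                          ≈⟨ +-identityˡ _ ⟩
      conv (f ∘ suc) (λ _ → 0#) n                               ≈⟨ trans (conv-comm (f ∘ suc) _ n) (conv-zeroˡ _ n) ⟩
      0#                                                        ∎

    -- The power rule and its companion `f*θ-psPow` are proved by mutual induction. The companion
    -- carries the extra factor f so that the exponent j - 1 never appears.
    θ-psPow-suc : ∀ j → θ (psPow f (suc j)) ≋ (λ n → nat (suc j) * conv (θ f) (psPow f j) n)
    f*θ-psPow : ∀ j → conv f (θ (psPow f j)) ≋ (λ n → nat j * conv (θ f) (psPow f j) n)

    θ-psPow-suc j n = begin
      θ (psPow f (suc j)) n
        ≈⟨ θ-cong (psPow-suc j) n ⟩
      θ (conv f (psPow f j)) n
        ≈⟨ θ-* f (psPow f j) n ⟩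
      conv (θ f) (psPow f j) n + conv f (θ (psPow f j)) n
        ≈⟨ +-cong (sym (*-identityˡ _)) (f*θ-psPow j n) ⟩
      1# * conv (θ f) (psPow f j) n + nat j * conv (θ f) (psPow f j) n
        ≈⟨ distribʳ _ _ _ ⟨
      nat (suc j) * conv (θ f) (psPow f j) n ∎

    f*θ-psPow zero n = begin
      conv f (θ psOne) n       ≈⟨ conv-cong {f} (λ _ → refl) (λ i → trans (θ-cong psOne≈const i) (θ-one i)) n ⟩
      conv f (λ _ → 0#) n      ≈⟨ trans (conv-comm f _ n) (conv-zeroˡ _ n) ⟩
      0#                       ≈⟨ zeroˡ _ ⟨
      0# * conv (θ f) psOne n  ∎
    f*θ-psPow (suc j) n = begin
      conv f (θ (psPow f (suc j))) n
        ≈⟨ conv-cong {f} (λ _ → refl) (θ-psPow-suc j) n ⟩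
      conv f (λ i → nat (suc j) * conv (θ f) (psPow f j) i) n
        ≈⟨ conv-scaleʳ (nat (suc j)) f _ n ⟩
      nat (suc j) * conv f (conv (θ f) (psPow f j)) n
        ≈⟨ *-congˡ (trans (sym (conv-assoc f (θ f) (psPow f j) n))
                  (trans (conv-cong (conv-comm f (θ f)) (λ _ → refl) n) (conv-assoc (θ f) f (psPow f j) n))) ⟩
      nat (suc j) * conv (θ f) (conv f (psPow f j)) n
        ≈⟨ *-congˡ (conv-cong {θ f} (λ _ → refl) (psPow-suc j) n) ⟨
      nat (suc j) * conv (θ f) (psPow f (suc j)) n ∎

    -- `psExp` truncates at a bound that depends on the degree, which suits neither `θ` nor `conv`;
    -- here the number of terms is the same in every degree.
    partial : ℕ → ℕ → Carrier
    partial J n = ∑ (upTo J) (λ j → invFact j * psPow f j n)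

    partial-≥ : ∀ J n → n < J → partial J n ≈ psExp f n
    partial-≥ J n n<J = begin
      partial J n                             ≡⟨ ≡.cong (λ N → partial N n) (ℕₚ.m+[n∸m]≡n n<J) ⟨
      partial (suc n ℕ.+ (J ∸ suc n)) n       ≈⟨ ∑-upTo-+ (suc n) (J ∸ suc n) _ ⟩
      psExp f n + ∑ (upTo (J ∸ suc n)) (λ i → invFact (suc n ℕ.+ i) * psPow f (suc n ℕ.+ i) n)
        ≈⟨ +-congˡ (∑-vanish (J ∸ suc n) (λ i _ → trans (*-congˡ (psPow-vanish _ n (ℕₚ.m≤m+n (suc n) i))) (zeroʳ _))) ⟩
      psExp f n + 0#                          ≈⟨ +-identityʳ _ ⟩
      psExp f n                               ∎

    -- `θ` annihilates the term j = 0 and sends term j + 1 to θf times term j, so one summand is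
    -- lost.
    θ-partial : ∀ J n → θ (partial (suc J)) n ≈ conv (θ f) (partial J) n
    θ-partial J n = begin
      nat n * partial (suc J) n
        ≈⟨ *-congˡ (reflexive (∑-upTo J (λ j → invFact j * psPow f j n))) ⟩
      nat n * (1# * psOne n + ∑ (upTo J) (λ j → invFact (suc j) * psPow f (suc j) n))
        ≈⟨ distribˡ _ _ _ ⟩
      nat n * (1# * psOne n) + nat n * ∑ (upTo J) (λ j → invFact (suc j) * psPow f (suc j) n)
        ≈⟨ +-cong (trans (*-congˡ (*-identityˡ _)) (trans (θ-cong psOne≈const n) (θ-one n))) (sym (∑-*ˡ (nat n) (upTo J) _)) ⟩
      0# + ∑ (upTo J) (λ j → nat n * (invFact (suc j) * psPow f (suc j) n))
        ≈⟨ +-identityˡ _ ⟩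
      ∑ (upTo J) (λ j → nat n * (invFact (suc j) * psPow f (suc j) n))
        ≈⟨ ∑-cong (upTo J) term ⟩
      ∑ (upTo J) (λ j → conv (θ f) (λ i → invFact j * psPow f j i) n)
        ≈⟨ conv-∑ (θ f) (upTo J) _ n ⟨
      conv (θ f) (partial J) n ∎
      where
      term : ∀ j → nat n * (invFact (suc j) * psPow f (suc j) n) ≈ conv (θ f) (λ i → invFact j * psPow f j i) n
      term j = begin
        nat n * ((inv j * invFact j) * psPow f (suc j) n)
          ≈⟨ solve 4 (λ a b c d → a :* ((b :* c) :* d) := b :* c :* (a :* d)) refl _ _ _ _ ⟩
        inv j * invFact j * θ (psPow f (suc j)) n
          ≈⟨ *-congˡ (θ-psPow-suc j n) ⟩
        inv j * invFact j * (nat (suc j) * conv (θ f) (psPow f j) n)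
          ≈⟨ solve 4 (λ a b c d → a :* b :* (c :* d) := (c :* a) :* (b :* d)) refl _ _ _ _ ⟩
        nat (suc j) * inv j * (invFact j * conv (θ f) (psPow f j) n)
          ≈⟨ *-congʳ (trans (*-congʳ (reflexive (nat≡natR (suc j)))) (qalg j)) ⟩
        1# * (invFact j * conv (θ f) (psPow f j) n)
          ≈⟨ *-identityˡ _ ⟩
        invFact j * conv (θ f) (psPow f j) n
          ≈⟨ conv-scaleʳ (invFact j) (θ f) (psPow f j) n ⟨
        conv (θ f) (λ i → invFact j * psPow f j i) n ∎

    θ-psExp : θ (psExp f) ≋ conv (θ f) (psExp f)
    θ-psExp zero = trans (zeroˡ _) (sym (trans (*-congʳ (zeroˡ _)) (zeroˡ _)))
    θ-psExp (suc n) = trans (θ-partial (suc n) (suc n)) (+-cong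
      (trans (*-congʳ (zeroˡ _)) (trans (zeroˡ _) (sym (trans (*-congʳ (zeroˡ _)) (zeroˡ _)))))
      (conv-cong-≤ n (λ _ _ → refl) (λ i i≤n → partial-≥ (suc n) i (s≤s i≤n))))

    psExp-0 : psExp f 0 ≈ 1#
    psExp-0 = trans (+-identityʳ _) (*-identityˡ _)

    -- Differentiating A B = 1 gives θB = - B (θA) B; inserting θA = (θf) A and cancelling A B
    -- leaves - (θf) B.
    θ-psInv-psExp : θ (psInv (psExp f)) ≋ (λ n → - conv (θ f) (psInv (psExp f)) n)
    θ-psInv-psExp = Ser.trans (Ser.sym (Ser.*-identityˡ _))
      (Ser.trans (Ser.*-congʳ {θ B} (Ser.sym AB))
      (Ser.trans (SerSolver.solve 4 (λ a b t s → (a SerSolver.:* b) SerSolver.:* t SerSolver.:=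
                     b SerSolver.:* ((s SerSolver.:* b) SerSolver.:+ (a SerSolver.:* t)) SerSolver.:- b SerSolver.:* (s SerSolver.:* b)) Ser.refl Aₑ B (θ B) (θ Aₑ))
      (Ser.trans (Ser.+-cong (Ser.trans (Ser.*-congˡ {B} (Ser.trans (Ser.sym (θ-* Aₑ B)) (Ser.trans (θ-cong AB) θ-one))) (Ser.zeroʳ B))
                             (Ser.-‿cong (Ser.*-congˡ {B} (Ser.*-congʳ {B} θ-psExp))))
      (Ser.trans (Ser.+-identityˡ _)
      (Ser.-‿cong (Ser.trans (SerSolver.solve 3 (λ a b t → b SerSolver.:* ((t SerSolver.:* a) SerSolver.:* b) SerSolver.:= (a SerSolver.:* b) SerSolver.:* (t SerSolver.:* b)) Ser.refl Aₑ B (θ f))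
                  (Ser.trans (Ser.*-congʳ {conv (θ f) B} AB) (Ser.*-identityˡ _))))))))
      where
      module SerSolver = IntegerSolver seriesRing
      Aₑ B : ℕ → Carrier
      Aₑ = psExp f
      B = psInv (psExp f)
      AB : conv Aₑ B ≋ const 1#
      AB = psInv-inverse Aₑ psExp-0

-- The series b(u) e^{Tu} and the action of `rho` on them

-- Series in u whose coefficients are series in T: polynomials in T are compared through their coefficients.
module ExponentialSeries {c ℓ : Level} (R : CommutativeRing c ℓ) (inv : ℕ → CommutativeRing.Carrier R)
                         (qalg : WithRing.QAlg R inv) where
  open CommutativeRing R hiding (zero)
  open WithRing R inv
  open Coefficients R inv
  open Summation R
  open IntegerSolver R
  open import Algebra.Properties.Ring ring using (-0#≈0#)
  open import Relation.Binary.Reasoning.Setoid setoid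

  module P = PowerSeries R
  module Pr = CommutativeRing P.seriesRing
  module P₂ = PowerSeries P.seriesRing
  module P₂r = CommutativeRing P₂.seriesRing
  open P using (_≋_; conv; const; alt; nat) public

  const-cong : ∀ {a b} → a ≈ b → const a ≋ const b
  const-cong p zero = p
  const-cong p (suc n) = refl

  const-+ : ∀ a b → const (a + b) ≋ const a Pr.+ const b
  const-+ a b zero = refl
  const-+ a b (suc n) = sym (+-identityˡ 0#)

  const-* : ∀ a b → const (a * b) ≋ conv (const a) (const b)
  const-* a b zero = sym (P.conv-constˡ a (const b) 0)
  const-* a b (suc n) = sym (trans (P.conv-constˡ a (const b) (suc n)) (zeroʳ a))

  const-neg : ∀ a → const (- a) ≋ Pr.- const a
  const-neg a zero = refl
  const-neg a (suc n) = sym -0#≈0#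

  const-zero : const 0# ≋ Pr.0#
  const-zero zero = refl
  const-zero (suc n) = refl

  const-nat : ∀ n → P₂.nat n ≋ const (nat n)
  const-nat zero = Pr.sym const-zero
  const-nat (suc n) = Pr.trans (Pr.+-congˡ {const 1#} (const-nat n)) (Pr.sym (const-+ 1# (nat n)))

  natInv : ℕ → ℕ → Carrier
  natInv n = const (inv n)

  nat-inverse : ∀ n → P₂.nat (suc n) Pr.* natInv n ≋ const 1#
  nat-inverse n = Pr.trans (Pr.*-congʳ {natInv n} (const-nat (suc n)))
    (Pr.trans (Pr.sym (const-* (nat (suc n)) (inv n)))
              (const-cong (trans (*-congʳ (reflexive (nat≡natR (suc n)))) (qalg n))))

  ι : (ℕ → Carrier) → ℕ → ℕ → Carrier
  ι f n = const (f n)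

  ι-cong : ∀ {f g} → f ≋ g → ι f P₂.≋ ι g
  ι-cong p n = const-cong (p n)

  ι-* : ∀ f g → ι (conv f g) P₂.≋ P₂.conv (ι f) (ι g)
  ι-* f g zero = const-* (f 0) (g 0)
  ι-* f g (suc n) = Pr.trans (const-+ _ _) (Pr.+-cong (const-* (f 0) (g (suc n))) (ι-* (f ∘ suc) g n))

  ι-neg : ∀ f → ι (λ n → - f n) P₂.≋ P₂r.- ι f
  ι-neg f n = const-neg (f n)

  ι-alt : ∀ f → ι (alt f) P₂.≋ P₂.alt (ι f)
  ι-alt f zero = Pr.refl
  ι-alt f (suc n) = Pr.trans (const-neg (alt (f ∘ suc) n)) (Pr.-‿cong (ι-alt (f ∘ suc) n))

  ι-θ : ∀ f → ι (P.θ f) P₂.≋ P₂.θ (ι f)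
  ι-θ f n = Pr.trans (const-* (nat n) (f n)) (Pr.*-congʳ {const (f n)} (Pr.sym (const-nat n)))

  ι-one : ι (const 1#) P₂.≋ P₂r.1#
  ι-one zero = Pr.refl
  ι-one (suc n) = const-zero

  -- Multiplication by T, as `T-conv` confirms; hence `mono n a` is a T^n.
  raise : (ℕ → Carrier) → ℕ → Carrier
  raise f zero = 0#
  raise f (suc j) = f j

  raise-conv : ∀ f g → conv (raise f) g ≋ raise (conv f g)
  raise-conv f g zero = zeroˡ _
  raise-conv f g (suc n) = trans (+-congʳ (zeroˡ _)) (+-identityˡ _)

  raise-cong : ∀ {f g} → f ≋ g → raise f ≋ raise g
  raise-cong p zero = refl
  raise-cong p (suc n) = p n

  mono : ℕ → Carrier → ℕ → Carrier
  mono zero a = const a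
  mono (suc n) a = raise (mono n a)

  mono-scale : ∀ n a b → conv (const a) (mono n b) ≋ mono n (a * b)
  mono-scale zero a b = Pr.sym (const-* a b)
  mono-scale (suc n) a b = Pr.trans (P.conv-comm (const a) _) (Pr.trans (raise-conv (mono n b) (const a))
    (raise-cong (Pr.trans (P.conv-comm (mono n b) (const a)) (mono-scale n a b))))

  mono-cong : ∀ n {a b} → a ≈ b → mono n a ≋ mono n b
  mono-cong zero p = const-cong p
  mono-cong (suc n) p = raise-cong (mono-cong n p)

  T : ℕ → Carrier
  T = coeff Tpoly

  T-conv : ∀ f → conv T f ≋ raise f
  T-conv f zero = zeroˡ _
  T-conv f (suc n) = trans (+-cong (zeroˡ _) (trans (P.conv-cong {T ∘ suc} {const 1#} T-suc (λ _ → refl) n) (P.conv-oneˡ f n))) (+-identityˡ _)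
    where
    T-suc : T ∘ suc ≋ const 1#
    T-suc zero = refl
    T-suc (suc n) = refl

  exp-T : ℕ → ℕ → Carrier
  exp-T n = mono n (invFact n)

  -- The series T u, with T in degree one: the logarithmic derivative of e^{Tu} with respect to `θ`.
  uT : ℕ → ℕ → Carrier
  uT zero = Pr.0#
  uT (suc n) = P₂.const T n

  θ-exp-T : P₂.θ exp-T P₂.≋ P₂.conv uT exp-T
  θ-exp-T zero = Pr.trans (Pr.zeroˡ _) (Pr.sym (Pr.zeroˡ _))
  θ-exp-T (suc n) = Pr.trans (Pr.*-congʳ {mono (suc n) _} (const-nat (suc n)))
    (Pr.trans (mono-scale (suc n) (nat (suc n)) (inv n * invFact n))
    (Pr.trans (mono-cong (suc n) (trans (sym (*-assoc _ _ _)) (trans (*-congʳ (trans (*-congʳ (reflexive (nat≡natR (suc n)))) (qalg n))) (*-identityˡ _))))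
    (Pr.trans (Pr.sym (T-conv (exp-T n)))
    (Pr.trans (Pr.sym (P₂.conv-constˡ T exp-T n))
    (Pr.sym (Pr.trans (Pr.+-congʳ {P₂.conv (P₂.const T) exp-T n} (Pr.zeroˡ (exp-T (suc n)))) (Pr.+-identityˡ _)))))))

  -- The tool behind the closed forms of `C []` on both sides and behind `exp-T-inverse`.
  unique : ∀ q X Y → q 0 ≋ Pr.0# → X 0 ≋ Y 0 → P₂.θ X P₂.≋ P₂.conv q X → P₂.θ Y P₂.≋ P₂.conv q Y → X P₂.≋ Y
  unique = P₂.θ-unique natInv nat-inverse

  -- Both sides have constant coefficient 1 and are annihilated by `θ`: the logarithmic derivatives
  -- of the two exponentials are opposite.
  exp-T-inverse : P₂.conv (P₂.alt exp-T) exp-T P₂.≋ P₂r.1#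
  exp-T-inverse = unique P₂r.0# _ _ Pr.refl (P.conv-oneˡ (const 1#))
    (P₂r.trans (P₂.θ-* (P₂.alt exp-T) exp-T)
    (P₂r.trans (P₂r.+-cong (P₂r.*-congʳ {exp-T} (P₂r.trans (P₂.θ-alt exp-T) (P₂r.trans (P₂.alt-cong θ-exp-T)
                  (P₂r.trans (P₂.alt-* uT exp-T) (P₂r.*-congʳ {P₂.alt exp-T} alt-uT)))))
                (P₂r.*-congˡ {P₂.alt exp-T} θ-exp-T))
    (P₂r.trans (S₂.solve 3 (λ u a e → (S₂.:- u S₂.:* a) S₂.:* e S₂.:+ a S₂.:* (u S₂.:* e) S₂.:= a S₂.:* e S₂.:- a S₂.:* e) P₂r.refl uT (P₂.alt exp-T) exp-T)
    (P₂r.trans (P₂r.-‿inverseʳ _) (P₂r.sym (P₂r.zeroˡ _))))))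
    (P₂r.trans P₂.θ-one (P₂r.sym (P₂r.zeroˡ _)))
    where
    module S₂ = IntegerSolver P₂.seriesRing
    alt-uT : P₂.alt uT P₂.≋ P₂r.- uT
    alt-uT zero = λ j → sym -0#≈0#
    alt-uT (suc n) = Pr.-‿cong (P₂.alt-const T n)

  -- the coefficient of Tʲ uⁿ in b(u) e^{Tu} is b_{n-j} / j! for j ≤ n, and 0 otherwise
  scaledExp : (ℕ → Carrier) → (ℕ → Carrier) → ℕ → ℕ → Carrier
  scaledExp e b n zero = e 0 * b n
  scaledExp e b zero (suc j) = 0#
  scaledExp e b (suc n) (suc j) = scaledExp (e ∘ suc) b n j

  scaledExp-> : ∀ e b n j → n < j → scaledExp e b n j ≈ 0#
  scaledExp-> e b zero (suc j) _ = refl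
  scaledExp-> e b (suc n) (suc j) (s≤s p) = scaledExp-> (e ∘ suc) b n j p

  scaledExp-+ : ∀ e b j d → scaledExp e b (j ℕ.+ d) j ≈ e j * b d
  scaledExp-+ e b zero d = refl
  scaledExp-+ e b (suc j) d = scaledExp-+ (e ∘ suc) b j d

  raise-conv₂ : ∀ F g n → P₂.conv (raise ∘ F) g n ≋ raise (P₂.conv F g n)
  raise-conv₂ F g zero = raise-conv (F 0) (g 0)
  raise-conv₂ F g (suc n) j = trans (+-cong (raise-conv (F 0) (g (suc n)) j) (raise-conv₂ (F ∘ suc) g n j)) (raise-+ j)
    where
    raise-+ : ∀ {f g} j → raise f j + raise g j ≈ raise (λ i → f i + g i) j
    raise-+ zero = +-identityˡ _
    raise-+ (suc j) = refl

  -- The coefficients 1/i! are replaced by an arbitrary `e` since the induction shifts them: without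
  -- its first term, the series is T u times one of the same kind.
  conv-scaledExp : ∀ e b n j → P₂.conv (λ i → mono i (e i)) (ι b) n j ≈ scaledExp e b n j
  conv-scaledExp e b zero zero = P.conv-constˡ (e 0) (const (b 0)) 0
  conv-scaledExp e b zero (suc j) = trans (P.conv-constˡ (e 0) (const (b 0)) (suc j)) (zeroʳ _)
  conv-scaledExp e b (suc n) zero = trans (+-cong (P.conv-constˡ (e 0) (const (b (suc n))) 0)
    (raise-conv₂ (λ i → mono i (e (suc i))) (ι b) n 0)) (+-identityʳ _)
  conv-scaledExp e b (suc n) (suc j) = trans (+-cong
    (trans (P.conv-constˡ (e 0) (const (b (suc n))) (suc j)) (zeroʳ _))
    (trans (raise-conv₂ (λ i → mono i (e (suc i))) (ι b) n (suc j)) (conv-scaledExp (e ∘ suc) b n j)))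
    (+-identityˡ _)

  _·exp-T : (ℕ → Carrier) → ℕ → ℕ → Carrier
  b ·exp-T = P₂.conv (ι b) exp-T

  ·exp-T-cong : ∀ {a b} → a ≋ b → a ·exp-T P₂.≋ b ·exp-T
  ·exp-T-cong p = P₂r.*-congʳ {exp-T} (ι-cong p)

  ·exp-T-coeff : ∀ b n j → (b ·exp-T) n j ≈ scaledExp invFact b n j
  ·exp-T-coeff b n j = trans (P₂.conv-comm (ι b) exp-T n j) (conv-scaledExp invFact b n j)

  -- At T = 0 the factor e^{Tu} becomes 1.
  ·exp-T-injective : ∀ {a b} → a ·exp-T P₂.≋ b ·exp-T → a ≋ b
  ·exp-T-injective {a} {b} p n = trans (sym (at a)) (trans (p n 0) (at b))
    where
    at : ∀ b → (b ·exp-T) n 0 ≈ b n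
    at b = trans (·exp-T-coeff b n 0) (*-identityˡ _)

  invFact-ff : ∀ i s → invFact (i ℕ.+ s) * natR (ff (i ℕ.+ s) s) ≈ invFact i
  invFact-ff i zero rewrite ℕₚ.+-identityʳ i = trans (*-congˡ (+-identityʳ 1#)) (*-identityʳ _)
  invFact-ff i (suc s) rewrite ℕₚ.+-suc i s = begin
    inv n * invFact n * natR (suc n ℕ.* ff n s)        ≈⟨ *-congˡ (natR-* (suc n) (ff n s)) ⟩
    inv n * invFact n * (natR (suc n) * natR (ff n s)) ≈⟨ solve 4 (λ a b c d → a :* b :* (c :* d) := (c :* a) :* (b :* d)) refl _ _ _ _ ⟩
    natR (suc n) * inv n * (invFact n * natR (ff n s)) ≈⟨ *-cong (qalg n) (invFact-ff i s) ⟩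
    1# * invFact i                                     ≈⟨ *-identityˡ _ ⟩
    invFact i                                          ∎
    where
    n : ℕ
    n = i ℕ.+ s

  -- Multiplication by the T-free series b commutes with ρ_a, which multiplies e^{Tu} by a. Since
  -- `rho` is defined on powers of T, this is verified on the coefficients of the polynomial p in
  -- degree n of u.
  rho-·exp-T : ∀ a b n p → coeff p ≋ (b ·exp-T) n → coeff (rho a p) ≋ (conv a b ·exp-T) n
  rho-·exp-T a b n p hp i with i ℕ.≤? n
  ... | no i≰n = begin
      coeff (rho a p) i
        ≈⟨ coeff-rho a p n i p-> ⟩
      ∑ (upTo (suc n)) (λ t → coeff p t * coeff (rhoMono a t) i)
        ≈⟨ ∑-vanish (suc n) (λ t t≤n → trans (*-congˡ (reflexive (coeff-rhoMono-> a t i (ℕₚ.≤-trans t≤n n<i)))) (zeroʳ _)) ⟩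
      0#
        ≈⟨ trans (·exp-T-coeff (conv a b) n i) (scaledExp-> invFact (conv a b) n i n<i) ⟨
      (conv a b ·exp-T) n i ∎
    where
    n<i : n < i
    n<i = ℕₚ.≰⇒> i≰n
    p-> : ∀ t → n < t → coeff p t ≈ 0#
    p-> t n<t = trans (hp t) (trans (·exp-T-coeff b n t) (scaledExp-> invFact b n t n<t))
  -- With n = i + d, only the powers T^(i+s) with s ≤ d contribute to T^i; their contributions form
  -- the Cauchy product of a and b in degree d, divided by i!.
  ... | yes i≤n with n ∸ i | ℕₚ.m+[n∸m]≡n i≤n
  ...   | d | ≡.refl = begin
      coeff (rho a p) i
        ≈⟨ coeff-rho a p n i p-> ⟩
      ∑ (upTo (suc n)) g
        ≡⟨ ≡.cong (λ N → ∑ (upTo N) g) (≡.sym (ℕₚ.+-suc i d)) ⟩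
      ∑ (upTo (i ℕ.+ suc d)) g
        ≈⟨ ∑-upTo-+ i (suc d) g ⟩
      ∑ (upTo i) g + ∑ (upTo (suc d)) (λ s → g (i ℕ.+ s))
        ≈⟨ +-cong (∑-vanish i (λ t t<i → trans (*-congˡ (reflexive (coeff-rhoMono-> a t i t<i))) (zeroʳ _)))
                  (∑-upTo-cong (suc d) term) ⟩
      0# + ∑ (upTo (suc d)) (λ s → invFact i * (a s * b (d ∸ s)))
        ≈⟨ +-identityˡ _ ⟩
      ∑ (upTo (suc d)) (λ s → invFact i * (a s * b (d ∸ s)))
        ≈⟨ ∑-*ˡ (invFact i) (upTo (suc d)) (λ s → a s * b (d ∸ s)) ⟩
      invFact i * ∑ (upTo (suc d)) (λ s → a s * b (d ∸ s))
        ≈⟨ *-congˡ (P.conv-as-sum a b d) ⟩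
      invFact i * conv a b d
        ≈⟨ trans (·exp-T-coeff (conv a b) n i) (scaledExp-+ invFact (conv a b) i d) ⟨
      (conv a b ·exp-T) n i ∎
    where
    g : ℕ → Carrier
    g t = coeff p t * coeff (rhoMono a t) i
    p-> : ∀ t → n < t → coeff p t ≈ 0#
    p-> t n<t = trans (hp t) (trans (·exp-T-coeff b n t) (scaledExp-> invFact b n t n<t))
    term : ∀ s → s < suc d → g (i ℕ.+ s) ≈ invFact i * (a s * b (d ∸ s))
    term s (s≤s s≤d) = begin
      coeff p (i ℕ.+ s) * coeff (rhoMono a (i ℕ.+ s)) i
        ≈⟨ *-cong (trans (hp (i ℕ.+ s)) (trans (·exp-T-coeff b n (i ℕ.+ s)) split))
                  (reflexive (≡.trans (coeff-rhoMono a (i ℕ.+ s) i (ℕₚ.m≤m+n i s))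
                     (≡.cong (λ r → natR (ff (i ℕ.+ s) r) * a r) (ℕₚ.m+n∸m≡n i s)))) ⟩
      invFact (i ℕ.+ s) * b (d ∸ s) * (natR (ff (i ℕ.+ s) s) * a s)
        ≈⟨ solve 4 (λ e b f a → e :* b :* (f :* a) := (e :* f) :* (a :* b)) refl _ _ _ _ ⟩
      invFact (i ℕ.+ s) * natR (ff (i ℕ.+ s) s) * (a s * b (d ∸ s))
        ≈⟨ *-congʳ (invFact-ff i s) ⟩
      invFact i * (a s * b (d ∸ s)) ∎
      where
      split : scaledExp invFact b n (i ℕ.+ s) ≈ invFact (i ℕ.+ s) * b (d ∸ s)
      split = trans (reflexive (≡.cong (λ N → scaledExp invFact b N (i ℕ.+ s))
                (≡.trans (≡.cong (i ℕ.+_) (≡.sym (ℕₚ.m+[n∸m]≡n s≤d))) (≡.sym (ℕₚ.+-assoc i s (d ∸ s))))))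
              (scaledExp-+ invFact b (i ℕ.+ s) (d ∸ s))

-- The harmonic product, the star operation and Newton's identities

har-[]ʳ : ∀ k → har k [] ≡ k ∷ []
har-[]ʳ [] = ≡.refl
har-[]ʳ (a ∷ k) = ≡.refl

har-Pos : ∀ {k l} → Pos k → Pos l → All Pos (har k l)
har-Pos [] pl = pl ∷ []
har-Pos (pa ∷ pk) [] = (pa ∷ pk) ∷ []
har-Pos (pa ∷ pk) (pb ∷ pl) = Allₚ.++⁺ (Allₚ.map⁺ (All.map (pa ∷_) (har-Pos pk (pb ∷ pl))))
  (Allₚ.++⁺ (Allₚ.map⁺ (All.map (pb ∷_) (har-Pos (pa ∷ pk) pl)))
            (Allₚ.map⁺ (All.map (ℕₚ.≤-trans pa (ℕₚ.m≤m+n _ _) ∷_) (har-Pos pk pl))))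

snoc-Pos : ∀ {k n} → Pos k → 1 ≤ n → Pos (k ∷ʳ n)
snoc-Pos pk pn = Allₚ.++⁺ pk (pn ∷ [])

reverse-Pos : ∀ {k} → Pos k → Pos (reverse k)
reverse-Pos {k} pk = ↭ₚ.All-resp-↭ (↭-sym (↭ₚ.↭-reverse k)) pk

snoc-Adm : ∀ {k n} → Pos k → 2 ≤ n → Adm (k ∷ʳ n)
snoc-Adm {[]} [] 2≤n = 2≤n
snoc-Adm {a ∷ []} (pa ∷ []) 2≤n = pa , 2≤n
snoc-Adm {a ∷ b ∷ k} (pa ∷ pk) 2≤n = pa , snoc-Adm pk 2≤n

-- The terms of the star sum with their last entry detached, because the recurrence and the product
-- ⊛ both act on last entries.
starSplit : ℕ → Index → List (Index × ℕ)
starSplit a [] = ([] , a) ∷ []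
starSplit a (b ∷ r) = map (λ p → (a ∷ proj₁ p , proj₂ p)) (starSplit b r) ++ starSplit (a ℕ.+ b) r

join : Index × ℕ → Index
join (v , n) = v ∷ʳ n

starAux-join : ∀ a r → starAux a r ≡ map join (starSplit a r)
starAux-join a [] = ≡.refl
starAux-join a (b ∷ r) = ≡.trans
  (≡.cong₂ _++_ (≡.trans (≡.cong (map (a ∷_)) (starAux-join b r))
                (≡.trans (≡.sym (Listₚ.map-∘ (starSplit b r))) (Listₚ.map-∘ (starSplit b r))))
                (starAux-join (a ℕ.+ b) r))
  (≡.sym (Listₚ.map-++ join _ (starSplit (a ℕ.+ b) r)))

starSplit-Pos : ∀ {a r} → 1 ≤ a → Pos r → All (λ p → Pos (proj₁ p) × 1 ≤ proj₂ p) (starSplit a r)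
starSplit-Pos pa [] = ([] , pa) ∷ []
starSplit-Pos pa (pb ∷ pr) = Allₚ.++⁺
  (Allₚ.map⁺ (All.map (λ { (pv , pn) → (pa ∷ pv) , pn }) (starSplit-Pos pb pr)))
  (starSplit-Pos (ℕₚ.≤-trans pa (ℕₚ.m≤m+n _ _)) pr)

splitLast-∷ʳ : ∀ v n → splitLast (v ∷ʳ n) ≡ just (v , n)
splitLast-∷ʳ [] n = ≡.refl
splitLast-∷ʳ (x ∷ []) n = ≡.refl
splitLast-∷ʳ (x ∷ y ∷ v) n rewrite splitLast-∷ʳ (y ∷ v) n = ≡.refl

circ-∷ʳ : ∀ k a l b → circ (k ∷ʳ a) (l ∷ʳ b) ≡ map (_∷ʳ (a ℕ.+ b)) (har k l)
circ-∷ʳ k a l b rewrite splitLast-∷ʳ k a | splitLast-∷ʳ l b = ≡.refl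

circ-Adm : ∀ {k a l b} → Pos k → 1 ≤ a → Pos l → 1 ≤ b → All Adm (circL (k ∷ʳ a) (star (l ∷ʳ b)))
circ-Adm {k} {a} {l} {b} pk pa pl pb = Allₚ.concat⁺ (Allₚ.map⁺ (eachStar (snoc-Pos pl pb)))
  where
  eachSplit : ∀ {p} → Pos (proj₁ p) × 1 ≤ proj₂ p → All Adm (circ (k ∷ʳ a) (join p))
  eachSplit {v , n} (pv , pn) rewrite circ-∷ʳ k a v n =
    Allₚ.map⁺ (All.map (λ pw → snoc-Adm pw (ℕₚ.+-mono-≤ pa pn)) (har-Pos pk pv))
  eachStar : ∀ {l} → Pos l → All (λ v → All Adm (circ (k ∷ʳ a) v)) (star l)
  eachStar [] with splitLast (k ∷ʳ a)
  ... | just _ = [] ∷ []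
  ... | nothing = [] ∷ []
  eachStar {x ∷ r} (px ∷ pr) rewrite starAux-join x r = Allₚ.map⁺ (All.map eachSplit (starSplit-Pos px pr))

module Harmonic {c ℓ : Level} (S : CommutativeRing c ℓ) where
  open CommutativeRing S hiding (zero)
  open Summation S
  open IntegerSolver S
  open import Algebra.Properties.Ring ring using (-0#≈0#)
  open import Relation.Binary.Reasoning.Setoid setoid

  ∑-har-∷ : ∀ a k b l F → ∑ (har (a ∷ k) (b ∷ l)) F ≈
    ∑ (har k (b ∷ l)) (F ∘ (a ∷_)) + (∑ (har (a ∷ k) l) (F ∘ (b ∷_)) + ∑ (har k l) (F ∘ ((a ℕ.+ b) ∷_)))
  ∑-har-∷ a k b l F = trans (∑-++ (map (a ∷_) (har k (b ∷ l))) _ F)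
    (+-cong (reflexive (∑-map (a ∷_) (har k (b ∷ l)) F))
    (trans (∑-++ (map (b ∷_) (har (a ∷ k) l)) _ F)
    (+-cong (reflexive (∑-map (b ∷_) (har (a ∷ k) l) F)) (reflexive (∑-map ((a ℕ.+ b) ∷_) (har k l) F)))))

  ∑-har-[]ʳ : ∀ k F → ∑ (har k []) F ≈ F k
  ∑-har-[]ʳ k F = trans (reflexive (≡.cong (λ l → ∑ l F) (har-[]ʳ k))) (+-identityʳ _)

  -- `har` recurses on first entries, whereas last entries matter here. Expanding at the front,
  -- applying induction to the three parts and regrouping the nine terms yields the rule at the
  -- back.
  ∑-har-∷ʳ : ∀ k a l b F → ∑ (har (k ∷ʳ a) (l ∷ʳ b)) F ≈
    ∑ (har (k ∷ʳ a) l) (F ∘ (_∷ʳ b)) + (∑ (har k (l ∷ʳ b)) (F ∘ (_∷ʳ a)) + ∑ (har k l) (F ∘ (_∷ʳ (a ℕ.+ b))))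
  ∑-har-∷ʳ [] a [] b F = ∑-har-∷ a [] b [] F
  ∑-har-∷ʳ [] a (x ∷ l) b F = begin
    ∑ (har (a ∷ []) (x ∷ (l ∷ʳ b))) F
      ≈⟨ ∑-har-∷ a [] x (l ∷ʳ b) F ⟩
    ∑ (har [] (x ∷ (l ∷ʳ b))) (F ∘ (a ∷_)) + (∑ (har (a ∷ []) (l ∷ʳ b)) (F ∘ (x ∷_)) + ∑ (har [] (l ∷ʳ b)) (F ∘ ((a ℕ.+ x) ∷_)))
      ≈⟨ +-congˡ (+-congʳ (∑-har-∷ʳ [] a l b (F ∘ (x ∷_)))) ⟩
    _
      ≈⟨ solve 5 (λ p q r s t → p :+ ((q :+ (r :+ s)) :+ t) := (p :+ (q :+ t)) :+ (r :+ s)) refl _ _ _ _ _ ⟩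
    _
      ≈⟨ +-congʳ (∑-har-∷ a [] x l (F ∘ (_∷ʳ b))) ⟨
    _ ∎
  ∑-har-∷ʳ (y ∷ k) a [] b F = begin
    ∑ (har (y ∷ (k ∷ʳ a)) (b ∷ [])) F
      ≈⟨ ∑-har-∷ y (k ∷ʳ a) b [] F ⟩
    ∑ (har (k ∷ʳ a) (b ∷ [])) (F ∘ (y ∷_)) + (∑ (har (y ∷ (k ∷ʳ a)) []) (F ∘ (b ∷_)) + ∑ (har (k ∷ʳ a) []) (F ∘ ((y ℕ.+ b) ∷_)))
      ≈⟨ +-cong (∑-har-∷ʳ k a [] b (F ∘ (y ∷_))) (+-cong (+-identityʳ _) (∑-har-[]ʳ (k ∷ʳ a) _)) ⟩
    (∑ (har (k ∷ʳ a) []) (λ w → F (y ∷ w ∷ʳ b)) + (∑ (har k (b ∷ [])) (λ w → F (y ∷ w ∷ʳ a)) + ∑ (har k []) (λ w → F (y ∷ w ∷ʳ (a ℕ.+ b)))))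
      + (F (b ∷ y ∷ k ∷ʳ a) + F ((y ℕ.+ b) ∷ k ∷ʳ a))
      ≈⟨ +-congʳ (+-cong (∑-har-[]ʳ (k ∷ʳ a) _) (+-congˡ (∑-har-[]ʳ k _))) ⟩
    (F (y ∷ k ∷ʳ a ∷ʳ b) + (∑ (har k (b ∷ [])) (λ w → F (y ∷ w ∷ʳ a)) + F (y ∷ k ∷ʳ (a ℕ.+ b)))) + (F (b ∷ y ∷ k ∷ʳ a) + F ((y ℕ.+ b) ∷ k ∷ʳ a))
      ≈⟨ solve 5 (λ p q r s t → (p :+ (q :+ r)) :+ (s :+ t) := p :+ ((q :+ (s :+ t)) :+ r)) refl _ _ _ _ _ ⟩
    F (y ∷ k ∷ʳ a ∷ʳ b) + ((∑ (har k (b ∷ [])) (λ w → F (y ∷ w ∷ʳ a)) + (F (b ∷ y ∷ k ∷ʳ a) + F ((y ℕ.+ b) ∷ k ∷ʳ a))) + F (y ∷ k ∷ʳ (a ℕ.+ b)))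
      ≈⟨ +-cong (sym (+-identityʳ _)) (+-cong (+-congˡ (+-cong (sym (+-identityʳ _)) (sym (∑-har-[]ʳ k _)))) (sym (+-identityʳ _))) ⟩
    _
      ≈⟨ +-congˡ (+-congʳ (∑-har-∷ y k b [] (F ∘ (_∷ʳ a)))) ⟨
    _ ∎
  ∑-har-∷ʳ (y ∷ k) a (x ∷ l) b F = begin
    ∑ (har (y ∷ (k ∷ʳ a)) (x ∷ (l ∷ʳ b))) F
      ≈⟨ ∑-har-∷ y (k ∷ʳ a) x (l ∷ʳ b) F ⟩
    _
      ≈⟨ +-cong (∑-har-∷ʳ k a (x ∷ l) b (F ∘ (y ∷_)))
        (+-cong (∑-har-∷ʳ (y ∷ k) a l b (F ∘ (x ∷_))) (∑-har-∷ʳ k a l b (F ∘ ((y ℕ.+ x) ∷_)))) ⟩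
    _
      ≈⟨ solve 9 (λ p q r p′ q′ r′ p″ q″ r″ → (p :+ (q :+ r)) :+ ((p′ :+ (q′ :+ r′)) :+ (p″ :+ (q″ :+ r″)))
                := (p :+ (p′ :+ p″)) :+ ((q :+ (q′ :+ q″)) :+ (r :+ (r′ :+ r″)))) refl _ _ _ _ _ _ _ _ _ ⟩
    _
      ≈⟨ +-cong (∑-har-∷ y (k ∷ʳ a) x l (F ∘ (_∷ʳ b)))
        (+-cong (∑-har-∷ y k x (l ∷ʳ b) (F ∘ (_∷ʳ a))) (∑-har-∷ y k x l (F ∘ (_∷ʳ (a ℕ.+ b))))) ⟨
    _ ∎

  -- The two sums correspond to a comma and to a plus sign in front of n.
  ∑-starSplit-∷ʳ : ∀ a r n h → ∑ (starSplit a (r ∷ʳ n)) h ≈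
    ∑ (starSplit a r) (λ p → h (join p , n)) + ∑ (starSplit a r) (λ p → h (proj₁ p , proj₂ p ℕ.+ n))
  ∑-starSplit-∷ʳ a [] n h = +-congʳ (sym (+-identityʳ _))
  ∑-starSplit-∷ʳ a (b ∷ r) n h = begin
    ∑ (starSplit a (b ∷ (r ∷ʳ n))) h
      ≈⟨ unfold (r ∷ʳ n) h ⟩
    _
      ≈⟨ +-cong (∑-starSplit-∷ʳ b r n (λ p → h (a ∷ proj₁ p , proj₂ p))) (∑-starSplit-∷ʳ (a ℕ.+ b) r n h) ⟩
    _
      ≈⟨ solve 4 (λ p q r s → (p :+ q) :+ (r :+ s) := (p :+ r) :+ (q :+ s)) refl _ _ _ _ ⟩
    _
      ≈⟨ +-cong (unfold r (λ p → h (join p , n))) (unfold r (λ p → h (proj₁ p , proj₂ p ℕ.+ n))) ⟨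
    _ ∎
    where
    unfold : ∀ r h → ∑ (starSplit a (b ∷ r)) h ≈
      ∑ (starSplit b r) (λ p → h (a ∷ proj₁ p , proj₂ p)) + ∑ (starSplit (a ℕ.+ b) r) h
    unfold r h = trans (∑-++ (map _ (starSplit b r)) _ h)
      (+-congʳ (reflexive (∑-map (λ p → (a ∷ proj₁ p , proj₂ p)) (starSplit b r) h)))

  ∑-starAux : ∀ a r (F : Index → Carrier) → ∑ (starAux a r) F ≈ ∑ (starSplit a r) (F ∘ join)
  ∑-starAux a r F = reflexive (≡.trans (≡.cong (λ l → ∑ l F) (starAux-join a r)) (∑-map join (starSplit a r) F))

  -- Σ_i (k * (l_1,…,l_i)^⋆)(l_{i+1}+⋯+l_s) for l = a ∷ r
  starJoin : (Index → Carrier) → Index → ℕ → Index → Carrier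
  starJoin F k a r = ∑ (starSplit a r) (λ p → ∑ (har k (proj₁ p)) (F ∘ (_∷ʳ proj₂ p)))

  starJoin-∷ʳ : ∀ F k a r n → starJoin F k a (r ∷ʳ n) ≈
    ∑ (starSplit a r) (λ p → ∑ (har k (join p)) (F ∘ (_∷ʳ n))) +
    ∑ (starSplit a r) (λ p → ∑ (har k (proj₁ p)) (F ∘ (_∷ʳ (proj₂ p ℕ.+ n))))
  starJoin-∷ʳ F k a r n = ∑-starSplit-∷ʳ a r n _

  starJoin-single : ∀ F k a → starJoin F k a [] ≈ F (k ∷ʳ a)
  starJoin-single F k a = trans (+-identityʳ _) (∑-har-[]ʳ k _)

  starJoin-[] : ∀ F a r → starJoin F [] a r ≈ ∑ (starAux a r) F
  starJoin-[] F a r = trans (∑-cong (starSplit a r) (λ p → +-identityʳ _)) (sym (∑-starAux a r F))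

  -- By `∑-har-∷ʳ` the last entry of a term of (k,n) * (v,s) is s, n or n+s. The first case gives
  -- the second summand; the other two are the comma and the plus sign before n in the first.
  starJoin-recurrence : ∀ F k n a r →
    ∑ (starAux a r) (λ v → ∑ (har (k ∷ʳ n) v) F) ≈ starJoin F k a (r ∷ʳ n) + starJoin F (k ∷ʳ n) a r
  starJoin-recurrence F k n a r = begin
    ∑ (starAux a r) (λ v → ∑ (har (k ∷ʳ n) v) F)
      ≈⟨ ∑-starAux a r _ ⟩
    ∑ (starSplit a r) (λ p → ∑ (har (k ∷ʳ n) (join p)) F)
      ≈⟨ ∑-cong (starSplit a r) (λ p → trans (∑-har-∷ʳ k n (proj₁ p) (proj₂ p) F)
           (+-congˡ (+-congˡ (∑-cong (har k (proj₁ p)) (λ w → reflexive (≡.cong (λ s → F (w ∷ʳ s)) (ℕₚ.+-comm n (proj₂ p)))))))) ⟩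
    _
      ≈⟨ ∑-+ (starSplit a r) _ _ ⟩
    _
      ≈⟨ +-congˡ (∑-+ (starSplit a r) _ _) ⟩
    _
      ≈⟨ +-comm _ _ ⟩
    _
      ≈⟨ +-congʳ (starJoin-∷ʳ F k a r n) ⟨
    starJoin F k a (r ∷ʳ n) + starJoin F (k ∷ʳ n) a r ∎

  ∑-circ : ∀ F k a v n → ∑ (circ (k ∷ʳ a) (v ∷ʳ n)) F ≈ ∑ (har k v) (F ∘ (_∷ʳ (a ℕ.+ n)))
  ∑-circ F k a v n = reflexive (≡.trans (≡.cong (λ l → ∑ l F) (circ-∷ʳ k a v n)) (∑-map _ (har k v) F))

  ∑-circL-single : ∀ F k a b → ∑ (circL (k ∷ʳ a) (star (b ∷ []))) F ≈ starJoin F k (a ℕ.+ b) []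
  ∑-circL-single F k a b = trans (∑-concatMap (circ (k ∷ʳ a)) (star (b ∷ [])) F) (+-congʳ (∑-circ F k a [] b))

  -- Adding a to the last entry gives a+b after a comma and s+(a+b) after a plus sign, in both cases
  -- as if b had been a+b from the start.
  ∑-circL : ∀ F k a x r b → ∑ (circL (k ∷ʳ a) (star (x ∷ r ∷ʳ b))) F ≈ starJoin F k x (r ∷ʳ (a ℕ.+ b))
  ∑-circL F k a x r b = begin
    ∑ (circL (k ∷ʳ a) (star (x ∷ r ∷ʳ b))) F
      ≈⟨ ∑-concatMap (circ (k ∷ʳ a)) (starAux x (r ∷ʳ b)) F ⟩
    ∑ (starAux x (r ∷ʳ b)) (λ v → ∑ (circ (k ∷ʳ a) v) F)
      ≈⟨ ∑-starAux x (r ∷ʳ b) _ ⟩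
    ∑ (starSplit x (r ∷ʳ b)) (λ p → ∑ (circ (k ∷ʳ a) (join p)) F)
      ≈⟨ ∑-cong (starSplit x (r ∷ʳ b)) (λ p → ∑-circ F k a (proj₁ p) (proj₂ p)) ⟩
    ∑ (starSplit x (r ∷ʳ b)) (λ p → ∑ (har k (proj₁ p)) (F ∘ (_∷ʳ (a ℕ.+ proj₂ p))))
      ≈⟨ ∑-starSplit-∷ʳ x r b _ ⟩
    _
      ≈⟨ +-congˡ (∑-cong (starSplit x r) (λ p → ∑-cong (har k (proj₁ p)) (λ w → reflexive (≡.cong (λ s → F (w ∷ʳ s))
           (≡.trans (≡.sym (ℕₚ.+-assoc a (proj₂ p) b)) (≡.trans (≡.cong (ℕ._+ b) (ℕₚ.+-comm a (proj₂ p))) (ℕₚ.+-assoc (proj₂ p) a b))))))) ⟩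
    _
      ≈⟨ starJoin-∷ʳ F k x r (a ℕ.+ b) ⟨
    starJoin F k x (r ∷ʳ (a ℕ.+ b)) ∎

  module Multiplicative (F : Index → Carrier) (F-[] : F [] ≈ 1#)
                        (F-* : ∀ k l → Pos k → Pos l → ∑ (har k l) F ≈ F k * F l) where
    open System S (F ∘ reverse) F-[]
    open PowerSeries S using (conv; alt; nat; conv-negˡ)

    -- Induction along the defining recurrence of m: `F-*` turns its product into a harmonic sum,
    -- and `starJoin-recurrence` splits that sum. Head and tail of the unreversed index are passed
    -- explicitly because `starSplit` recurses from the front.
    m-starJoin : ∀ k n l a r → Pos k → 1 ≤ n → Pos l → reverse (n ∷ l) ≡ a ∷ r →
      m k (n ∷ l) ≈ starJoin F (reverse k) a r
    m-starJoin k n [] a r pk pn pl ≡.refl = begin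
      F (reverse (n ∷ k)) * 1# - 0#   ≈⟨ trans (+-congˡ -0#≈0#) (trans (+-identityʳ _) (*-identityʳ _)) ⟩
      F (reverse (n ∷ k))             ≡⟨ ≡.cong F (Listₚ.unfold-reverse n k) ⟩
      F (reverse k ∷ʳ n)              ≈⟨ starJoin-single F (reverse k) n ⟨
      starJoin F (reverse k) n []     ∎
    m-starJoin k n (n′ ∷ l) a r pk pn (pn′ ∷ pl) eq with reverse (n′ ∷ l) in eq′
    ... | [] = contradiction (≡.trans (≡.sym (Listₚ.reverse-involutive (n′ ∷ l))) (≡.cong reverse eq′)) λ ()
    ... | a′ ∷ r′ with ≡.trans (≡.sym eq) (≡.trans (Listₚ.unfold-reverse n (n′ ∷ l)) (≡.cong (_∷ʳ n) eq′))
    ... | ≡.refl = begin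
      F (reverse (n ∷ k)) * m [] (n′ ∷ l) - m (n ∷ k) (n′ ∷ l)
        ≈⟨ +-cong (*-congˡ (trans (m-starJoin [] n′ l a′ r′ [] pn′ pl eq′) (starJoin-[] F a′ r′)))
                  (-‿cong (m-starJoin (n ∷ k) n′ l a′ r′ (pn ∷ pk) pn′ pl eq′)) ⟩
      F (reverse (n ∷ k)) * ∑ (starAux a′ r′) F - starJoin F (reverse (n ∷ k)) a′ r′
        ≈⟨ +-congʳ (∑-*ˡ _ (starAux a′ r′) F) ⟨
      ∑ (starAux a′ r′) (λ v → F (reverse (n ∷ k)) * F v) - starJoin F (reverse (n ∷ k)) a′ r′
        ≡⟨ ≡.cong (λ K → ∑ (starAux a′ r′) (λ v → F K * F v) - starJoin F K a′ r′) (Listₚ.unfold-reverse n k) ⟩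
      ∑ (starAux a′ r′) (λ v → F (reverse k ∷ʳ n) * F v) - starJoin F (reverse k ∷ʳ n) a′ r′
        ≈⟨ +-congʳ (∑-congᴬ (All.map (λ {v} pv → F-* (reverse k ∷ʳ n) v (snoc-Pos (reverse-Pos pk) pn) pv) star-Pos)) ⟨
      ∑ (starAux a′ r′) (λ v → ∑ (har (reverse k ∷ʳ n) v) F) - starJoin F (reverse k ∷ʳ n) a′ r′
        ≈⟨ +-congʳ (starJoin-recurrence F (reverse k) n a′ r′) ⟩
      (starJoin F (reverse k) a′ (r′ ∷ʳ n) + starJoin F (reverse k ∷ʳ n) a′ r′) - starJoin F (reverse k ∷ʳ n) a′ r′
        ≈⟨ solve 2 (λ x y → (x :+ y) :- y := x) refl _ _ ⟩
      starJoin F (reverse k) a′ (r′ ∷ʳ n) ∎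
      where
      star-Pos : All Pos (starAux a′ r′)
      star-Pos with ≡.subst Pos eq′ (reverse-Pos (pn′ ∷ pl))
      ... | pa ∷ pr rewrite starAux-join a′ r′ =
        Allₚ.map⁺ (All.map (λ { (pv , ps) → snoc-Pos pv ps }) (starSplit-Pos pa pr))

    m-star : ∀ l → Pos l → m [] l ≈ ∑ (star (reverse l)) F
    m-star [] _ = sym (trans (+-identityʳ _) F-[])
    m-star (n ∷ l) (pn ∷ pl) with reverse (n ∷ l) in eq
    ... | [] = contradiction (≡.trans (≡.sym (Listₚ.reverse-involutive (n ∷ l))) (≡.cong reverse eq)) λ ()
    ... | a ∷ r = trans (m-starJoin [] n l a r [] pn pl eq) (starJoin-[] F a r)

    m-circ : ∀ k a l b → Pos k → 1 ≤ a → Pos l → 1 ≤ b →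
      m k (a ℕ.+ b ∷ l) ≈ ∑ (circL (reverse k ∷ʳ a) (star (reverse l ∷ʳ b))) F
    m-circ k a l b pk pa pl pb with reverse l in eq
    ... | [] = trans (m-starJoin k (a ℕ.+ b) l (a ℕ.+ b) [] pk (ℕₚ.≤-trans pa (ℕₚ.m≤m+n a b)) pl
                       (≡.trans (Listₚ.unfold-reverse (a ℕ.+ b) l) (≡.cong (_∷ʳ (a ℕ.+ b)) eq)))
                     (sym (∑-circL-single F (reverse k) a b))
    ... | x ∷ r = trans (m-starJoin k (a ℕ.+ b) l x (r ∷ʳ (a ℕ.+ b)) pk (ℕₚ.≤-trans pa (ℕₚ.m≤m+n a b)) pl
                          (≡.trans (Listₚ.unfold-reverse (a ℕ.+ b) l) (≡.cong (_∷ʳ (a ℕ.+ b)) eq)))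
                        (sym (∑-circL F (reverse k) a x r b))

    -- the sum of the indices obtained by inserting i into {1}^n
    insertion : (Index → Carrier) → ℕ → ℕ → Carrier
    insertion G i zero = G (i ∷ [])
    insertion G i (suc n) = G (i ∷ replicate (suc n) 1) + insertion (G ∘ (1 ∷_)) i n

    ∑-har-ones : ∀ G i n → ∑ (har (i ∷ []) (replicate (suc n) 1)) G ≈ insertion G i (suc n) + insertion G (i ℕ.+ 1) n
    ∑-har-ones G i zero = trans (sym (+-assoc _ _ _)) (+-congˡ (+-identityʳ _))
    ∑-har-ones G i (suc n) = begin
      ∑ (har (i ∷ []) (1 ∷ replicate (suc n) 1)) G
        ≈⟨ ∑-har-∷ i [] 1 (replicate (suc n) 1) G ⟩
      _
        ≈⟨ +-cong (+-identityʳ _) (+-cong (∑-har-ones (G ∘ (1 ∷_)) i n) (+-identityʳ _)) ⟩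
      _
        ≈⟨ solve 4 (λ p q r s → p :+ ((q :+ r) :+ s) := (p :+ q) :+ (s :+ r)) refl _ _ _ _ ⟩
      insertion G i (suc (suc n)) + insertion G (i ℕ.+ 1) (suc n) ∎

    insertion-1 : ∀ G n → insertion G 1 n ≈ nat (suc n) * G (replicate (suc n) 1)
    insertion-1 G zero = sym (trans (*-congʳ (+-identityʳ 1#)) (*-identityˡ _))
    insertion-1 G (suc n) = trans (+-cong (sym (*-identityˡ _)) (insertion-1 (G ∘ (1 ∷_)) n)) (sym (distribʳ _ _ _))

    replicate-Pos : ∀ n → Pos (replicate n 1)
    replicate-Pos zero = []
    replicate-Pos (suc n) = s≤s z≤n ∷ replicate-Pos n

    -- The product c(i) c({1}^n) is the insertion of i into {1}^n plus that of i+1 into {1}^(n-1),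
    -- so the alternating sum telescopes.
    insertion-conv : ∀ j n → conv (alt (λ i → F (suc (j ℕ.+ i) ∷ []))) (λ p → F (replicate p 1)) n ≈ insertion F (suc j) n
    insertion-conv j zero = trans (*-congˡ F-[]) (trans (*-identityʳ _) (reflexive (≡.cong (λ i → F (suc i ∷ [])) (ℕₚ.+-identityʳ j))))
    insertion-conv j (suc n) = begin
      F (suc (j ℕ.+ 0) ∷ []) * F (replicate (suc n) 1) + conv (λ i → - alt (λ i → F (suc (j ℕ.+ suc i) ∷ [])) i) E n
        ≈⟨ +-cong (*-congʳ (reflexive (≡.cong (λ i → F (suc i ∷ [])) (ℕₚ.+-identityʳ j))))
                  (trans (conv-negˡ (alt (λ i → F (suc (j ℕ.+ suc i) ∷ []))) E n)
                    (-‿cong (PowerSeries.conv-cong S (PowerSeries.alt-cong S (λ i → reflexive (≡.cong (λ s → F (suc s ∷ [])) (ℕₚ.+-suc j i)))) (λ _ → refl) n))) ⟩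
      F (suc j ∷ []) * F (replicate (suc n) 1) - conv (alt (λ i → F (suc (suc j ℕ.+ i) ∷ []))) E n
        ≈⟨ +-cong (sym (F-* (suc j ∷ []) (replicate (suc n) 1) (s≤s z≤n ∷ []) (replicate-Pos (suc n))))
                  (-‿cong (insertion-conv (suc j) n)) ⟩
      ∑ (har (suc j ∷ []) (replicate (suc n) 1)) F - insertion F (suc (suc j)) n
        ≈⟨ +-cong (∑-har-ones F (suc j) n) (-‿cong (reflexive (≡.cong (λ i → insertion F i n) (≡.sym (ℕₚ.+-comm (suc j) 1))))) ⟩
      (insertion F (suc j) (suc n) + insertion F (suc j ℕ.+ 1) n) - insertion F (suc j ℕ.+ 1) n
        ≈⟨ solve 2 (λ x y → (x :+ y) :- y := x) refl _ _ ⟩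
      insertion F (suc j) (suc n) ∎
      where
      E : ℕ → Carrier
      E p = F (replicate p 1)

    -- Newton's identities, with c({1}^p) as elementary symmetric function and c(i) as power sum:
    -- inserting 1 into {1}^n gives {1}^(n+1) in n+1 ways.
    newton : ∀ n → nat (suc n) * F (replicate (suc n) 1) ≈ conv (alt (λ i → F (suc i ∷ []))) (λ p → F (replicate p 1)) n
    newton n = sym (trans (insertion-conv 0 n) (insertion-1 F n))

-- Permutations, positions and shuffles of lists of elements

Unique-resp-↭ : ∀ {A : Set} {xs ys : List A} → xs ↭ ys → Unique xs → Unique ys
Unique-resp-↭ ↭.refl u = u
Unique-resp-↭ (prep x p) (a ∷ u) = ↭ₚ.All-resp-↭ p a ∷ Unique-resp-↭ p u
Unique-resp-↭ (swap x y p) ((xy ∷ xa) ∷ ya ∷ u) =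
  ((λ e → xy (≡.sym e)) ∷ ↭ₚ.All-resp-↭ p ya) ∷ ↭ₚ.All-resp-↭ p xa ∷ Unique-resp-↭ p u
Unique-resp-↭ (↭.trans p q) u = Unique-resp-↭ q (Unique-resp-↭ p u)

Unique-++ʳ : ∀ {A : Set} (xs : List A) {ys} → Unique (xs ++ ys) → Unique ys
Unique-++ʳ [] u = u
Unique-++ʳ (x ∷ xs) (_ ∷ u) = Unique-++ʳ xs u

≡ᵇ-refl : ∀ x → (x ℕ.≡ᵇ x) ≡ true
≡ᵇ-refl zero = ≡.refl
≡ᵇ-refl (suc x) = ≡ᵇ-refl x

≡ᵇ-≢ : ∀ {x y} → x ≢ y → (x ℕ.≡ᵇ y) ≡ false
≡ᵇ-≢ {zero} {zero} p = contradiction ≡.refl p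
≡ᵇ-≢ {zero} {suc y} p = ≡.refl
≡ᵇ-≢ {suc x} {zero} p = ≡.refl
≡ᵇ-≢ {suc x} {suc y} p = ≡ᵇ-≢ (λ e → p (≡.cong suc e))

before : ℕ → ℕ → List ℕ → Bool
before x y π = pos x π ℕ.<ᵇ pos y π

pos-here : ∀ x π → pos x (x ∷ π) ≡ 0
pos-here x π rewrite ≡ᵇ-refl x = ≡.refl

pos-there : ∀ {x y} π → x ≢ y → pos x (y ∷ π) ≡ suc (pos x π)
pos-there π p rewrite ≡ᵇ-≢ p = ≡.refl

pos-∈ : ∀ {x π} → x ∈ π → pos x π < length π
pos-∈ {x} {y ∷ π} p with x ℕ.≟ y
... | yes ≡.refl rewrite pos-here x π = s≤s z≤n
pos-∈ (here e) | no x≢y = contradiction e x≢y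
pos-∈ {x} {y ∷ π} (there p) | no x≢y rewrite pos-there π x≢y = s≤s (pos-∈ p)

pos-injective : ∀ {x y} π → x ∈ π → pos x π ≡ pos y π → x ≡ y
pos-injective {x} {y} (z ∷ π) p e with x ℕ.≟ z | y ℕ.≟ z
... | yes ≡.refl | yes ≡.refl = ≡.refl
... | yes ≡.refl | no y≢z rewrite pos-here x π | pos-there π y≢z = contradiction e λ ()
... | no x≢z | yes ≡.refl rewrite pos-here y π | pos-there π x≢z = contradiction e λ ()
pos-injective (z ∷ π) (here x≡z) e | no x≢z | no y≢z = contradiction x≡z x≢z
pos-injective (z ∷ π) (there p) e | no x≢z | no y≢z rewrite pos-there π x≢z | pos-there π y≢z =
  pos-injective π p (ℕₚ.suc-injective e)

<ᵇ-≢ : ∀ m n → m ≢ n → (n ℕ.<ᵇ m) ≡ not (m ℕ.<ᵇ n)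
<ᵇ-≢ zero zero p = contradiction ≡.refl p
<ᵇ-≢ zero (suc n) p = ≡.refl
<ᵇ-≢ (suc m) zero p = ≡.refl
<ᵇ-≢ (suc m) (suc n) p = <ᵇ-≢ m n (λ e → p (≡.cong suc e))

-- Membership matters: `pos` gives every absent element the same value, the length of the list.
before-antisym : ∀ {x y π} → x ≢ y → x ∈ π → before y x π ≡ not (before x y π)
before-antisym {x} {y} {π} x≢y x∈π = <ᵇ-≢ (pos x π) (pos y π) (λ e → x≢y (pos-injective π x∈π e))

before-first : ∀ {x y} π → x ≢ y → before x y (x ∷ π) ≡ true
before-first {x} {y} π x≢y rewrite pos-here x π | pos-there π (λ e → x≢y (≡.sym e)) = ≡.refl

not-before-first : ∀ x y π → before y x (x ∷ π) ≡ false
not-before-first x y π rewrite pos-here x π = ≡.refl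

before-∷ : ∀ x y z {π ρ} → before x y π ≡ before x y ρ → before x y (z ∷ π) ≡ before x y (z ∷ ρ)
before-∷ x y z e with x ℕ.≡ᵇ z | y ℕ.≡ᵇ z
... | true | true = ≡.refl
... | true | false = ≡.refl
... | false | true = ≡.refl
... | false | false = e

before-skip : ∀ {x y z} π → x ≢ z → y ≢ z → before x y (z ∷ π) ≡ before x y π
before-skip π x≢z y≢z rewrite pos-there π x≢z | pos-there π y≢z = ≡.refl

insertAll-↭ : ∀ {A : Set} (a : A) π → All (_↭ (a ∷ π)) (insertAll a π)
insertAll-↭ a [] = ↭-refl ∷ []
insertAll-↭ a (z ∷ π) = ↭-refl ∷ Allₚ.map⁺ (All.map (λ p → ↭-trans (prep z p) (swap z a ↭-refl)) (insertAll-↭ a π))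

perms-↭ : ∀ {A : Set} (xs : List A) → All (_↭ xs) (perms xs)
perms-↭ [] = ↭-refl ∷ []
perms-↭ (x ∷ xs) = Allₚ.concat⁺ (Allₚ.map⁺ (All.map
  (λ {π} p → All.map (λ q → ↭-trans q (prep x p)) (insertAll-↭ x π)) (perms-↭ xs)))

before-insert : ∀ {a x y} → a ≢ x → a ≢ y → ∀ π → All (λ ρ → before x y ρ ≡ before x y π) (insertAll a π)
before-insert a≢x a≢y [] = before-skip [] (a≢x ∘ ≡.sym) (a≢y ∘ ≡.sym) ∷ []
before-insert {a} {x} {y} a≢x a≢y (z ∷ π) = before-skip (z ∷ π) (a≢x ∘ ≡.sym) (a≢y ∘ ≡.sym)
  ∷ Allₚ.map⁺ (All.map (λ {ρ} → before-∷ x y z {ρ} {π}) (before-insert a≢x a≢y π))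

Avoids : ℕ → List (ℕ × ℕ) → Set
Avoids a = All (λ r → a ≢ proj₁ r × a ≢ proj₂ r)

Within : List ℕ → List (ℕ × ℕ) → Set
Within xs = All (λ r → proj₁ r ∈ xs × proj₂ r ∈ xs)

respects-insert : ∀ {a rs} → Avoids a rs → ∀ π → All (λ ρ → respects rs ρ ≡ respects rs π) (insertAll a π)
respects-insert [] π = All.universal (λ _ → ≡.refl) _
respects-insert ((p , q) ∷ av) π = All.zipWith (λ { (e , f) → ≡.cong₂ _∧_ e f }) (before-insert p q π , respects-insert av π)

respects-↭ : ∀ {rs rs′} → rs ↭ rs′ → ∀ π → respects rs π ≡ respects rs′ π
respects-↭ ↭.refl π = ≡.refl
respects-↭ (prep (x , y) p) π = ≡.cong (before x y π ∧_) (respects-↭ p π)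
respects-↭ (swap (x , y) (z , w) p) π rewrite respects-↭ p π with before x y π | before z w π
... | true | true = ≡.refl
... | true | false = ≡.refl
... | false | true = ≡.refl
... | false | false = ≡.refl
respects-↭ (↭.trans p q) π = ≡.trans (respects-↭ p π) (respects-↭ q π)

respects-∈ : ∀ {rs x y} π → respects rs π ≡ true → (x , y) ∈ rs → before x y π ≡ true
respects-∈ {(x , y) ∷ rs} π e (here ≡.refl) with before x y π
... | true = ≡.refl
respects-∈ {(x′ , y′) ∷ rs} π e (there p) with before x′ y′ π
... | true = respects-∈ {rs} π e p

chain : List ℕ → List (ℕ × ℕ)
chain [] = []
chain (a ∷ []) = []
chain (a ∷ b ∷ c) = (a , b) ∷ chain (b ∷ c)

within-mono : ∀ {xs ys rs} → (∀ {x} → x ∈ xs → x ∈ ys) → Within xs rs → Within ys rs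
within-mono f = All.map (λ { (p , q) → f p , f q })

chain-Within : ∀ xs → Within xs (chain xs)
chain-Within [] = []
chain-Within (a ∷ []) = []
chain-Within (a ∷ b ∷ c) = (here ≡.refl , there (here ≡.refl)) ∷ within-mono there (chain-Within (b ∷ c))

-- `sh` for arbitrary entries: poset elements are shuffled first and labelled afterwards, by
-- `sh-map`.
shuffle : ∀ {A : Set} → List A → List A → List (List A)
shuffle [] w = w ∷ []
shuffle (a ∷ v) [] = (a ∷ v) ∷ []
shuffle (a ∷ v) (b ∷ w) = map (a ∷_) (shuffle v (b ∷ w)) ++ map (b ∷_) (shuffle (a ∷ v) w)

shuffle-[]ʳ : ∀ {A : Set} (v : List A) → shuffle v [] ≡ v ∷ []
shuffle-[]ʳ [] = ≡.refl
shuffle-[]ʳ (a ∷ v) = ≡.refl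

shuffle-single : ∀ {A : Set} (a : A) w → shuffle (a ∷ []) w ≡ insertAll a w
shuffle-single a [] = ≡.refl
shuffle-single a (b ∷ w) = ≡.cong (λ l → (a ∷ b ∷ w) ∷ map (b ∷_) l) (shuffle-single a w)

sh-map : ∀ {A : Set} (g : A → Letter) v w → sh (map g v) (map g w) ≡ map (map g) (shuffle v w)
sh-map g [] w = ≡.refl
sh-map g (a ∷ v) [] = ≡.refl
sh-map g (a ∷ v) (b ∷ w) = ≡.trans
  (≡.cong₂ _++_ (push a (sh-map g v (b ∷ w))) (push b (sh-map g (a ∷ v) w)))
  (≡.sym (Listₚ.map-++ (map g) (map (a ∷_) (shuffle v (b ∷ w))) _))
  where
  push : ∀ c {xs ys} → xs ≡ map (map g) ys → map (g c ∷_) xs ≡ map (map g) (map (c ∷_) ys)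
  push c {ys = ys} ≡.refl = ≡.trans (≡.sym (Listₚ.map-∘ ys)) (Listₚ.map-∘ ys)

-- Sums over linear extensions

module LinearExtensions {c ℓ : Level} (S : CommutativeRing c ℓ) where
  open CommutativeRing S hiding (zero)
  open Summation S
  open IntegerSolver S
  open import Relation.Binary.Reasoning.Setoid setoid

  infix 3 [_]_
  [_]_ : Bool → Carrier → Carrier
  [ b ] x = if b then x else 0#

  []-cong : ∀ b {x y} → (b ≡ true → x ≈ y) → ([ b ] x) ≈ ([ b ] y)
  []-cong true p = p ≡.refl
  []-cong false p = refl

  []-∧ : ∀ a b x → ([ a ∧ b ] x) ≡ ([ b ] ([ a ] x))
  []-∧ true b x = ≡.refl
  []-∧ false true x = ≡.refl
  []-∧ false false x = ≡.refl

  []-∑ : ∀ {A : Set} b xs (f : A → Carrier) → ∑ xs (λ x → [ b ] f x) ≈ ([ b ] ∑ xs f)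
  []-∑ true xs f = refl
  []-∑ false xs f = ∑-0 xs

  ∑-insertAll-comm : ∀ (x y : ℕ) π φ →
    ∑ (insertAll y π) (λ ρ → ∑ (insertAll x ρ) φ) ≈ ∑ (insertAll x π) (λ ρ → ∑ (insertAll y ρ) φ)
  ∑-insertAll-comm x y [] φ = solve 3 (λ a b o → (a :+ (b :+ o)) :+ o := (b :+ (a :+ o)) :+ o) refl _ _ 0#
  ∑-insertAll-comm x y (z ∷ π) φ = begin
    ∑ (insertAll y (z ∷ π)) (λ ρ → ∑ (insertAll x ρ) φ)
      ≈⟨ expand x y ⟩
    _
      ≈⟨ +-congˡ (+-congˡ (∑-insertAll-comm x y π (φ ∘ (z ∷_)))) ⟩
    _
      ≈⟨ solve 5 (λ a b c d e → (a :+ (b :+ c)) :+ (d :+ e) := (b :+ (a :+ d)) :+ (c :+ e)) refl _ _ _ _ _ ⟩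
    _
      ≈⟨ expand y x ⟨
    ∑ (insertAll x (z ∷ π)) (λ ρ → ∑ (insertAll y ρ) φ) ∎
    where
    expand : ∀ x y → ∑ (insertAll y (z ∷ π)) (λ ρ → ∑ (insertAll x ρ) φ) ≈
      (φ (x ∷ y ∷ z ∷ π) + (φ (y ∷ x ∷ z ∷ π) + ∑ (insertAll x π) (λ ρ → φ (y ∷ z ∷ ρ)))) +
      (∑ (insertAll y π) (λ ρ → φ (x ∷ z ∷ ρ)) + ∑ (insertAll y π) (λ ρ → ∑ (insertAll x ρ) (φ ∘ (z ∷_))))
    expand x y = +-cong
      (+-congˡ (+-congˡ (reflexive (≡.trans (∑-map (y ∷_) (map (z ∷_) (insertAll x π)) φ) (∑-map (z ∷_) (insertAll x π) (φ ∘ (y ∷_)))))))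
      (trans (reflexive (∑-map (z ∷_) (insertAll y π) _))
      (trans (∑-cong (insertAll y π) (λ ρ → +-congˡ (reflexive (∑-map (z ∷_) (insertAll x ρ) φ))))
             (∑-+ (insertAll y π) _ _)))

  -- Two successive insertions commute under the sum. The elements of a poset may thus be listed in
  -- whichever order suits the argument.
  ∑-perms-↭ : ∀ {xs ys : List ℕ} → xs ↭ ys → ∀ φ → ∑ (perms xs) φ ≈ ∑ (perms ys) φ
  ∑-perms-↭ ↭.refl φ = refl
  ∑-perms-↭ {x ∷ xs} {x ∷ ys} (prep x p) φ = trans (∑-concatMap (insertAll x) (perms xs) φ)
    (trans (∑-perms-↭ p _) (sym (∑-concatMap (insertAll x) (perms ys) φ)))
  ∑-perms-↭ {x ∷ y ∷ xs} {y ∷ x ∷ ys} (swap x y p) φ = begin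
    ∑ (perms (x ∷ y ∷ xs)) φ
      ≈⟨ trans (∑-concatMap (insertAll x) (perms (y ∷ xs)) φ) (∑-concatMap (insertAll y) (perms xs) _) ⟩
    ∑ (perms xs) (λ π → ∑ (insertAll y π) (λ ρ → ∑ (insertAll x ρ) φ))
      ≈⟨ ∑-cong (perms xs) (λ π → ∑-insertAll-comm x y π φ) ⟩
    ∑ (perms xs) (λ π → ∑ (insertAll x π) (λ ρ → ∑ (insertAll y ρ) φ))
      ≈⟨ ∑-perms-↭ p _ ⟩
    ∑ (perms ys) (λ π → ∑ (insertAll x π) (λ ρ → ∑ (insertAll y ρ) φ))
      ≈⟨ trans (∑-concatMap (insertAll y) (perms (x ∷ ys)) φ) (∑-concatMap (insertAll x) (perms ys) _) ⟨
    ∑ (perms (y ∷ x ∷ ys)) φ ∎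
  ∑-perms-↭ (↭.trans p q) φ = trans (∑-perms-↭ p φ) (∑-perms-↭ q φ)

  LinSum : List ℕ → List (ℕ × ℕ) → (List ℕ → Carrier) → Carrier
  LinSum xs rs φ = ∑ (perms xs) (λ π → [ respects rs π ] φ π)

  LinSum-W : ∀ labs rs F → ∑ (W (poset2 labs rs)) F ≈ LinSum (upTo (length labs)) rs (F ∘ map (lookupD x0 labs))
  LinSum-W labs rs F = trans (reflexive (∑-map (map (lookupD x0 labs)) (linExt (poset2 labs rs)) F))
    (∑-filterB (respects rs) (perms (upTo (length labs))) (F ∘ map (lookupD x0 labs)))

  LinSum-↭ : ∀ {xs ys rs rs′} → xs ↭ ys → rs ↭ rs′ → ∀ φ → LinSum xs rs φ ≈ LinSum ys rs′ φ
  LinSum-↭ {xs} {ys} p q φ = trans (∑-perms-↭ p _)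
    (∑-cong (perms ys) (λ π → reflexive (≡.cong (λ b → [ b ] φ π) (respects-↭ q π))))

  LinSum-cong : ∀ {xs rs φ ψ} → (∀ π → π ↭ xs → respects rs π ≡ true → φ π ≈ ψ π) → LinSum xs rs φ ≈ LinSum xs rs ψ
  LinSum-cong {xs} {rs} h = ∑-congᴬ (All.map (λ {π} p → []-cong (respects rs π) (h π p)) (perms-↭ xs))

  LinSum-* : ∀ xs rs a φ → LinSum xs rs (λ π → a * φ π) ≈ a * LinSum xs rs φ
  LinSum-* xs rs a φ = trans (∑-cong (perms xs) (λ π → scale (respects rs π) (φ π))) (∑-*ˡ a (perms xs) _)
    where
    scale : ∀ b x → ([ b ] a * x) ≈ a * ([ b ] x)
    scale true x = refl
    scale false x = sym (zeroʳ a)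

  -- Every linear extension puts exactly one of two distinct elements first.
  LinSum-split : ∀ {x y xs} → x ≢ y → x ∈ xs → ∀ rs φ →
    LinSum xs rs φ ≈ LinSum xs ((x , y) ∷ rs) φ + LinSum xs ((y , x) ∷ rs) φ
  LinSum-split {x} {y} {xs} x≢y x∈xs rs φ = trans
    (∑-congᴬ (All.map (λ {π} p → split π (before-antisym x≢y (↭ₚ.∈-resp-↭ (↭-sym p) x∈xs))) (perms-↭ xs)))
    (∑-+ (perms xs) _ _)
    where
    split : ∀ π → before y x π ≡ not (before x y π) →
      ([ respects rs π ] φ π) ≈ ([ respects ((x , y) ∷ rs) π ] φ π) + ([ respects ((y , x) ∷ rs) π ] φ π)
    split π e rewrite e with before x y π
    ... | true = sym (+-identityʳ _)
    ... | false = sym (+-identityˡ _)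

  insertBefore : ℕ → ℕ → (List ℕ → Carrier) → List ℕ → Carrier
  insertBefore a b φ π = ∑ (insertAll a π) (λ ρ → [ before a b ρ ] φ ρ)

  insertBefore-here : ∀ {a b} → a ≢ b → ∀ φ π → insertBefore a b φ (b ∷ π) ≈ φ (a ∷ b ∷ π)
  insertBefore-here {a} {b} a≢b φ π = begin
    ([ before a b (a ∷ b ∷ π) ] φ (a ∷ b ∷ π)) + ∑ (map (b ∷_) (insertAll a π)) (λ ρ → [ before a b ρ ] φ ρ)
      ≈⟨ +-cong (reflexive (≡.cong (λ t → [ t ] φ (a ∷ b ∷ π)) (before-first (b ∷ π) a≢b)))
                (trans (reflexive (∑-map (b ∷_) (insertAll a π) _))
                (trans (∑-cong (insertAll a π) (λ ρ → reflexive (≡.cong (λ t → [ t ] φ (b ∷ ρ)) (not-before-first b a ρ))))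
                       (∑-0 (insertAll a π)))) ⟩
    φ (a ∷ b ∷ π) + 0#
      ≈⟨ +-identityʳ _ ⟩
    φ (a ∷ b ∷ π) ∎

  insertBefore-there : ∀ {a b z} → a ≢ b → a ≢ z → b ≢ z → ∀ φ π →
    insertBefore a b φ (z ∷ π) ≈ φ (a ∷ z ∷ π) + insertBefore a b (φ ∘ (z ∷_)) π
  insertBefore-there {a} {b} {z} a≢b a≢z b≢z φ π = +-cong
    (reflexive (≡.cong (λ t → [ t ] φ (a ∷ z ∷ π)) (before-first (z ∷ π) a≢b)))
    (trans (reflexive (∑-map (z ∷_) (insertAll a π) _))
           (∑-cong (insertAll a π) (λ ρ → reflexive (≡.cong (λ t → [ t ] φ (z ∷ ρ)) (before-skip ρ a≢z b≢z)))))

  ∑-shuffle-∷ : ∀ (a : ℕ) v b w φ → ∑ (shuffle (a ∷ v) (b ∷ w)) φ ≈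
    ∑ (shuffle v (b ∷ w)) (φ ∘ (a ∷_)) + ∑ (shuffle (a ∷ v) w) (φ ∘ (b ∷_))
  ∑-shuffle-∷ a v b w φ = trans (∑-++ (map (a ∷_) (shuffle v (b ∷ w))) _ φ)
    (+-cong (reflexive (∑-map (a ∷_) (shuffle v (b ∷ w)) φ)) (reflexive (∑-map (b ∷_) (shuffle (a ∷ v) w) φ)))

  -- In a shuffle of `b ∷ c` with ζ, the places in front of b are exactly those available to a new
  -- head a of the chain.
  ∑-shuffle-insertBefore : ∀ {a b} → a ≢ b → ∀ c ζ → All (a ≢_) ζ → All (b ≢_) ζ → ∀ φ →
    ∑ (shuffle (b ∷ c) ζ) (insertBefore a b φ) ≈ ∑ (shuffle (a ∷ b ∷ c) ζ) φ
  ∑-shuffle-insertBefore a≢b c [] [] [] φ = +-congʳ (insertBefore-here a≢b φ c)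
  ∑-shuffle-insertBefore {a} {b} a≢b c (z ∷ ζ) (a≢z ∷ a∉) (b≢z ∷ b∉) φ = begin
    ∑ (shuffle (b ∷ c) (z ∷ ζ)) (insertBefore a b φ)
      ≈⟨ ∑-shuffle-∷ b c z ζ _ ⟩
    ∑ (shuffle c (z ∷ ζ)) (λ π → insertBefore a b φ (b ∷ π)) + ∑ (shuffle (b ∷ c) ζ) (λ π → insertBefore a b φ (z ∷ π))
      ≈⟨ +-cong (∑-cong (shuffle c (z ∷ ζ)) (insertBefore-here a≢b φ))
                (trans (∑-cong (shuffle (b ∷ c) ζ) (insertBefore-there a≢b a≢z b≢z φ)) (∑-+ (shuffle (b ∷ c) ζ) _ _)) ⟩
    ∑ (shuffle c (z ∷ ζ)) (λ π → φ (a ∷ b ∷ π)) +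
      (∑ (shuffle (b ∷ c) ζ) (λ π → φ (a ∷ z ∷ π)) + ∑ (shuffle (b ∷ c) ζ) (insertBefore a b (φ ∘ (z ∷_))))
      ≈⟨ +-congˡ (+-congˡ (∑-shuffle-insertBefore a≢b c ζ a∉ b∉ (φ ∘ (z ∷_)))) ⟩
    _
      ≈⟨ +-assoc _ _ _ ⟨
    _
      ≈⟨ +-congʳ (∑-shuffle-∷ b c z ζ (φ ∘ (a ∷_))) ⟨
    _
      ≈⟨ ∑-shuffle-∷ a (b ∷ c) z ζ φ ⟨
    ∑ (shuffle (a ∷ b ∷ c) (z ∷ ζ)) φ ∎

  avoids : ∀ {a zs rs} → All (a ≢_) zs → Within zs rs → Avoids a rs
  avoids a∉ = All.map (λ { (p , q) → All.lookup a∉ p , All.lookup a∉ q })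

  -- `perms` inserts the head of the list last, and the head of a chain is only required to precede
  -- the next element. Adding the chain from its top downwards therefore produces the shuffles.
  LinSum-chain : ∀ c zs {rs} → Unique (c ++ zs) → Within zs rs → ∀ φ →
    LinSum (c ++ zs) (chain c ++ rs) φ ≈ LinSum zs rs (λ ζ → ∑ (shuffle c ζ) φ)
  LinSum-chain [] zs {rs} u w φ = LinSum-cong {zs} {rs} (λ π _ _ → sym (+-identityʳ _))
  LinSum-chain (a ∷ []) zs {rs} (a∉ ∷ u) w φ = begin
    ∑ (perms (a ∷ zs)) (λ π → [ respects rs π ] φ π)
      ≈⟨ ∑-concatMap (insertAll a) (perms zs) _ ⟩
    ∑ (perms zs) (λ π → ∑ (insertAll a π) (λ ρ → [ respects rs ρ ] φ ρ))
      ≈⟨ ∑-cong (perms zs) (λ π → trans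
           (∑-congᴬ (All.map (λ {ρ} e → reflexive (≡.cong (λ t → [ t ] φ ρ) e)) (respects-insert (avoids a∉ w) π)))
           (trans ([]-∑ (respects rs π) (insertAll a π) φ)
                  (reflexive (≡.cong (λ l → [ respects rs π ] ∑ l φ) (≡.sym (shuffle-single a π)))))) ⟩
    LinSum zs rs (λ ζ → ∑ (shuffle (a ∷ []) ζ) φ) ∎
  LinSum-chain (a ∷ b ∷ c) zs {rs} (a∉@(a≢b ∷ a∉′) ∷ u@(b∉ ∷ _)) w φ = begin
    ∑ (perms (a ∷ b ∷ c ++ zs)) (λ π → [ before a b π ∧ respects rs′ π ] φ π)
      ≈⟨ ∑-concatMap (insertAll a) (perms (b ∷ c ++ zs)) _ ⟩
    ∑ (perms (b ∷ c ++ zs)) (λ π → ∑ (insertAll a π) (λ ρ → [ before a b ρ ∧ respects rs′ ρ ] φ ρ))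
      ≈⟨ ∑-cong (perms (b ∷ c ++ zs)) (λ π → trans
           (∑-congᴬ (All.map (λ {ρ} e → reflexive (≡.trans ([]-∧ (before a b ρ) (respects rs′ ρ) (φ ρ))
                                           (≡.cong (λ t → [ t ] ([ before a b ρ ] φ ρ)) e))) (respects-insert avoid π)))
           ([]-∑ (respects rs′ π) (insertAll a π) _)) ⟩
    LinSum (b ∷ c ++ zs) rs′ (insertBefore a b φ)
      ≈⟨ LinSum-chain (b ∷ c) zs u w (insertBefore a b φ) ⟩
    LinSum zs rs (λ ζ → ∑ (shuffle (b ∷ c) ζ) (insertBefore a b φ))
      ≈⟨ LinSum-cong {zs} {rs} (λ ζ p _ → ∑-shuffle-insertBefore a≢b c ζ
           (↭ₚ.All-resp-↭ (↭-sym p) (Allₚ.++⁻ʳ c a∉′)) (↭ₚ.All-resp-↭ (↭-sym p) (Allₚ.++⁻ʳ c b∉)) φ) ⟩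
    LinSum zs rs (λ ζ → ∑ (shuffle (a ∷ b ∷ c) ζ) φ) ∎
    where
    rs′ : List (ℕ × ℕ)
    rs′ = chain (b ∷ c) ++ rs
    avoid : Avoids a rs′
    avoid = avoids a∉ (Allₚ.++⁺
      (within-mono ∈ₚ.∈-++⁺ˡ (chain-Within (b ∷ c))) (within-mono (∈ₚ.∈-++⁺ʳ (b ∷ c)) w))

-- Recognising words of indices and of admissible indices

toWord-++ : ∀ k l → toWord (k ++ l) ≡ toWord k ++ toWord l
toWord-++ [] l = ≡.refl
toWord-++ (a ∷ k) l = ≡.cong (x1 ∷_) (≡.trans (≡.cong (replicate (a ∸ 1) x0 ++_) (toWord-++ k l))
  (≡.sym (Listₚ.++-assoc (replicate (a ∸ 1) x0) (toWord k) (toWord l))))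

toWord-reverse-∷ : ∀ n k → toWord (reverse (n ∷ k)) ≡ toWord (reverse k) ++ x1 ∷ replicate (n ∸ 1) x0
toWord-reverse-∷ n k = ≡.trans (≡.cong toWord (Listₚ.unfold-reverse n k))
  (≡.trans (toWord-++ (reverse k) (n ∷ [])) (≡.cong (λ w → toWord (reverse k) ++ x1 ∷ w) (Listₚ.++-identityʳ _)))

toWord-head : ∀ k {a w} → a ∷ w ≡ toWord k → a ≡ x1
toWord-head (n ∷ k) ≡.refl = ≡.refl

parse : ∀ w → ∃[ n ] ∃[ j ] (Pos j × w ≡ replicate n x0 ++ toWord j)
parse [] = 0 , [] , [] , ≡.refl
parse (x0 ∷ w) with parse w
... | n , j , pj , e = suc n , j , pj , ≡.cong (x0 ∷_) e
parse (x1 ∷ w) with parse w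
... | n , j , pj , e = 0 , suc n ∷ j , s≤s z≤n ∷ pj , ≡.cong (x1 ∷_) e

lastLetter : Letter → Word → Letter
lastLetter a [] = a
lastLetter a (b ∷ w) = lastLetter b w

-- Here w is the tail of a word starting with x1, and `suc n` is the first entry of the index of
-- that whole word.
parse-Adm : ∀ w → lastLetter x1 w ≡ x0 → ∃[ n ] ∃[ j ] (Adm (suc n ∷ j) × w ≡ replicate n x0 ++ toWord j)
parse-Adm (x0 ∷ []) _ = 1 , [] , s≤s (s≤s z≤n) , ≡.refl
parse-Adm (x0 ∷ b ∷ w) e with parse-Adm (b ∷ w) e
... | n , [] , ad , q = suc n , [] , ℕₚ.m≤n⇒m≤1+n ad , ≡.cong (x0 ∷_) q
... | n , i ∷ j , (_ , ad) , q = suc n , i ∷ j , (s≤s z≤n , ad) , ≡.cong (x0 ∷_) q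
parse-Adm (x1 ∷ w) e with parse-Adm w e
... | n , j , ad , q = 0 , suc n ∷ j , (s≤s z≤n , ad) , ≡.cong (x1 ∷_) q

-- Zigzag posets and configurations

Block : Set
Block = ℕ × List ℕ

els : Block → List ℕ
els (b , bs) = b ∷ bs

top : ℕ → List ℕ → ℕ
top b [] = b
top b (b′ ∷ bs) = top b′ bs

top-∈ : ∀ b bs → top b bs ∈ b ∷ bs
top-∈ b [] = here ≡.refl
top-∈ b (b′ ∷ bs) = there (top-∈ b′ bs)

-- A zigzag poset is given by its list of blocks in reverse order, so that its head is the block b_{s,1} < b_{s,2} < ⋯.
elems : List Block → List ℕ
elems [] = []
elems (B ∷ z) = els B ++ elems z

-- The relation b_{j-1,1} < b_{j,l_j}; as blocks are listed backwards, block j-1 is the head of z.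
cross : List Block → Block → List (ℕ × ℕ)
cross [] B = []
cross (B′ ∷ z) B = (proj₁ B′ , top (proj₁ B) (proj₂ B)) ∷ []

zig : List Block → List (ℕ × ℕ)
zig [] = []
zig (B ∷ z) = chain (els B) ++ (cross z B ++ zig z)

chain-++ : ∀ a as b bs → chain ((a ∷ as) ++ b ∷ bs) ≡ chain (a ∷ as) ++ (top a as , b) ∷ chain (b ∷ bs)
chain-++ a [] b bs = ≡.refl
chain-++ a (a′ ∷ as) b bs = ≡.cong ((a , a′) ∷_) (chain-++ a′ as b bs)

chain-++-++ : ∀ c a as b bs →
  chain ((c ++ a ∷ as) ++ b ∷ bs) ≡ chain (c ++ a ∷ as) ++ (top a as , b) ∷ chain (b ∷ bs)
chain-++-++ [] a as b bs = chain-++ a as b bs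
chain-++-++ (x ∷ []) a as b bs = ≡.cong ((x , a) ∷_) (chain-++ a as b bs)
chain-++-++ (x ∷ y ∷ c) a as b bs = ≡.cong ((x , y) ∷_) (chain-++-++ (y ∷ c) a as b bs)

chain-pred : ∀ {x} a as → x ∈ a ∷ as → x ≡ a ⊎ ∃[ y ] (y , x) ∈ chain (a ∷ as)
chain-pred a as (here e) = inj₁ e
chain-pred a (b ∷ as) (there p) with chain-pred b as p
... | inj₁ ≡.refl = inj₂ (a , here ≡.refl)
... | inj₂ (y , q) = inj₂ (y , there q)

chain-succ : ∀ {x} c b bs → x ∈ c → ∃[ y ] (y ∈ c ++ b ∷ bs × (x , y) ∈ chain (c ++ b ∷ bs))
chain-succ (a ∷ []) b bs (here ≡.refl) = b , there (here ≡.refl) , here ≡.refl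
chain-succ (a ∷ a′ ∷ c) b bs (here ≡.refl) = a′ , there (here ≡.refl) , here ≡.refl
chain-succ (a ∷ a′ ∷ c) b bs (there p) with chain-succ (a′ ∷ c) b bs p
... | y , q , r = y , there q , there r

zig-Within : ∀ z → Within (elems z) (zig z)
zig-Within [] = []
zig-Within (B ∷ z) = Allₚ.++⁺ (within-mono ∈ₚ.∈-++⁺ˡ (chain-Within (els B)))
  (Allₚ.++⁺ (cross-Within z) (within-mono (∈ₚ.∈-++⁺ʳ (els B)) (zig-Within z)))
  where
  cross-Within : ∀ z → Within (els B ++ elems z) (cross z B)
  cross-Within [] = []
  cross-Within (B′ ∷ z) = (∈ₚ.∈-++⁺ʳ (els B) (here ≡.refl) , ∈ₚ.∈-++⁺ˡ (top-∈ (proj₁ B) (proj₂ B))) ∷ []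

IsBlock : (ℕ → Letter) → Block → ℕ → Set
IsBlock lab B n = map lab (els B) ≡ x1 ∷ replicate (n ∸ 1) x0

data Blocks (lab : ℕ → Letter) : List Block → Index → Set where
  [] : Blocks lab [] []
  _∷_ : ∀ {B n z l} → IsBlock lab B n → Blocks lab z l → Blocks lab (B ∷ z) (n ∷ l)

-- A configuration is the poset behind m(k,(l,n)): `c` is the chain of k, `B` the last zigzag block,
-- placed on top of it, and `z` the remaining blocks.
confElems : List ℕ → Block → List Block → List ℕ
confElems c B z = (c ++ els B) ++ elems z

confRels : List ℕ → Block → List Block → List (ℕ × ℕ)
confRels c B z = chain (c ++ els B) ++ (cross z B ++ zig z)

block-bottom : ∀ {lab B n} → IsBlock lab B n → lab (proj₁ B) ≡ x1
block-bottom e = Listₚ.∷-injectiveˡ e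

replicate-∈ : ∀ {lab : ℕ → Letter} {x} bs m → map lab bs ≡ replicate m x0 → x ∈ bs → lab x ≡ x0
replicate-∈ (b ∷ bs) (suc m) e (here ≡.refl) = Listₚ.∷-injectiveˡ e
replicate-∈ (b ∷ bs) (suc m) e (there p) = replicate-∈ bs m (Listₚ.∷-injectiveʳ e) p

block-label : ∀ {lab x} B n → IsBlock lab B n → x ∈ els B → x ≡ proj₁ B ⊎ lab x ≡ x0
block-label B n e (here p) = inj₁ p
block-label B n e (there p) = inj₂ (replicate-∈ (proj₂ B) (n ∸ 1) (Listₚ.∷-injectiveʳ e) p)

-- Minimal elements carry x1, since x0 occurs only above the bottom of a block. Linear extensions
-- therefore spell words of indices.
zig-pred : ∀ {lab z l x} → Blocks lab z l → x ∈ elems z → lab x ≡ x1 ⊎ ∃[ y ] (y , x) ∈ zig z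
zig-pred {z = B ∷ z} {n ∷ l} (isB ∷ bz) p with ∈ₚ.∈-++⁻ (els B) p
... | inj₂ q with zig-pred bz q
...   | inj₁ e = inj₁ e
...   | inj₂ (y , r) = inj₂ (y , ∈ₚ.∈-++⁺ʳ (chain (els B)) (∈ₚ.∈-++⁺ʳ (cross z B) r))
zig-pred {z = B ∷ z} {n ∷ l} (isB ∷ bz) p | inj₁ q with chain-pred (proj₁ B) (proj₂ B) q
... | inj₁ ≡.refl = inj₁ (block-bottom {B = B} {n} isB)
... | inj₂ (y , r) = inj₂ (y , ∈ₚ.∈-++⁺ˡ r)

zig-succ : ∀ {lab z l x} B → Blocks lab z l → x ∈ elems z →
  lab x ≡ x0 ⊎ ∃[ y ] (y ∈ els B ++ elems z × (x , y) ∈ cross z B ++ zig z)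
zig-succ {z = B′ ∷ z} {n ∷ l} B (isB′ ∷ bz) p with ∈ₚ.∈-++⁻ (els B′) p
... | inj₁ q with block-label B′ n isB′ q
...   | inj₁ ≡.refl = inj₂ (top (proj₁ B) (proj₂ B) , ∈ₚ.∈-++⁺ˡ (top-∈ (proj₁ B) (proj₂ B)) , here ≡.refl)
...   | inj₂ e = inj₁ e
zig-succ {z = B′ ∷ z} {n ∷ l} B (isB′ ∷ bz) p | inj₂ q with zig-succ B′ bz q
... | inj₁ e = inj₁ e
... | inj₂ (y , r , s) = inj₂ (y , ∈ₚ.∈-++⁺ʳ (els B) r , there (∈ₚ.∈-++⁺ʳ (chain (els B′)) s))

conf-pred : ∀ {lab c k B n z l x} → map lab c ≡ toWord k → IsBlock lab B n → Blocks lab z l →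
  x ∈ confElems c B z → lab x ≡ x1 ⊎ ∃[ y ] (y , x) ∈ confRels c B z
conf-pred {lab} {c} {k} {B} {n} {z} {l} ec isB bz p with ∈ₚ.∈-++⁻ (c ++ els B) p
... | inj₂ q with zig-pred bz q
...   | inj₁ e = inj₁ e
...   | inj₂ (y , r) = inj₂ (y , ∈ₚ.∈-++⁺ʳ (chain (c ++ els B)) (∈ₚ.∈-++⁺ʳ (cross z B) r))
conf-pred {lab} {[]} {k} {B} {n} {z} {l} ec isB bz p | inj₁ q with chain-pred (proj₁ B) (proj₂ B) q
... | inj₁ ≡.refl = inj₁ (block-bottom {B = B} {n} isB)
... | inj₂ (y , r) = inj₂ (y , ∈ₚ.∈-++⁺ˡ r)
conf-pred {lab} {a ∷ c} {k} {B} {n} {z} {l} ec isB bz p | inj₁ q with chain-pred a (c ++ els B) q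
... | inj₁ ≡.refl = inj₁ (toWord-head k ec)
... | inj₂ (y , r) = inj₂ (y , ∈ₚ.∈-++⁺ˡ r)

-- Maximal elements carry x0: a bottom in z lies below the top of the following block, the chain
-- lies below B, and the bottom of B lies below the rest of B, which is non-empty as n ≥ 2.
conf-succ : ∀ {lab c B n z l x} → IsBlock lab B n → 2 ≤ n → Blocks lab z l →
  x ∈ confElems c B z → lab x ≡ x0 ⊎ ∃[ y ] (y ∈ confElems c B z × (x , y) ∈ confRels c B z)
conf-succ {lab} {c} {B} {n} {z} {l} isB 2≤n bz p with ∈ₚ.∈-++⁻ (c ++ els B) p
... | inj₂ q with zig-succ B bz q
...   | inj₁ e = inj₁ e
...   | inj₂ (y , r , s) = inj₂ (y , ≡.subst (y ∈_) (≡.sym (Listₚ.++-assoc c (els B) (elems z))) (∈ₚ.∈-++⁺ʳ c r)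
                                 , ∈ₚ.∈-++⁺ʳ (chain (c ++ els B)) s)
conf-succ {lab} {c} {B} {n} {z} {l} isB 2≤n bz p | inj₁ q with ∈ₚ.∈-++⁻ c q
... | inj₁ r with chain-succ c (proj₁ B) (proj₂ B) r
...   | y , s , t = inj₂ (y , ∈ₚ.∈-++⁺ˡ s , ∈ₚ.∈-++⁺ˡ t)
conf-succ {lab} {c} {b , []} {suc (suc n)} {z} {l} () 2≤n bz p | inj₁ q | inj₂ r
conf-succ {lab} {c} {b , []} {suc zero} {z} {l} isB (s≤s ()) bz p | inj₁ q | inj₂ r
conf-succ {lab} {c} {b , b′ ∷ bs} {n} {z} {l} isB 2≤n bz p | inj₁ q | inj₂ r with block-label (b , b′ ∷ bs) n isB r
... | inj₂ e = inj₁ e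
... | inj₁ ≡.refl with chain-succ (c ∷ʳ b) b′ bs (∈ₚ.∈-++⁺ʳ c (here ≡.refl))
...   | y , s , t rewrite Listₚ.++-assoc c (b ∷ []) (b′ ∷ bs) = inj₂ (y , ∈ₚ.∈-++⁺ˡ s , ∈ₚ.∈-++⁺ˡ t)

first-letter : ∀ {lab : ℕ → Letter} {xs rs π} → π ↭ xs → respects rs π ≡ true →
  (∀ {x} → x ∈ xs → lab x ≡ x1 ⊎ ∃[ y ] (y , x) ∈ rs) → ∃[ j ] (Pos j × map lab π ≡ toWord j)
first-letter {π = []} p e h = [] , [] , ≡.refl
first-letter {lab} {π = x ∷ π} p e h with h (↭ₚ.∈-resp-↭ p (here ≡.refl))
... | inj₂ (y , r) with ≡.trans (≡.sym (not-before-first x y π)) (respects-∈ (x ∷ π) e r)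
...   | ()
first-letter {lab} {π = x ∷ π} p e h | inj₁ lx with parse (map lab π)
... | n , j , pj , q = suc n ∷ j , s≤s z≤n ∷ pj , ≡.cong₂ _∷_ lx q

pos-top : ∀ x xs → Unique (x ∷ xs) → pos (top x xs) (x ∷ xs) ≡ length xs
pos-top x [] u = pos-here x []
pos-top x (y ∷ xs) (x∉ ∷ u) = ≡.trans (pos-there (y ∷ xs) (λ e → All.lookup x∉ (top-∈ y xs) (≡.sym e)))
  (≡.cong suc (pos-top y xs u))

lastLetter-top : ∀ (lab : ℕ → Letter) x xs → lastLetter (lab x) (map lab xs) ≡ lab (top x xs)
lastLetter-top lab x [] = ≡.refl
lastLetter-top lab x (y ∷ xs) = lastLetter-top lab y xs

<ᵇ-false : ∀ {m n} → n ≤ m → (m ℕ.<ᵇ n) ≡ false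
<ᵇ-false z≤n = ≡.refl
<ᵇ-false (s≤s p) = <ᵇ-false p

last-letter : ∀ {lab : ℕ → Letter} {xs rs x π} → x ∷ π ↭ xs → Unique xs → respects rs (x ∷ π) ≡ true →
  (∀ {x} → x ∈ xs → lab x ≡ x0 ⊎ ∃[ y ] (y ∈ xs × (x , y) ∈ rs)) → lastLetter (lab x) (map lab π) ≡ x0
last-letter {lab} {xs} {rs} {x} {π} p u e h with h (↭ₚ.∈-resp-↭ p (top-∈ x π))
... | inj₁ q = ≡.trans (lastLetter-top lab x π) q
... | inj₂ (y , y∈ , r) = contradiction (≡.trans (≡.sym (respects-∈ (x ∷ π) e r)) false-before) λ ()
  where
  false-before : before (top x π) y (x ∷ π) ≡ false
  false-before rewrite pos-top x π (Unique-resp-↭ (↭-sym p) u) =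
    <ᵇ-false (ℕₚ.≤-pred (pos-∈ (↭ₚ.∈-resp-↭ (↭-sym p) y∈)))

admissible-word : ∀ {lab : ℕ → Letter} {xs rs π} → π ↭ xs → Unique xs → respects rs π ≡ true →
  (∀ {x} → x ∈ xs → lab x ≡ x1 ⊎ ∃[ y ] (y , x) ∈ rs) →
  (∀ {x} → x ∈ xs → lab x ≡ x0 ⊎ ∃[ y ] (y ∈ xs × (x , y) ∈ rs)) → ∃[ j ] (Adm j × map lab π ≡ toWord j)
admissible-word {π = []} p u e h h′ = [] , tt , ≡.refl
admissible-word {lab} {π = x ∷ π} p u e h h′ with first-letter {lab} p e h
... | (n ∷ j) , _ , q with parse-Adm (map lab π) (≡.subst (λ a → lastLetter a (map lab π) ≡ x0) (Listₚ.∷-injectiveˡ q) (last-letter {lab} p u e h′))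
...   | n′ , j′ , ad , q′ = suc n′ ∷ j′ , ad , ≡.cong₂ _∷_ (Listₚ.∷-injectiveˡ q) q′

-- Configurations satisfy the recurrence

module Configurations {c ℓ : Level} (S : CommutativeRing c ℓ) where
  open CommutativeRing S hiding (zero)
  open Summation S
  open LinearExtensions S
  open IntegerSolver S
  open import Algebra.Properties.Ring ring using (-0#≈0#)
  open import Relation.Binary.Reasoning.Setoid setoid

  ConfSum : List ℕ → Block → List Block → (List ℕ → Carrier) → Carrier
  ConfSum c B z = LinSum (confElems c B z) (confRels c B z)

  ConfSum-chain : ∀ c B → Unique (confElems c B []) → ∀ φ → ConfSum c B [] φ ≈ φ (c ++ els B)
  ConfSum-chain c B u φ = begin
    LinSum ((c ++ els B) ++ []) (chain (c ++ els B) ++ []) φ   ≈⟨ LinSum-chain (c ++ els B) [] u [] φ ⟩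
    ∑ (shuffle (c ++ els B) []) φ + 0#                         ≈⟨ +-identityʳ _ ⟩
    ∑ (shuffle (c ++ els B) []) φ                              ≡⟨ ≡.cong (λ l → ∑ l φ) (shuffle-[]ʳ (c ++ els B)) ⟩
    φ (c ++ els B) + 0#                                        ≈⟨ +-identityʳ _ ⟩
    φ (c ++ els B)                                             ∎

  -- Compare the top of the chain c B with the bottom of the last zigzag block B′.
  ConfSum-recurrence : ∀ c B B′ z → Unique (confElems c B (B′ ∷ z)) → ∀ φ →
    LinSum (elems (B′ ∷ z)) (zig (B′ ∷ z)) (λ ζ → ∑ (shuffle (c ++ els B) ζ) φ) ≈
    ConfSum c B (B′ ∷ z) φ + ConfSum (c ++ els B) B′ z φ
  ConfSum-recurrence c B B′ z u φ = begin
    LinSum (elems (B′ ∷ z)) (zig (B′ ∷ z)) (λ ζ → ∑ (shuffle (c ++ els B) ζ) φ)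
      ≈⟨ LinSum-chain (c ++ els B) (elems (B′ ∷ z)) u (zig-Within (B′ ∷ z)) φ ⟨
    LinSum es (chain (c ++ els B) ++ zig (B′ ∷ z)) φ
      ≈⟨ LinSum-split b′≢t b′∈ (chain (c ++ els B) ++ zig (B′ ∷ z)) φ ⟩
    LinSum es ((b′ , t) ∷ chain (c ++ els B) ++ zig (B′ ∷ z)) φ + LinSum es ((t , b′) ∷ chain (c ++ els B) ++ zig (B′ ∷ z)) φ
      ≈⟨ +-cong (LinSum-↭ {es} ↭-refl (↭-sym (↭ₚ.shift (b′ , t) (chain (c ++ els B)) (zig (B′ ∷ z)))) φ)
                (LinSum-↭ {es} (↭.↭-reflexive (≡.sym (Listₚ.++-assoc (c ++ els B) (els B′) (elems z)))) rels φ) ⟩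
    ConfSum c B (B′ ∷ z) φ + ConfSum (c ++ els B) B′ z φ ∎
    where
    es : List ℕ
    es = confElems c B (B′ ∷ z)
    b′ t : ℕ
    b′ = proj₁ B′
    t = top (proj₁ B) (proj₂ B)
    b′∈ : b′ ∈ es
    b′∈ = ∈ₚ.∈-++⁺ʳ (c ++ els B) (here ≡.refl)
    disjoint : ∀ {x y} {xs ys : List ℕ} → Unique (xs ++ ys) → x ∈ xs → y ∈ ys → x ≢ y
    disjoint {xs = a ∷ xs} (a∉ ∷ _) (here ≡.refl) q = All.lookup a∉ (∈ₚ.∈-++⁺ʳ xs q)
    disjoint {xs = a ∷ xs} (_ ∷ u) (there p) q = disjoint u p q
    b′≢t : b′ ≢ t
    b′≢t e = disjoint u (∈ₚ.∈-++⁺ʳ c (top-∈ (proj₁ B) (proj₂ B))) (here ≡.refl) (≡.sym e)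
    rels : (t , b′) ∷ chain (c ++ els B) ++ zig (B′ ∷ z) ↭ confRels (c ++ els B) B′ z
    rels = ↭-trans (↭-sym (↭ₚ.shift (t , b′) (chain (c ++ els B)) (zig (B′ ∷ z))))
      (↭.↭-reflexive (≡.trans (≡.sym (Listₚ.++-assoc (chain (c ++ els B)) ((t , b′) ∷ chain (els B′)) _))
        (≡.cong (_++ (cross z B′ ++ zig z)) (≡.sym (chain-++-++ c (proj₁ B) (proj₂ B) b′ (proj₂ B′))))))

  module Multiplicative (F : Word → Carrier) (F-[] : F [] ≈ 1#)
      (F-* : ∀ k l → Pos k → Pos l → ∑ (sh (toWord k) (toWord l)) F ≈ F (toWord k) * F (toWord l)) where
    open System S (F ∘ toWord ∘ reverse) F-[]

    map-conf : ∀ {lab} k n c B → map lab c ≡ toWord (reverse k) → IsBlock lab B n →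
      map lab (c ++ els B) ≡ toWord (reverse (n ∷ k))
    map-conf {lab} k n c B ec isB = ≡.trans (Listₚ.map-++ lab c (els B))
      (≡.trans (≡.cong₂ _++_ ec isB) (≡.sym (toWord-reverse-∷ n k)))

    -- Induction on z by `ConfSum-recurrence`. Each linear extension of the free zigzag spells the
    -- word of an index, so `F-*` applies to its shuffles with the chain and the value of the chain
    -- factors out.
    ConfSum-value : ∀ lab k n l c B z → Pos k → 1 ≤ n → map lab c ≡ toWord (reverse k) → IsBlock lab B n → Blocks lab z l →
      Pos l → Unique (confElems c B z) → ConfSum c B z (F ∘ map lab) ≈ m k (n ∷ l)
    ConfSum-value lab k n [] c B [] pk pn ec isB [] _ u = begin
      ConfSum c B [] (F ∘ map lab)       ≈⟨ ConfSum-chain c B u _ ⟩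
      F (map lab (c ++ els B))           ≡⟨ ≡.cong F (map-conf k n c B ec isB) ⟩
      F (toWord (reverse (n ∷ k)))       ≈⟨ *-identityʳ _ ⟨
      F (toWord (reverse (n ∷ k))) * 1#  ≈⟨ trans (+-congˡ -0#≈0#) (+-identityʳ _) ⟨
      m k (n ∷ [])                       ∎
    ConfSum-value lab k n (n′ ∷ l) c B (B′ ∷ z) pk pn ec isB (isB′ ∷ bz) (pn′ ∷ pl) u = begin
      ConfSum c B (B′ ∷ z) φ
        ≈⟨ solve 2 (λ x y → x := (x :+ y) :- y) refl _ _ ⟩
      (ConfSum c B (B′ ∷ z) φ + ConfSum (c ++ els B) B′ z φ) - ConfSum (c ++ els B) B′ z φ
        ≈⟨ +-cong (sym (ConfSum-recurrence c B B′ z u φ))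
                  (-‿cong (ConfSum-value lab (n ∷ k) n′ l (c ++ els B) B′ z (pn ∷ pk) pn′ (map-conf k n c B ec isB) isB′ bz pl
                    (≡.subst Unique (≡.sym (Listₚ.++-assoc (c ++ els B) (els B′) (elems z))) u))) ⟩
      LinSum (elems (B′ ∷ z)) (zig (B′ ∷ z)) (λ ζ → ∑ (shuffle (c ++ els B) ζ) φ) - m (n ∷ k) (n′ ∷ l)
        ≈⟨ +-congʳ (LinSum-cong {elems (B′ ∷ z)} {zig (B′ ∷ z)} shuffle-value) ⟩
      LinSum (elems (B′ ∷ z)) (zig (B′ ∷ z)) (λ ζ → F (toWord (reverse (n ∷ k))) * φ ζ) - m (n ∷ k) (n′ ∷ l)
        ≈⟨ +-congʳ (LinSum-* (elems (B′ ∷ z)) (zig (B′ ∷ z)) _ φ) ⟩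
      -- The free zigzag is by definition the configuration with empty chain.
      F (toWord (reverse (n ∷ k))) * ConfSum [] B′ z φ - m (n ∷ k) (n′ ∷ l)
        ≈⟨ +-congʳ (*-congˡ (ConfSum-value lab [] n′ l [] B′ z [] pn′ ≡.refl isB′ bz pl (Unique-++ʳ (c ++ els B) u))) ⟩
      m k (n ∷ n′ ∷ l) ∎
      where
      φ : List ℕ → Carrier
      φ = F ∘ map lab
      shuffle-value : ∀ ζ → ζ ↭ elems (B′ ∷ z) → respects (zig (B′ ∷ z)) ζ ≡ true →
        ∑ (shuffle (c ++ els B) ζ) φ ≈ F (toWord (reverse (n ∷ k))) * φ ζ
      shuffle-value ζ p e with first-letter {lab} p e (zig-pred {z = B′ ∷ z} {n′ ∷ l} (isB′ ∷ bz))
      ... | j , pj , q = begin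
        ∑ (shuffle (c ++ els B) ζ) (F ∘ map lab)
          ≡⟨ ∑-map (map lab) (shuffle (c ++ els B) ζ) F ⟨
        ∑ (map (map lab) (shuffle (c ++ els B) ζ)) F
          ≡⟨ ≡.cong (λ ws → ∑ ws F) (≡.sym (sh-map lab (c ++ els B) ζ)) ⟩
        ∑ (sh (map lab (c ++ els B)) (map lab ζ)) F
          ≡⟨ ≡.cong₂ (λ v w → ∑ (sh v w) F) (map-conf k n c B ec isB) q ⟩
        ∑ (sh (toWord (reverse (n ∷ k))) (toWord j)) F
          ≈⟨ F-* _ j (reverse-Pos (pn ∷ pk)) pj ⟩
        F (toWord (reverse (n ∷ k))) * F (toWord j)
          ≡⟨ ≡.cong (λ w → F (toWord (reverse (n ∷ k))) * F w) (≡.sym q) ⟩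
        F (toWord (reverse (n ∷ k))) * F (map lab ζ) ∎

-- The numbering of poset elements and the relations produced by `Pgo`

rng : ℕ → ℕ → List ℕ
rng o zero = []
rng o (suc n) = o ∷ rng (suc o) n

rng-+ : ∀ o m n → rng o (m ℕ.+ n) ≡ rng o m ++ rng (o ℕ.+ m) n
rng-+ o zero n rewrite ℕₚ.+-identityʳ o = ≡.refl
rng-+ o (suc m) n rewrite ℕₚ.+-suc o m = ≡.cong (o ∷_) (rng-+ (suc o) m n)

applyUpTo-rng : ∀ (f : ℕ → ℕ) o n → (∀ i → f i ≡ o ℕ.+ i) → applyUpTo f n ≡ rng o n
applyUpTo-rng f o zero h = ≡.refl
applyUpTo-rng f o (suc n) h = ≡.cong₂ _∷_ (≡.trans (h 0) (ℕₚ.+-identityʳ o))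
  (applyUpTo-rng (f ∘ suc) (suc o) n (λ i → ≡.trans (h (suc i)) (ℕₚ.+-suc o i)))

upTo-rng : ∀ n → upTo n ≡ rng 0 n
upTo-rng n = applyUpTo-rng id 0 n (λ _ → ≡.refl)

rng-≥ : ∀ o n → All (o ≤_) (rng o n)
rng-≥ o zero = []
rng-≥ o (suc n) = ℕₚ.≤-refl ∷ All.map ℕₚ.<⇒≤ (rng-≥ (suc o) n)

rng-Unique : ∀ o n → Unique (rng o n)
rng-Unique o zero = []
rng-Unique o (suc n) = All.map (λ p e → ℕₚ.<⇒≢ p e) (rng-≥ (suc o) n) ∷ rng-Unique (suc o) n

top-rng : ∀ o n → top o (rng (suc o) n) ≡ o ℕ.+ n
top-rng o zero = ≡.sym (ℕₚ.+-identityʳ o)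
top-rng o (suc n) = ≡.trans (top-rng (suc o) n) (≡.sym (ℕₚ.+-suc o n))

top-++ : ∀ x xs y ys → top x (xs ++ y ∷ ys) ≡ top y ys
top-++ x [] y ys = ≡.refl
top-++ x (x′ ∷ xs) y ys = top-++ x′ xs y ys

applyUpTo-chain : ∀ (g : ℕ → ℕ × ℕ) o n → (∀ i → g i ≡ (o ℕ.+ i , suc (o ℕ.+ i))) → applyUpTo g n ≡ chain (rng o (suc n))
applyUpTo-chain g o zero h = ≡.refl
applyUpTo-chain g o (suc n) h = ≡.cong₂ _∷_ (≡.trans (h 0) (≡.cong (λ i → i , suc i) (ℕₚ.+-identityʳ o)))
  (applyUpTo-chain (g ∘ suc) (suc o) n (λ i → ≡.trans (h (suc i)) (≡.cong (λ i → i , suc i) (ℕₚ.+-suc o i))))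

map-lookupD-rng : ∀ {A : Set} (d : A) pre mid post →
  map (lookupD d (pre ++ mid ++ post)) (rng (length pre) (length mid)) ≡ mid
map-lookupD-rng d pre [] post = ≡.refl
map-lookupD-rng d pre (x ∷ mid) post = ≡.cong₂ _∷_ head-eq tail-eq
  where
  head-eq : lookupD d (pre ++ x ∷ mid ++ post) (length pre) ≡ x
  head-eq = ≡.trans (≡.cong (lookupD d (pre ++ x ∷ mid ++ post)) (≡.sym (ℕₚ.+-identityʳ (length pre))))
                    (lookupD-++ʳ d pre (x ∷ mid ++ post) 0)
  tail-eq : map (lookupD d (pre ++ x ∷ mid ++ post)) (rng (suc (length pre)) (length mid)) ≡ mid
  tail-eq = ≡.trans (≡.cong₂ (λ l o → map (lookupD d l) (rng o (length mid)))
                      (≡.sym (Listₚ.++-assoc pre (x ∷ []) (mid ++ post)))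
                      (≡.sym (≡.trans (Listₚ.length-++ pre) (ℕₚ.+-comm (length pre) 1))))
                    (map-lookupD-rng d (pre ∷ʳ x) mid post)

++-injective : ∀ {A : Set} (xs xs′ : List A) {ys ys′} → length xs ≡ length xs′ → xs ++ ys ≡ xs′ ++ ys′ → xs ≡ xs′ × ys ≡ ys′
++-injective [] [] _ e = ≡.refl , e
++-injective (x ∷ xs) (x′ ∷ xs′) n e with ++-injective xs xs′ (ℕₚ.suc-injective n) (Listₚ.∷-injectiveʳ e)
... | p , q = ≡.cong₂ _∷_ (Listₚ.∷-injectiveˡ e) p , q

length-rng : ∀ o n → length (rng o n) ≡ n
length-rng o zero = ≡.refl
length-rng o (suc n) = ≡.cong suc (length-rng (suc o) n)

length-toWord : ∀ {l} → Pos l → length (toWord l) ≡ weight l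
length-toWord [] = ≡.refl
length-toWord {suc n ∷ l} (_ ∷ pl) = ≡.cong suc (≡.trans (Listₚ.length-++ (replicate n x0))
  (≡.cong₂ ℕ._+_ (Listₚ.length-replicate n) (length-toWord pl)))

replicate-+ : ∀ {A : Set} {x : A} m n → replicate (m ℕ.+ n) x ≡ replicate m x ++ replicate n x
replicate-+ zero n = ≡.refl
replicate-+ (suc m) n = ≡.cong (_ ∷_) (replicate-+ m n)

weight-∷ʳ : ∀ k a → weight (k ∷ʳ a) ≡ weight k ℕ.+ a
weight-∷ʳ [] a = ℕₚ.+-identityʳ a
weight-∷ʳ (n ∷ k) a = ≡.trans (≡.cong (n ℕ.+_) (weight-∷ʳ k a)) (≡.sym (ℕₚ.+-assoc n (weight k) a))

sumInit-∷ʳ : ∀ l b → sumInit (l ∷ʳ b) ≡ weight l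
sumInit-∷ʳ [] b = ≡.refl
sumInit-∷ʳ (n ∷ []) b = ≡.refl
sumInit-∷ʳ (n ∷ n′ ∷ l) b = ≡.cong (n ℕ.+_) (sumInit-∷ʳ (n′ ∷ l) b)

block : ℕ → ℕ → Block
block o n = o , rng (suc o) (n ∸ 1)

blocks : ℕ → Index → List Block
blocks o [] = []
blocks o (n ∷ l) = block o n ∷ blocks (o ℕ.+ n) l

blocks-∷ʳ : ∀ o l b → blocks o (l ∷ʳ b) ≡ blocks o l ∷ʳ block (o ℕ.+ weight l) b
blocks-∷ʳ o [] b rewrite ℕₚ.+-identityʳ o = ≡.refl
blocks-∷ʳ o (n ∷ l) b rewrite blocks-∷ʳ (o ℕ.+ n) l b | ℕₚ.+-assoc o n (weight l) = ≡.refl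

elems-blocks : ∀ o {l} → Pos l → elems (blocks o l) ≡ rng o (weight l)
elems-blocks o [] = ≡.refl
elems-blocks o {suc n ∷ l} (_ ∷ pl) = ≡.trans (≡.cong (rng o (suc n) ++_) (elems-blocks (o ℕ.+ suc n) pl))
  (≡.sym (rng-+ o (suc n) (weight l)))

elems-ʳ++ : ∀ z z′ → elems (z ʳ++ z′) ↭ elems z ++ elems z′
elems-ʳ++ [] z′ = ↭-refl
elems-ʳ++ (B ∷ z) z′ = ↭-trans (elems-ʳ++ z (B ∷ z′))
  (↭-trans (↭ₚ.shifts (elems z) (els B)) (↭.↭-reflexive (≡.sym (Listₚ.++-assoc (els B) (elems z) (elems z′)))))

elems-reverse-blocks : ∀ o {l} → Pos l → elems (reverse (blocks o l)) ↭ rng o (weight l)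
elems-reverse-blocks o {l} pl = ↭-trans (elems-ʳ++ (blocks o l) [])
  (↭.↭-reflexive (≡.trans (Listₚ.++-identityʳ _) (elems-blocks o pl)))

Blocks-ʳ++ : ∀ {lab z l z′ l′} → Blocks lab z l → Blocks lab z′ l′ → Blocks lab (z ʳ++ z′) (l ʳ++ l′)
Blocks-ʳ++ [] b = b
Blocks-ʳ++ (p ∷ b) b′ = Blocks-ʳ++ b (p ∷ b′)

Blocks-blocks : ∀ lab o {l} → Pos l → map lab (rng o (weight l)) ≡ toWord l → Blocks lab (blocks o l) l
Blocks-blocks lab o [] _ = []
Blocks-blocks lab o {suc n ∷ l} (_ ∷ pl) e with ++-injective (map lab (rng o (suc n))) (x1 ∷ replicate n x0)
  (≡.trans (Listₚ.length-map lab (rng o (suc n))) (≡.trans (length-rng o (suc n)) (≡.cong suc (≡.sym (Listₚ.length-replicate n)))))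
  (≡.trans (≡.sym (Listₚ.map-++ lab (rng o (suc n)) (rng (o ℕ.+ suc n) (weight l))))
           (≡.trans (≡.cong (map lab) (≡.sym (rng-+ o (suc n) (weight l)))) e))
... | p , q = p ∷ Blocks-blocks lab (o ℕ.+ suc n) pl q

crossF : Maybe ℕ → Block → List (ℕ × ℕ)
crossF nothing B = []
crossF (just p) B = (p , top (proj₁ B) (proj₂ B)) ∷ []

-- `Pgo` lists relations from the first block on and carries the bottom of the previous block,
-- whereas `zig` starts at the last block; this is the order of `Pgo`.
zigF : Maybe ℕ → List Block → List (ℕ × ℕ)
zigF p [] = []
zigF p (B ∷ z) = chain (els B) ++ (crossF p B ++ zigF (just (proj₁ B)) z)

bottom : List Block → Maybe ℕ
bottom [] = nothing
bottom (B ∷ z) = just (proj₁ B)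

-- The accumulator `z′` holds the blocks already passed; the bottom of its head is the element that
-- `Pgo` carries.
zigF-zig : ∀ z z′ → zigF (bottom z′) z ++ zig z′ ↭ zig (z ʳ++ z′)
zigF-zig [] z′ = ↭-refl
zigF-zig (B ∷ z) z′ = ↭-trans
  (↭-trans (↭.↭-reflexive (≡.trans (Listₚ.++-assoc (chain (els B)) _ _)
             (≡.cong (chain (els B) ++_) (Listₚ.++-assoc (crossF (bottom z′) B) _ _))))
  (↭-trans (↭ₚ.++⁺ˡ (chain (els B)) (↭ₚ.shifts (crossF (bottom z′) B) (zigF (just (proj₁ B)) z)))
  (↭-trans (↭ₚ.shifts (chain (els B)) (zigF (just (proj₁ B)) z))
  (↭.↭-reflexive (≡.cong (λ r → zigF (just (proj₁ B)) z ++ (chain (els B) ++ (r ++ zig z′))) (crossF-cross z′))))))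
  (zigF-zig z (B ∷ z′))
  where
  crossF-cross : ∀ z′ → crossF (bottom z′) B ≡ cross z′ B
  crossF-cross [] = ≡.refl
  crossF-cross (B′ ∷ z′) = ≡.refl

zigF-reverse : ∀ z → zigF nothing z ↭ zig (reverse z)
zigF-reverse z = ↭-trans (↭.↭-reflexive (≡.sym (Listₚ.++-identityʳ _))) (zigF-zig z [])

shift : ℕ → ℕ × ℕ → ℕ × ℕ
shift K (x , y) = K ℕ.+ x , K ℕ.+ y

-- The offset K serves `mu`, where the zigzag is numbered after the chain; the zigzag P_1 alone is
-- the case K = 0.
Pgo-rels : ∀ δ K off prev {l} → Pos l →
  map (shift K) (proj₂ (Pgo δ off prev l)) ≡ zigF (Maybe.map (K ℕ.+_) prev) (blocks (K ℕ.+ off) l)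
Pgo-rels δ K off prev [] = ≡.refl
Pgo-rels δ K off prev {suc n ∷ l} (_ ∷ pl) = byPrev prev
  where
  chain-eq : map (shift K) (map (λ i → (off ℕ.+ i , off ℕ.+ suc i)) (upTo n)) ≡ chain (rng (K ℕ.+ off) (suc n))
  chain-eq = ≡.trans (≡.sym (Listₚ.map-∘ (upTo n))) (≡.trans (Listₚ.map-applyUpTo id _ n)
    (applyUpTo-chain _ (K ℕ.+ off) n (λ i → ≡.cong₂ _,_ (≡.sym (ℕₚ.+-assoc K off i))
      (≡.trans (≡.sym (ℕₚ.+-assoc K off (suc i))) (ℕₚ.+-suc (K ℕ.+ off) i)))))
  rest : List (ℕ × ℕ)
  rest = proj₂ (Pgo δ (off ℕ.+ suc n) (just off) l)
  glue : ∀ xs {ys} → map (shift K) xs ≡ ys →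
    map (shift K) (map (λ i → (off ℕ.+ i , off ℕ.+ suc i)) (upTo n) ++ (xs ++ rest)) ≡
    chain (rng (K ℕ.+ off) (suc n)) ++ (ys ++ zigF (just (K ℕ.+ off)) (blocks (K ℕ.+ off ℕ.+ suc n) l))
  glue xs e = ≡.trans (Listₚ.map-++ (shift K) (map (λ i → (off ℕ.+ i , off ℕ.+ suc i)) (upTo n)) _)
    (≡.cong₂ _++_ chain-eq (≡.trans (Listₚ.map-++ (shift K) xs rest)
    (≡.cong₂ _++_ e (≡.trans (Pgo-rels δ K (off ℕ.+ suc n) (just off) pl)
      (≡.cong (λ o → zigF (just (K ℕ.+ off)) (blocks o l)) (≡.sym (ℕₚ.+-assoc K off (suc n))))))))
  byPrev : ∀ prev → map (shift K) (proj₂ (Pgo δ off prev (suc n ∷ l))) ≡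
    zigF (Maybe.map (K ℕ.+_) prev) (blocks (K ℕ.+ off) (suc n ∷ l))
  byPrev nothing = glue [] ≡.refl
  byPrev (just p) = glue ((p , off ℕ.+ n) ∷ []) (≡.cong (λ t → (K ℕ.+ p , t) ∷ [])
    (≡.trans (≡.sym (ℕₚ.+-assoc K off n)) (≡.sym (top-rng (K ℕ.+ off) n))))

Pgo-labels-x1 : ∀ off prev l → proj₁ (Pgo x1 off prev l) ≡ toWord l
Pgo-labels-x1 off prev [] = ≡.refl
Pgo-labels-x1 off prev (n ∷ []) = ≡.refl
Pgo-labels-x1 off prev (n ∷ n′ ∷ l) = ≡.cong (λ w → x1 ∷ replicate (n ∸ 1) x0 ++ w) (Pgo-labels-x1 (off ℕ.+ n) (just off) (n′ ∷ l))

Pgo-labels-x0 : ∀ off prev l b → proj₁ (Pgo x0 off prev (l ∷ʳ suc b)) ≡ toWord l ++ replicate (suc b) x0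
Pgo-labels-x0 off prev [] b = Listₚ.++-identityʳ _
Pgo-labels-x0 off prev (n ∷ []) b = ≡.trans
  (≡.cong (λ w → x1 ∷ replicate (n ∸ 1) x0 ++ w) (Pgo-labels-x0 (off ℕ.+ n) (just off) [] b))
  (≡.cong (x1 ∷_) (≡.sym (≡.trans (Listₚ.++-assoc (replicate (n ∸ 1) x0) [] _) ≡.refl)))
Pgo-labels-x0 off prev (n ∷ n′ ∷ l) b = ≡.trans
  (≡.cong (λ w → x1 ∷ replicate (n ∸ 1) x0 ++ w) (Pgo-labels-x0 (off ℕ.+ n) (just off) (n′ ∷ l) b))
  (≡.cong (x1 ∷_) (≡.sym (Listₚ.++-assoc (replicate (n ∸ 1) x0) (toWord (n′ ∷ l)) _)))

-- The poset of μ((k,a+1),(l,b+1)) as a configuration: the last block of the chain is glued to the last block of the zigzag.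
module MuConfiguration (k : Index) (a : ℕ) (l : Index) (b : ℕ) (pk : Pos k) (pl : Pos l) where

  -- `K` is the length of the chain, hence the number of the first zigzag element, and `q` is the
  -- number of b_{s,1}.
  K q : ℕ
  K = weight k ℕ.+ suc a
  q = K ℕ.+ weight l

  cs as bs : List ℕ
  cs = rng 0 (weight k)
  as = rng (suc (weight k)) a
  bs = rng (suc q) b

  -- Since a_K < b_{s,1} and P_0 labels b_{s,1} by 0, the chain part of the entry a+1 and the last
  -- zigzag block together read x1 followed by zeros: one block for the entry (a+1)+(b+1).
  B : Block
  B = weight k , as ++ q ∷ bs

  z : List Block
  z = reverse (blocks K l)

  labels : List Letter
  labels = toWord (k ∷ʳ suc a) ++ Poset2.labels (P x0 (l ∷ʳ suc b))

  lab : ℕ → Letter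
  lab = lookupD x0 labels

  extra rels : List (ℕ × ℕ)
  extra = (weight (k ∷ʳ suc a) ∸ 1 , weight (k ∷ʳ suc a) ℕ.+ sumInit (l ∷ʳ suc b)) ∷ []
  rels = map (λ t → (t , suc t)) (upTo (weight (k ∷ʳ suc a) ∸ 1))
    ++ (map (shift (weight (k ∷ʳ suc a))) (Poset2.rels (P x0 (l ∷ʳ suc b))) ++ extra)

  labels-eq : labels ≡ toWord k ++ (x1 ∷ replicate a x0) ++ toWord l ++ replicate (suc b) x0
  labels-eq = ≡.trans (≡.cong₂ _++_ (≡.trans (toWord-++ k (suc a ∷ [])) (≡.cong (λ w → toWord k ++ x1 ∷ w) (Listₚ.++-identityʳ _)))
                                    (Pgo-labels-x0 0 nothing l b))
                      (Listₚ.++-assoc (toWord k) (x1 ∷ replicate a x0) _)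

  map-lab : ∀ pre mid post → labels ≡ pre ++ mid ++ post → ∀ {o n} → length pre ≡ o → length mid ≡ n → map lab (rng o n) ≡ mid
  map-lab pre mid post e ≡.refl ≡.refl rewrite e = map-lookupD-rng x0 pre mid post

  length-a : length (x1 ∷ replicate a x0) ≡ suc a
  length-a = ≡.cong suc (Listₚ.length-replicate a)

  map-cs : map lab cs ≡ toWord k
  map-cs = map-lab [] (toWord k) _ labels-eq ≡.refl (length-toWord pk)

  map-as : map lab (weight k ∷ as) ≡ x1 ∷ replicate a x0
  map-as = map-lab (toWord k) (x1 ∷ replicate a x0) _ labels-eq (length-toWord pk) length-a

  map-l : map lab (rng K (weight l)) ≡ toWord l
  map-l = map-lab (toWord k ++ x1 ∷ replicate a x0) (toWord l) (replicate (suc b) x0)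
    (≡.trans labels-eq (≡.sym (Listₚ.++-assoc (toWord k) (x1 ∷ replicate a x0) _)))
    (≡.trans (Listₚ.length-++ (toWord k)) (≡.cong₂ ℕ._+_ (length-toWord pk) length-a))
    (length-toWord pl)

  map-bs : map lab (q ∷ bs) ≡ replicate (suc b) x0
  map-bs = map-lab (toWord k ++ (x1 ∷ replicate a x0) ++ toWord l) (replicate (suc b) x0) []
    (≡.trans labels-eq (≡.trans (≡.sym assoc₃) (≡.cong ((toWord k ++ (x1 ∷ replicate a x0) ++ toWord l) ++_) (≡.sym (Listₚ.++-identityʳ _)))))
    (≡.trans (Listₚ.length-++ (toWord k)) (≡.trans (≡.cong₂ ℕ._+_ (length-toWord pk)
      (≡.trans (Listₚ.length-++ (x1 ∷ replicate a x0)) (≡.cong₂ ℕ._+_ length-a (length-toWord pl))))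
      (≡.sym (ℕₚ.+-assoc (weight k) (suc a) (weight l)))))
    (Listₚ.length-replicate (suc b))
    where
    assoc₃ : (toWord k ++ (x1 ∷ replicate a x0) ++ toWord l) ++ replicate (suc b) x0 ≡
             toWord k ++ (x1 ∷ replicate a x0) ++ toWord l ++ replicate (suc b) x0
    assoc₃ = ≡.trans (Listₚ.++-assoc (toWord k) _ _) (≡.cong (toWord k ++_) (Listₚ.++-assoc (x1 ∷ replicate a x0) (toWord l) _))

  isBlock-B : IsBlock lab B (suc a ℕ.+ suc b)
  isBlock-B = ≡.trans (Listₚ.map-++ lab (weight k ∷ as) (q ∷ bs))
    (≡.trans (≡.cong₂ _++_ map-as map-bs) (≡.cong (x1 ∷_) (≡.sym (replicate-+ a (suc b)))))

  blocks-z : Blocks lab z (reverse l)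
  blocks-z = Blocks-ʳ++ (Blocks-blocks lab K pl map-l) []

  cs-as : cs ++ weight k ∷ as ≡ rng 0 K
  cs-as = ≡.sym (rng-+ 0 (weight k) (suc a))

  elems-↭ : upTo (length labels) ↭ confElems cs B z
  elems-↭ = ↭-trans (↭.↭-reflexive (≡.trans (upTo-rng _) (≡.cong (rng 0) length-labels)))
    (↭-trans (↭.↭-reflexive (≡.trans (rng-+ 0 q (suc b)) (≡.cong (_++ q ∷ bs) (rng-+ 0 K (weight l)))))
    (↭-trans (↭.↭-reflexive (Listₚ.++-assoc (rng 0 K) (rng K (weight l)) (q ∷ bs)))
    (↭-trans (↭ₚ.++⁺ˡ (rng 0 K) (↭-trans (↭ₚ.++-comm (rng K (weight l)) (q ∷ bs))
                (↭ₚ.++⁺ˡ (q ∷ bs) (↭-sym (elems-reverse-blocks K pl)))))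
    (↭.↭-reflexive (≡.trans (≡.sym (Listₚ.++-assoc (rng 0 K) (q ∷ bs) (elems z)))
      (≡.cong (_++ elems z) (≡.trans (≡.cong (_++ q ∷ bs) (≡.sym cs-as)) (Listₚ.++-assoc cs (weight k ∷ as) (q ∷ bs)))))))))
    where
    length-labels : length labels ≡ q ℕ.+ suc b
    length-labels = ≡.trans (Listₚ.length-++ (toWord (k ∷ʳ suc a))) (≡.trans (≡.cong₂ ℕ._+_
        (≡.trans (length-toWord (snoc-Pos pk (s≤s z≤n))) (weight-∷ʳ k (suc a)))
        (≡.trans (≡.cong length (Pgo-labels-x0 0 nothing l b)) (≡.trans (Listₚ.length-++ (toWord l))
          (≡.cong₂ ℕ._+_ (length-toWord pl) (Listₚ.length-replicate (suc b))))))
      (≡.sym (ℕₚ.+-assoc K (weight l) (suc b))))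

  unique : Unique (confElems cs B z)
  unique = Unique-resp-↭ elems-↭ (≡.subst Unique (≡.sym (upTo-rng _)) (rng-Unique 0 _))

  zig-z : zigF nothing (blocks K (l ∷ʳ suc b)) ↭ chain (q ∷ bs) ++ (cross z B ++ zig z)
  zig-z = ↭-trans (zigF-reverse (blocks K (l ∷ʳ suc b))) (↭.↭-reflexive (≡.trans
    (≡.cong (zig ∘ reverse) (blocks-∷ʳ K l (suc b)))
    (≡.trans (≡.cong zig (Listₚ.reverse-++ (blocks K l) (block q (suc b) ∷ [])))
             (≡.cong (λ r → chain (q ∷ bs) ++ (r ++ zig z)) (cross-top z)))))
    where
    -- Gluing extends the last block downwards only; its top, and with it the cross relation, is
    -- unchanged.
    cross-top : ∀ z → cross z (q , bs) ≡ cross z B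
    cross-top [] = ≡.refl
    cross-top (B′ ∷ z) = ≡.cong (λ t → (proj₁ B′ , t) ∷ []) (≡.sym (top-++ (weight k) as q bs))

  rels-↭ : rels ↭ confRels cs B z
  rels-↭ = ↭-trans (↭.↭-reflexive rels-eq)
    (↭-trans (↭ₚ.++⁺ˡ (chain (rng 0 K)) (↭-trans (↭ₚ.++-comm (zigF nothing (blocks K (l ∷ʳ suc b))) _) (prep (K ∸ 1 , q) zig-z)))
    (↭.↭-reflexive (≡.trans (≡.sym (Listₚ.++-assoc (chain (rng 0 K)) ((K ∸ 1 , q) ∷ chain (q ∷ bs)) _))
      (≡.cong (_++ (cross z B ++ zig z)) (≡.sym chain-eq)))))
    where
    K≡ : K ≡ suc (weight k ℕ.+ a)
    K≡ = ℕₚ.+-suc (weight k) a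
    chainUp : map (λ t → (t , suc t)) (upTo (K ∸ 1)) ≡ chain (rng 0 K)
    chainUp rewrite K≡ = ≡.trans (Listₚ.map-applyUpTo id _ (weight k ℕ.+ a)) (applyUpTo-chain _ 0 (weight k ℕ.+ a) (λ _ → ≡.refl))
    rels-eq : rels ≡ chain (rng 0 K) ++ (zigF nothing (blocks K (l ∷ʳ suc b)) ++ (K ∸ 1 , q) ∷ [])
    rels-eq rewrite weight-∷ʳ k (suc a) | sumInit-∷ʳ l (suc b) = ≡.cong₂ _++_ chainUp
      (≡.cong (_++ (K ∸ 1 , q) ∷ []) (≡.trans (Pgo-rels x0 K 0 nothing (snoc-Pos pl (s≤s z≤n)))
        (≡.cong (λ o → zigF nothing (blocks o (l ∷ʳ suc b))) (ℕₚ.+-identityʳ K))))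
    -- The extra relation of `mu` is the link that joins the two chains.
    chain-eq : chain (cs ++ els B) ≡ chain (rng 0 K) ++ (K ∸ 1 , q) ∷ chain (q ∷ bs)
    chain-eq = ≡.trans (≡.cong chain (≡.sym (Listₚ.++-assoc cs (weight k ∷ as) (q ∷ bs))))
      (≡.trans (chain-++-++ cs (weight k) as q bs)
      (≡.cong₂ (λ xs t → chain xs ++ (t , q) ∷ chain (q ∷ bs)) cs-as (≡.trans (top-rng (weight k) a) (≡.cong (_∸ 1) (≡.sym K≡)))))

  -- `mu` shifts by an anonymous pattern-matching function, which equals `shift` only pointwise.
  mu-W : mu (k ∷ʳ suc a) (l ∷ʳ suc b) ≡ W (poset2 labels rels)
  mu-W = ≡.cong (λ r → W (poset2 labels (map (λ t → (t , suc t)) (upTo (weight (k ∷ʳ suc a) ∸ 1)) ++ (r ++ extra))))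
    (Listₚ.map-cong (λ { (x , y) → ≡.refl }) (Poset2.rels (P x0 (l ∷ʳ suc b))))

-- The sums over `mu` and over P_1 as values of m

module MuSums {c ℓ : Level} (S : CommutativeRing c ℓ) where
  open CommutativeRing S hiding (zero)
  open Summation S
  open LinearExtensions S
  open Configurations S using (ConfSum)

  module _ (k : Index) (a : ℕ) (l : Index) (b : ℕ) (pk : Pos k) (pl : Pos l) where
    open MuConfiguration k a l b pk pl

    ∑-mu : ∀ F → ∑ (mu (k ∷ʳ suc a) (l ∷ʳ suc b)) F ≈ ConfSum cs B z (F ∘ map lab)
    ∑-mu F = trans (reflexive (≡.cong (λ ws → ∑ ws F) mu-W)) (trans (LinSum-W labels rels F) (LinSum-↭ elems-↭ rels-↭ _))

    -- Linear extensions of a configuration with last entry at least 2 spell admissible words only.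
    -- This allows the regularised values in the sum to be replaced by those of Z.
    ∑-mu-cong : ∀ F G → (∀ j → Adm j → F (toWord j) ≈ G (toWord j)) →
      ∑ (mu (k ∷ʳ suc a) (l ∷ʳ suc b)) F ≈ ∑ (mu (k ∷ʳ suc a) (l ∷ʳ suc b)) G
    ∑-mu-cong F G h = trans (∑-mu F) (trans (LinSum-cong {confElems cs B z} {confRels cs B z} word) (sym (∑-mu G)))
      where
      word : ∀ π → π ↭ confElems cs B z → respects (confRels cs B z) π ≡ true → F (map lab π) ≈ G (map lab π)
      word π p e with admissible-word {lab} p unique e
        (conf-pred {c = cs} {k} {B} {suc a ℕ.+ suc b} {z} map-cs isBlock-B blocks-z)
        (conf-succ {c = cs} {B} {suc a ℕ.+ suc b} {z} isBlock-B (s≤s (ℕₚ.≤-trans (s≤s z≤n) (ℕₚ.m≤n+m (suc b) a))) blocks-z)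
      ... | j , ad , q rewrite q = h j ad

  module Multiplicative (F : Word → Carrier) (F-[] : F [] ≈ 1#)
      (F-* : ∀ k l → Pos k → Pos l → ∑ (sh (toWord k) (toWord l)) F ≈ F (toWord k) * F (toWord l)) where
    open System S (F ∘ toWord ∘ reverse) F-[]
    open Configurations.Multiplicative S F F-[] F-*

    m-mu : ∀ k a l b → Pos k → Pos l →
      m (reverse k) (suc a ℕ.+ suc b ∷ reverse l) ≈ ∑ (mu (k ∷ʳ suc a) (l ∷ʳ suc b)) F
    m-mu k a l b pk pl = sym (trans (∑-mu k a l b pk pl F)
      (ConfSum-value lab (reverse k) (suc a ℕ.+ suc b) (reverse l) cs B z (reverse-Pos pk) (s≤s z≤n)
        (≡.trans map-cs (≡.cong toWord (≡.sym (Listₚ.reverse-involutive k)))) isBlock-B blocks-z (reverse-Pos pl) unique))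
      where
      open MuConfiguration k a l b pk pl

    m-P : ∀ l → Pos l → m [] (reverse l) ≈ ∑ (W (P x1 l)) F
    m-P l pl = sym (trans (LinSum-W (Poset2.labels (P x1 l)) (Poset2.rels (P x1 l)) F)
      (trans (LinSum-↭ elems-↭ rels-↭ _) (zig-value (Blocks-ʳ++ (Blocks-blocks lab 0 pl map-lab) []) (reverse-Pos pl) unique)))
      where
      lab : ℕ → Letter
      lab = lookupD x0 (Poset2.labels (P x1 l))
      map-lab : map lab (rng 0 (weight l)) ≡ toWord l
      map-lab = ≡.trans (≡.cong₂ (λ ws n → map (lookupD x0 ws) (rng 0 n))
          (≡.trans (Pgo-labels-x1 0 nothing l) (≡.sym (Listₚ.++-identityʳ _))) (≡.sym (length-toWord pl)))
        (map-lookupD-rng x0 [] (toWord l) [])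
      elems-↭ : upTo (length (Poset2.labels (P x1 l))) ↭ elems (reverse (blocks 0 l))
      elems-↭ = ↭-trans (↭.↭-reflexive (≡.trans (upTo-rng _)
          (≡.cong (rng 0) (≡.trans (≡.cong length (Pgo-labels-x1 0 nothing l)) (length-toWord pl)))))
        (↭-sym (elems-reverse-blocks 0 pl))
      rels-↭ : Poset2.rels (P x1 l) ↭ zig (reverse (blocks 0 l))
      rels-↭ = ↭-trans (↭.↭-reflexive (≡.trans (≡.sym (Listₚ.map-id _)) (Pgo-rels x1 0 0 nothing pl)))
        (zigF-reverse (blocks 0 l))
      unique : Unique (elems (reverse (blocks 0 l)))
      unique = Unique-resp-↭ elems-↭ (≡.subst Unique (≡.sym (upTo-rng _)) (rng-Unique 0 _))
      zig-value : ∀ {z rl} → Blocks lab z rl → Pos rl → Unique (elems z) →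
        LinSum (elems z) (zig z) (F ∘ map lab) ≈ m [] rl
      -- The empty poset is no configuration, since it lacks a block; both sides are 1.
      zig-value [] _ _ = trans (+-identityʳ _) F-[]
      zig-value {B ∷ z} {n ∷ rl} (isB ∷ bz) (pn ∷ pl) u = ConfSum-value lab [] n rl [] B z [] pn ≡.refl isB bz pl u

-- The three properties in terms of the two solutions

reverse-ones : ∀ p l → reverse (ones p l) ≡ reverse l ++ replicate p 1
reverse-ones zero l = ≡.sym (Listₚ.++-identityʳ _)
reverse-ones (suc p) l = ≡.trans (reverse-ones p (1 ∷ l))
  (≡.trans (≡.cong (_++ replicate p 1) (Listₚ.unfold-reverse 1 l)) (Listₚ.++-assoc (reverse l) (1 ∷ []) (replicate p 1)))

module Equivalence {c ℓ : Level} (R : CommutativeRing c ℓ) (inv : ℕ → CommutativeRing.Carrier R)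
    (qalg : WithRing.QAlg R inv) (Z : Word → CommutativeRing.Carrier R)
    (Zsh Zst : Word → WithRing.Poly R inv)
    (shReg : WithRing.IsShReg R inv Z Zsh) (stReg : WithRing.IsStReg R inv Z Zst) where
  open CommutativeRing R hiding (zero)
  open WithRing R inv
  open Coefficients R inv
  open ExponentialSeries R inv qalg
  open IntegerSolver R
  open import Algebra.Properties.Ring ring using (-0#≈0#)
  open Summation R using (∑)
  open Summation P.seriesRing using (∑-map; ∑-congᴬ) renaming (∑ to ∑ₛ)

  F₁ F₂ : Word → ℕ → Carrier
  F₁ w = coeff (Zsh w)
  F₂ w = coeff (Zst w)

  F₁-[] : F₁ [] ≋ const 1#
  F₁-[] = Pr.trans (proj₁ shReg) (coeff-pconst 1#)

  F₂-[] : F₂ [] ≋ const 1#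
  F₂-[] = Pr.trans (proj₁ stReg) (coeff-pconst 1#)

  F₁-1 : F₁ (x1 ∷ []) ≋ T
  F₁-1 = proj₁ (proj₂ shReg)

  F₂-1 : F₂ (x1 ∷ []) ≋ T
  F₂-1 = proj₁ (proj₂ stReg)

  F₁-Adm : ∀ j → Adm j → F₁ (toWord j) ≋ const (Z (toWord j))
  F₁-Adm j ad = Pr.trans (proj₁ (proj₂ (proj₂ shReg)) j ad) (coeff-pconst _)

  F₂-Adm : ∀ j → Adm j → F₂ (toWord j) ≋ const (Z (toWord j))
  F₂-Adm j ad = Pr.trans (proj₁ (proj₂ (proj₂ stReg)) j ad) (coeff-pconst _)

  F₁-* : ∀ k l → Pos k → Pos l → ∑ₛ (sh (toWord k) (toWord l)) F₁ ≋ F₁ (toWord k) Pr.* F₁ (toWord l)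
  F₁-* k l pk pl = Pr.trans (Pr.sym (coeff-PΣ Zsh (sh (toWord k) (toWord l))))
    (Pr.trans (proj₂ (proj₂ (proj₂ shReg)) k l pk pl) (coeff-pmul (Zsh (toWord k)) (Zsh (toWord l))))

  F₂-* : ∀ k l → Pos k → Pos l → ∑ₛ (har k l) (F₂ ∘ toWord) ≋ F₂ (toWord k) Pr.* F₂ (toWord l)
  F₂-* k l pk pl = Pr.trans (Pr.reflexive (≡.sym (∑-map toWord (har k l) F₂)))
    (Pr.trans (Pr.sym (coeff-PΣ Zst (map toWord (har k l))))
    (Pr.trans (proj₂ (proj₂ (proj₂ stReg)) k l pk pl) (coeff-pmul (Zst (toWord k)) (Zst (toWord l)))))

  module S₁ = System P.seriesRing (F₁ ∘ toWord ∘ reverse) F₁-[]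
  module S₂ = System P.seriesRing (F₂ ∘ toWord ∘ reverse) F₂-[]
  module Sh = MuSums.Multiplicative P.seriesRing F₁ F₁-[] F₁-*
  module St = Harmonic.Multiplicative P.seriesRing (F₂ ∘ toWord) F₂-[] F₂-*
  open Comparison P.seriesRing (F₁ ∘ toWord ∘ reverse) (F₂ ∘ toWord ∘ reverse) F₁-[] F₂-[]

  ∑-const : ∀ {A : Set} (xs : List A) f → ∑ₛ xs (const ∘ f) ≋ const (∑ xs f)
  ∑-const [] f = Pr.sym const-zero
  ∑-const (x ∷ xs) f = Pr.trans (Pr.+-congˡ {const (f x)} (∑-const xs f)) (Pr.sym (const-+ (f x) (∑ xs f)))

  m₁-const : ∀ k a l b → Pos k → Pos l →
    S₁.m (reverse k) (suc a ℕ.+ suc b ∷ reverse l) ≋ const (ZΣ Z (mu (k ∷ʳ suc a) (l ∷ʳ suc b)))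
  m₁-const k a l b pk pl = Pr.trans (Sh.m-mu k a l b pk pl)
    (Pr.trans (MuSums.∑-mu-cong P.seriesRing k a l b pk pl F₁ (const ∘ Z) F₁-Adm) (∑-const (mu (k ∷ʳ suc a) (l ∷ʳ suc b)) Z))

  m₂-const : ∀ k a l b → Pos k → Pos l →
    S₂.m (reverse k) (suc a ℕ.+ suc b ∷ reverse l) ≋ const (ZΣ Z (map toWord (circL (k ∷ʳ suc a) (star (l ∷ʳ suc b)))))
  m₂-const k a l b pk pl = Pr.trans (St.m-circ (reverse k) (suc a) (reverse l) (suc b) (reverse-Pos pk) (s≤s z≤n) (reverse-Pos pl) (s≤s z≤n))
    (Pr.trans (Pr.reflexive (≡.cong₂ (λ k l → ∑ₛ (circL (k ∷ʳ suc a) (star (l ∷ʳ suc b))) (F₂ ∘ toWord)) (Listₚ.reverse-involutive k) (Listₚ.reverse-involutive l)))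
    (Pr.trans (∑-congᴬ (All.map (λ {j} → F₂-Adm j) (circ-Adm pk (s≤s z≤n) pl (s≤s z≤n))))
    (Pr.trans (∑-const (circL (k ∷ʳ suc a) (star (l ∷ʳ suc b))) (Z ∘ toWord))
    (const-cong (reflexive (≡.sym (Summation.∑-map R toWord (circL (k ∷ʳ suc a) (star (l ∷ʳ suc b))) Z)))))))

  constant : ∀ {f a} → f ≋ const a → f ≋ const (f 0)
  constant p = Pr.trans p (const-cong (sym (p 0)))

  -- Splitting n as 1 + (n-1) presents the value as a sum over some `mu`, which is free of T.
  m₁-constant : ∀ k n l → Pos k → 2 ≤ n → Pos l → S₁.m k (n ∷ l) ≋ const (S₁.m k (n ∷ l) 0)
  m₁-constant k (suc (suc n)) l pk (s≤s (s≤s z≤n)) pl = ≡.subst₂ (λ k l → S₁.m k (suc (suc n) ∷ l) ≋ const (S₁.m k (suc (suc n) ∷ l) 0))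
    (Listₚ.reverse-involutive k) (Listₚ.reverse-involutive l)
    (constant (m₁-const (reverse k) 0 (reverse l) n (reverse-Pos pk) (reverse-Pos pl)))

  m₂-constant : ∀ k n l → Pos k → 2 ≤ n → Pos l → S₂.m k (n ∷ l) ≋ const (S₂.m k (n ∷ l) 0)
  m₂-constant k (suc (suc n)) l pk (s≤s (s≤s z≤n)) pl = ≡.subst₂ (λ k l → S₂.m k (suc (suc n) ∷ l) ≋ const (S₂.m k (suc (suc n) ∷ l) 0))
    (Listₚ.reverse-involutive k) (Listₚ.reverse-involutive l)
    (constant (m₂-const (reverse k) 0 (reverse l) n (reverse-Pos pk) (reverse-Pos pl)))

  ∷ʳ≢[] : ∀ (k : Index) a → ¬ (k ∷ʳ a ≡ [])
  ∷ʳ≢[] [] a ()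
  ∷ʳ≢[] (_ ∷ _) a ()

  -- Both sides of (Int-Ser) depend on the last entries only through their sum n, so the splitting 1
  -- + (n-1) is enough.
  IntSer⇒Agree : IntSer Z → Agree
  IntSer⇒Agree is k (suc (suc n)) l pk (s≤s (s≤s z≤n)) pl = ≡.subst₂ (λ k l → S₁.m k (suc (suc n) ∷ l) ≋ S₂.m k (suc (suc n) ∷ l))
    (Listₚ.reverse-involutive k) (Listₚ.reverse-involutive l)
    (Pr.trans (m₁-const (reverse k) 0 (reverse l) n rk rl)
    (Pr.trans (const-cong (is _ _ (snoc-Pos rk (s≤s z≤n)) (snoc-Pos rl (s≤s z≤n)) (∷ʳ≢[] (reverse k) 1) (∷ʳ≢[] (reverse l) (suc n))))
    (Pr.sym (m₂-const (reverse k) 0 (reverse l) n rk rl))))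
    where
    rk = reverse-Pos pk
    rl = reverse-Pos pl

  Agree⇒IntSer : Agree → IntSer Z
  Agree⇒IntSer ag k l pk pl k≢[] l≢[] with initLast k | initLast l
  ... | [] | _ = contradiction ≡.refl k≢[]
  ... | _ ∷ʳ′ _ | [] = contradiction ≡.refl l≢[]
  ... | k′ ∷ʳ′ a | l′ ∷ʳ′ b with Allₚ.++⁻ k′ pk | Allₚ.++⁻ l′ pl
  ...   | pk′ , (s≤s {n = a′} z≤n ∷ []) | pl′ , (s≤s {n = b′} z≤n ∷ []) =
    trans (sym (m₁-const k′ a′ l′ b′ pk′ pl′ 0))
    (trans (ag (reverse k′) (suc a′ ℕ.+ suc b′) (reverse l′) (reverse-Pos pk′) (s≤s (ℕₚ.≤-trans (s≤s z≤n) (ℕₚ.m≤n+m (suc b′) a′))) (reverse-Pos pl′) 0)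
           (m₂-const k′ a′ l′ b′ pk′ pl′ 0))

  C₁[] : ∀ p → S₁.C [] p ≡ F₁ (toWord (replicate p 1))
  C₁[] p = ≡.cong (F₁ ∘ toWord) (reverse-ones p [])

  C₂[] : ∀ p → S₂.C [] p ≡ F₂ (toWord (replicate p 1))
  C₂[] p = ≡.cong (F₂ ∘ toWord) (reverse-ones p [])

  -- The letter x1 can be inserted at n+1 places, always with the same result.
  ∑-sh-ones : ∀ G n → ∑ₛ (sh (x1 ∷ []) (toWord (replicate n 1))) G ≋ P₂.nat (suc n) Pr.* G (toWord (replicate (suc n) 1))
  ∑-sh-ones G zero = Pr.trans (Pr.+-identityʳ _) (Pr.sym (Pr.trans (Pr.*-congʳ {G (x1 ∷ [])} (Pr.+-identityʳ (const 1#))) (Pr.*-identityˡ _)))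
  ∑-sh-ones G (suc n) = Pr.trans (Pr.+-cong (Pr.sym (Pr.*-identityˡ (G (x1 ∷ x1 ∷ toWord (replicate n 1)))))
      (Pr.trans (Pr.reflexive (∑-map (x1 ∷_) (sh (x1 ∷ []) (toWord (replicate n 1))) G)) (∑-sh-ones (G ∘ (x1 ∷_)) n)))
    (Pr.sym (Pr.distribʳ (G (toWord (replicate (suc (suc n)) 1))) (const 1#) (P₂.nat (suc n))))

  θ-from-shift : ∀ q X → q 0 ≋ Pr.0# → (∀ n → P₂.nat (suc n) Pr.* X (suc n) ≋ P₂.conv (q ∘ suc) X n) → P₂.θ X P₂.≋ P₂.conv q X
  θ-from-shift q X q0 h zero = Pr.trans (Pr.zeroˡ (X 0)) (Pr.sym (Pr.trans (Pr.*-congʳ {X 0} q0) (Pr.zeroˡ (X 0))))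
  θ-from-shift q X q0 h (suc n) = Pr.trans (h n) (Pr.sym (Pr.trans
    (Pr.+-congʳ {P₂.conv (q ∘ suc) X n} (Pr.trans (Pr.*-congʳ {X (suc n)} q0) (Pr.zeroˡ (X (suc n))))) (Pr.+-identityˡ _)))

  -- Shuffling e_1 with its own powers gives (n+1) c({1}^(n+1)) = T c({1}^n), that is θE = (Tu) E.
  C₁[]-exp : S₁.C [] P₂.≋ exp-T
  C₁[]-exp = unique uT _ _ Pr.refl F₁-[] (θ-from-shift uT (S₁.C []) Pr.refl step) θ-exp-T
    where
    step : ∀ n → P₂.nat (suc n) Pr.* S₁.C [] (suc n) ≋ P₂.conv (P₂.const T) (S₁.C []) n
    step n = Pr.trans (Pr.*-congˡ {P₂.nat (suc n)} (Pr.reflexive (C₁[] (suc n))))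
      (Pr.trans (Pr.sym (∑-sh-ones F₁ n))
      (Pr.trans (F₁-* (1 ∷ []) (replicate n 1) (s≤s z≤n ∷ []) (St.replicate-Pos n))
      (Pr.trans (Pr.*-cong F₁-1 (Pr.reflexive (≡.sym (C₁[] n)))) (Pr.sym (P₂.conv-constˡ T (S₁.C []) n)))))

  a₀ a₀⁻¹ : ℕ → Carrier
  a₀ = A Z
  a₀⁻¹ = psInv (A Z)

  module LogA = Exponential qalg (logA Z) refl

  a₀-inverse : conv a₀ a₀⁻¹ ≋ const 1#
  a₀-inverse = psInv-inverse a₀ LogA.psExp-0

  module S₂ᵣ = IntegerSolver P₂.seriesRing

  -- Newton's identities read θE = qE, where q has (-1)^i c(i+1) in degree i+1. The coefficient T in
  -- degree 1 and the T-free ones above it form θ(Tu - log A), the logarithmic derivative of e^{Tu}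
  -- / A.
  C₂[]-exp : S₂.C [] P₂.≋ a₀⁻¹ ·exp-T
  C₂[]-exp = unique q (S₂.C []) (a₀⁻¹ ·exp-T) q0 (Pr.trans F₂-[] (Pr.sym (Pr.*-identityˡ (const 1#))))
    (θ-from-shift q (S₂.C []) q0 step)
    (P₂r.trans (P₂.θ-* (ι a₀⁻¹) exp-T)
    (P₂r.trans (P₂r.+-cong
       (P₂r.*-congʳ {exp-T} (P₂r.trans (P₂r.sym (ι-θ a₀⁻¹)) (P₂r.trans (ι-cong LogA.θ-psInv-psExp)
          (P₂r.trans (ι-neg (conv (P.θ (logA Z)) a₀⁻¹)) (P₂r.-‿cong (ι-* (P.θ (logA Z)) a₀⁻¹))))))
       (P₂r.*-congˡ {ι a₀⁻¹} θ-exp-T))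
    (S₂ᵣ.solve 4 (λ t a e u → (S₂ᵣ.:- (t S₂ᵣ.:* a)) S₂ᵣ.:* e S₂ᵣ.:+ a S₂ᵣ.:* (u S₂ᵣ.:* e) S₂ᵣ.:= (u S₂ᵣ.:- t) S₂ᵣ.:* (a S₂ᵣ.:* e))
       P₂r.refl (ι (P.θ (logA Z))) (ι a₀⁻¹) exp-T uT)))
    where
    q : ℕ → ℕ → Carrier
    q = uT P₂r.- ι (P.θ (logA Z))
    q0 : q 0 ≋ Pr.0#
    q0 = Pr.trans (Pr.+-identityˡ _) (Pr.trans (Pr.-‿cong (Pr.trans (const-cong (zeroˡ _)) const-zero)) (λ _ → -0#≈0#))
    Zₙ : ℕ → Carrier
    Zₙ i = Z (toWord (suc (suc i) ∷ []))
    coefficient : ∀ i → alt Zₙ i ≈ nat (suc (suc i)) * logA Z (suc (suc i))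
    coefficient i = trans (sym (alt≈psNeg Zₙ i)) (sym (trans
      (solve 4 (λ n s v z → n :* (:- (:- s) :* (v :* z)) := (n :* v) :* (s :* z)) refl (nat (suc (suc i))) (sgn i) (inv (suc i)) (Zₙ i))
      (trans (*-congʳ (trans (*-congʳ (reflexive (nat≡natR (suc (suc i))))) (qalg (suc i)))) (*-identityˡ _))))
    q-suc : ∀ i → P₂.alt (λ i → F₂ (toWord (suc i ∷ []))) i ≋ q (suc i)
    q-suc zero = Pr.trans F₂-1 (Pr.sym (Pr.trans (Pr.+-congˡ {T} (Pr.trans (Pr.-‿cong (Pr.trans (const-cong (zeroʳ _)) const-zero)) (λ _ → -0#≈0#))) (Pr.+-identityʳ T)))
    q-suc (suc i) = Pr.trans (Pr.-‿cong (Pr.trans (P₂.alt-cong (λ i → F₂-Adm (suc (suc i) ∷ []) (s≤s (s≤s z≤n))) i)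
        (Pr.trans (Pr.sym (ι-alt Zₙ i)) (const-cong (coefficient i)))))
      (Pr.sym (Pr.+-identityˡ _))
    step : ∀ n → P₂.nat (suc n) Pr.* S₂.C [] (suc n) ≋ P₂.conv (q ∘ suc) (S₂.C []) n
    step n = Pr.trans (Pr.*-congˡ {P₂.nat (suc n)} (Pr.reflexive (C₂[] (suc n))))
      (Pr.trans (St.newton n) (P₂.conv-cong q-suc (λ p → Pr.reflexive (≡.sym (C₂[] p))) n))

  inverse-unique : ∀ a x y → P₂.conv a x P₂.≋ P₂r.1# → P₂.conv a y P₂.≋ P₂r.1# → x P₂.≋ y
  inverse-unique a x y ax ay = P₂r.trans (P₂r.sym (P₂r.*-identityˡ x)) (P₂r.trans (P₂r.*-congʳ {x} (P₂r.sym ay))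
    (P₂r.trans (S₂ᵣ.solve 3 (λ a x y → (a S₂ᵣ.:* y) S₂ᵣ.:* x S₂ᵣ.:= (a S₂ᵣ.:* x) S₂ᵣ.:* y) P₂r.refl a x y)
    (P₂r.trans (P₂r.*-congʳ {y} ax) (P₂r.*-identityˡ y))))

  D₁[]-exp : S₁.D [] P₂.≋ exp-T
  D₁[]-exp = inverse-unique (P₂.alt (S₁.C [])) _ _ S₁.C*D-inverse
    (P₂r.trans (P₂r.*-congʳ {exp-T} (P₂.alt-cong C₁[]-exp)) exp-T-inverse)

  -- H(u) = 1 / E(-u) = A(-u) e^{Tu}, which is where the factor A(-u)^(-1) in ρ^⋆ comes from.
  D₂[]-exp : S₂.D [] P₂.≋ alt a₀ ·exp-T
  D₂[]-exp = inverse-unique (P₂.alt (S₂.C [])) _ _ S₂.C*D-inverse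
    (P₂r.trans (P₂r.*-congʳ {alt a₀ ·exp-T} (P₂r.trans (P₂.alt-cong C₂[]-exp)
       (P₂r.trans (P₂.alt-* (ι a₀⁻¹) exp-T) (P₂r.*-congʳ {P₂.alt exp-T} (P₂r.sym (ι-alt a₀⁻¹))))))
    (P₂r.trans (S₂ᵣ.solve 4 (λ i f a e → (i S₂ᵣ.:* f) S₂ᵣ.:* (a S₂ᵣ.:* e) S₂ᵣ.:= (a S₂ᵣ.:* i) S₂ᵣ.:* (f S₂ᵣ.:* e)) P₂r.refl
       (ι (alt a₀⁻¹)) (P₂.alt exp-T) (ι (alt a₀)) exp-T)
    (P₂r.trans (P₂r.*-cong (P₂r.trans (P₂r.sym (ι-* (alt a₀) (alt a₀⁻¹))) (P₂r.trans
         (ι-cong (Pr.trans (Pr.sym (P.alt-* a₀ a₀⁻¹)) (Pr.trans (P.alt-cong a₀-inverse) (P.alt-const 1#)))) ι-one)) exp-T-inverse)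
    (P₂r.*-identityˡ P₂r.1#))))

  star-inverse : conv (Astar Z) (alt a₀) ≋ const 1#
  star-inverse = Pr.trans (P.conv-comm (Astar Z) (alt a₀)) (Pr.trans (Pr.*-congʳ {Astar Z} (Pr.sym (alt≈psNeg a₀)))
    (psInv-inverse (psNeg a₀) (trans (*-identityˡ _) LogA.psExp-0)))

  ·exp-T-* : ∀ b σ {V W} → V P₂.≋ b ·exp-T → W P₂.≋ ι σ → P₂.conv V (P₂.alt W) P₂.≋ conv b (alt σ) ·exp-T
  ·exp-T-* b σ {V} {W} p r = P₂r.trans (P₂r.*-cong p (P₂r.trans (P₂.alt-cong r) (P₂r.sym (ι-alt σ))))
    (P₂r.trans (S₂ᵣ.solve 3 (λ b e s → (b S₂ᵣ.:* e) S₂ᵣ.:* s S₂ᵣ.:= (b S₂ᵣ.:* s) S₂ᵣ.:* e) P₂r.refl (ι b) exp-T (ι (alt σ)))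
    (P₂r.*-congʳ {exp-T} (P₂r.sym (ι-* b (alt σ)))))

  exp-T-* : ∀ σ {V W} → V P₂.≋ exp-T → W P₂.≋ ι σ → P₂.conv V (P₂.alt W) P₂.≋ alt σ ·exp-T
  exp-T-* σ {V} {W} p r = P₂r.trans (P₂r.*-cong p (P₂r.trans (P₂.alt-cong r) (P₂r.sym (ι-alt σ)))) (P₂r.*-comm exp-T (ι (alt σ)))

  one-·exp-T : const 1# ·exp-T P₂.≋ exp-T
  one-·exp-T = P₂r.trans (P₂r.*-congʳ {exp-T} ι-one) (P₂r.*-identityˡ exp-T)

  rho-cancel : ∀ a b σ n p → conv a b ≋ const 1# → coeff p ≋ (conv b σ ·exp-T) n → coeff (rho a p) ≋ (σ ·exp-T) n
  rho-cancel a b σ n p ab hp = Pr.trans (rho-·exp-T a (conv b σ) n p hp)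
    (·exp-T-cong (Pr.trans (Pr.sym (P.conv-assoc a b σ)) (Pr.trans (Pr.*-congʳ {σ} ab) (Pr.*-identityˡ σ))) n)

  rho-cancel-one : ∀ a b n p → conv a b ≋ const 1# → coeff p ≋ (b ·exp-T) n → coeff (rho a p) ≋ exp-T n
  rho-cancel-one a b n p ab hp = Pr.trans (rho-·exp-T a b n p hp) (Pr.trans (·exp-T-cong ab n) (one-·exp-T n))

  alt-injective : ∀ {f g} → alt f ≋ alt g → f ≋ g
  alt-injective {f} {g} p = Pr.trans (Pr.sym (P.alt-involutive f)) (Pr.trans (P.alt-cong p) (P.alt-involutive g))

  Reg′ : Index → Set ℓ
  Reg′ k = coeff (Zsh (toWord (reverse k))) ≋ coeff (rho (A Z) (Zst (toWord (reverse k))))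

  Reg⇒Reg′ : Reg Z Zsh Zst → ∀ k → Pos k → Reg′ k
  Reg⇒Reg′ reg k pk = reg (reverse k) (reverse-Pos pk)

  Reg′⇒Reg : (∀ k → Pos k → Reg′ k) → Reg Z Zsh Zst
  Reg′⇒Reg reg k pk = ≡.subst (λ k → Zsh (toWord k) ≈P rho (A Z) (Zst (toWord k))) (Listₚ.reverse-involutive k)
    (reg (reverse k) (reverse-Pos pk))

  module _ (n : ℕ) (k : Index) (2≤n : 2 ≤ n) (pk : Pos k) where
    -- The two series s over the base ring; their coefficients are constant in T, so the coefficient
    -- of T^0 contains everything.
    σ₁ σ₂ : ℕ → Carrier
    σ₁ p = S₁.Ξ k n [] p 0
    σ₂ p = S₂.Ξ k n [] p 0

    Ξ₁-ι : S₁.Ξ k n [] P₂.≋ ι σ₁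
    Ξ₁-ι p = m₁-constant k n (ones p []) pk 2≤n (ones-Pos p [])

    Ξ₂-ι : S₂.Ξ k n [] P₂.≋ ι σ₂
    Ξ₂-ι p = m₂-constant k n (ones p []) pk 2≤n (ones-Pos p [])

    C₁-exp : S₁.C (n ∷ k) P₂.≋ alt σ₁ ·exp-T
    C₁-exp = P₂r.trans (S₁.C-∷ n k) (exp-T-* σ₁ C₁[]-exp Ξ₁-ι)

    -- The harmonic series is A(u)^(-1) σ₂(-u) e^{Tu}, and ρ removes the factor A(u)^(-1).
    rho-C₂ : ∀ p → coeff (rho (A Z) (Zst (toWord (reverse (ones p (n ∷ k)))))) ≋ (alt σ₂ ·exp-T) p
    rho-C₂ p = rho-cancel a₀ a₀⁻¹ (alt σ₂) p (Zst (toWord (reverse (ones p (n ∷ k))))) a₀-inverse (P₂r.trans (S₂.C-∷ n k) (·exp-T-* a₀⁻¹ σ₂ C₂[]-exp Ξ₂-ι) p)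

    Reg′⇒Ξ : (∀ p → Reg′ (ones p (n ∷ k))) → S₁.Ξ k n [] P₂.≋ S₂.Ξ k n []
    Reg′⇒Ξ reg = P₂r.trans Ξ₁-ι (P₂r.trans (ι-cong (alt-injective (·exp-T-injective
      (λ p → Pr.trans (Pr.sym (C₁-exp p)) (Pr.trans (reg p) (rho-C₂ p)))))) (P₂r.sym Ξ₂-ι))

    Ξ⇒Reg′ : S₁.Ξ k n [] P₂.≋ S₂.Ξ k n [] → ∀ p → Reg′ (ones p (n ∷ k))
    Ξ⇒Reg′ e p = Pr.trans (C₁-exp p) (Pr.trans (·exp-T-cong (P.alt-cong (λ i → e i 0)) p) (Pr.sym (rho-C₂ p)))

  Reg⇒Agree : Reg Z Zsh Zst → Agree
  Reg⇒Agree reg = agree-from-Ξ (λ k n pk 2≤n → Reg′⇒Ξ n k 2≤n pk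
    (λ p → Reg⇒Reg′ reg (ones p (n ∷ k)) (ones-Pos p (ℕₚ.≤-trans (s≤s z≤n) 2≤n ∷ pk))))

  Agree⇒Reg : Agree → Reg Z Zsh Zst
  Agree⇒Reg ag = Reg′⇒Reg (λ k pk → reg (trailingOnes pk))
    where
    reg : ∀ {k} → TrailingOnes k → Reg′ k
    -- For {1}^p (Reg) holds outright: ρ sends A(u)^(-1) e^{Tu} to e^{Tu}.
    reg (only p) = Pr.trans (C₁[]-exp p) (Pr.sym (rho-cancel-one a₀ a₀⁻¹ p (Zst (toWord (reverse (ones p [])))) a₀-inverse (C₂[]-exp p)))
    reg (after p n k 2≤n pk) = Ξ⇒Reg′ n k 2≤n pk (λ i → ag k n (ones i []) pk 2≤n (ones-Pos i [])) p

  star₁ : ∀ k → Pos k → coeff (PΣ Zsh (W (P x1 (reverse k)))) ≋ S₁.m [] k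
  star₁ k pk = Pr.trans (coeff-PΣ Zsh (W (P x1 (reverse k)))) (Pr.trans (Pr.sym (Sh.m-P (reverse k) (reverse-Pos pk)))
    (Pr.reflexive (≡.cong (S₁.m []) (Listₚ.reverse-involutive k))))

  star₂ : ∀ k → Pos k → coeff (PΣ Zst (map toWord (star (reverse k)))) ≋ S₂.m [] k
  star₂ k pk = Pr.trans (coeff-PΣ Zst (map toWord (star (reverse k))))
    (Pr.trans (Pr.reflexive (∑-map toWord (star (reverse k)) F₂)) (Pr.sym (St.m-star k pk)))

  RegStar′ : Index → Set ℓ
  RegStar′ k = S₁.m [] k ≋ coeff (rho (Astar Z) (PΣ Zst (map toWord (star (reverse k)))))

  RegStar⇒RegStar′ : RegStar Z Zsh Zst → ∀ k → Pos k → RegStar′ k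
  RegStar⇒RegStar′ reg k pk = Pr.trans (Pr.sym (star₁ k pk)) (reg (reverse k) (reverse-Pos pk))

  RegStar′⇒RegStar : (∀ k → Pos k → RegStar′ k) → RegStar Z Zsh Zst
  RegStar′⇒RegStar reg k pk = ≡.subst (λ k → PΣ Zsh (W (P x1 k)) ≈P rho (Astar Z) (PΣ Zst (map toWord (star k))))
    (Listₚ.reverse-involutive k) (Pr.trans (star₁ (reverse k) (reverse-Pos pk)) (reg (reverse k) (reverse-Pos pk)))

  module _ (n : ℕ) (l : Index) (2≤n : 2 ≤ n) (pl : Pos l) where
    -- The analogue of σ for (Reg^⋆): up to the sign of u, the two series t over the base ring.
    τ₁ τ₂ : ℕ → Carrier
    τ₁ p = S₁.Y [] (n ∷ l) p 0
    τ₂ p = S₂.Y [] (n ∷ l) p 0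

    Y₁-ι : S₁.Y [] (n ∷ l) P₂.≋ ι τ₁
    Y₁-ι p = m₁-constant (ones p []) n l (ones-Pos p []) 2≤n pl

    Y₂-ι : S₂.Y [] (n ∷ l) P₂.≋ ι τ₂
    Y₂-ι p = m₂-constant (ones p []) n l (ones-Pos p []) 2≤n pl

    D₁-exp : S₁.D (n ∷ l) P₂.≋ alt τ₁ ·exp-T
    D₁-exp = P₂r.trans (S₁.D-factor (n ∷ l)) (exp-T-* τ₁ D₁[]-exp Y₁-ι)

    rho-D₂ : ∀ p → coeff (rho (Astar Z) (PΣ Zst (map toWord (star (reverse (ones p (n ∷ l))))))) ≋ (alt τ₂ ·exp-T) p
    rho-D₂ p = rho-cancel (Astar Z) (alt a₀) (alt τ₂) p (PΣ Zst (map toWord (star (reverse (ones p (n ∷ l)))))) star-inverse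
      (Pr.trans (star₂ (ones p (n ∷ l)) (ones-Pos p (ℕₚ.≤-trans (s≤s z≤n) 2≤n ∷ pl)))
                (P₂r.trans (S₂.D-factor (n ∷ l)) (·exp-T-* (alt a₀) τ₂ D₂[]-exp Y₂-ι) p))

    RegStar′⇒Y : (∀ p → RegStar′ (ones p (n ∷ l))) → S₁.Y [] (n ∷ l) P₂.≋ S₂.Y [] (n ∷ l)
    RegStar′⇒Y reg = P₂r.trans Y₁-ι (P₂r.trans (ι-cong (alt-injective (·exp-T-injective
      (λ p → Pr.trans (Pr.sym (D₁-exp p)) (Pr.trans (reg p) (rho-D₂ p)))))) (P₂r.sym Y₂-ι))

    Y⇒RegStar′ : S₁.Y [] (n ∷ l) P₂.≋ S₂.Y [] (n ∷ l) → ∀ p → RegStar′ (ones p (n ∷ l))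
    Y⇒RegStar′ e p = Pr.trans (D₁-exp p) (Pr.trans (·exp-T-cong (P.alt-cong (λ i → e i 0)) p) (Pr.sym (rho-D₂ p)))

  RegStar⇒Agree : RegStar Z Zsh Zst → Agree
  RegStar⇒Agree reg = agree-from-Y (λ n l 2≤n pl → RegStar′⇒Y n l 2≤n pl
    (λ p → RegStar⇒RegStar′ reg (ones p (n ∷ l)) (ones-Pos p (ℕₚ.≤-trans (s≤s z≤n) 2≤n ∷ pl))))

  Agree⇒RegStar : Agree → RegStar Z Zsh Zst
  Agree⇒RegStar ag = RegStar′⇒RegStar (λ k pk → reg (trailingOnes pk))
    where
    reg : ∀ {k} → TrailingOnes k → RegStar′ k
    reg (only p) = Pr.trans (D₁[]-exp p) (Pr.sym (rho-cancel-one (Astar Z) (alt a₀) p (PΣ Zst (map toWord (star (reverse (ones p []))))) star-inverse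
      (Pr.trans (star₂ (ones p []) (ones-Pos p [])) (D₂[]-exp p))))
    reg (after p n l 2≤n pl) = Y⇒RegStar′ n l 2≤n pl (λ i → ag (ones i []) n l (ones-Pos i []) 2≤n pl) p

theorem4p6 : {c ℓ : Level} (R : CommutativeRing c ℓ) (inv : ℕ → CommutativeRing.Carrier R) →
    let open WithRing R inv in
    QAlg →
    (Z : Word → CommutativeRing.Carrier R) → DoubleShuffle Z →
    (Zsh Zst : Word → Poly) → IsShReg Z Zsh → IsStReg Z Zst →
    (Reg Z Zsh Zst ⇔ RegStar Z Zsh Zst) × (Reg Z Zsh Zst ⇔ IntSer Z)
theorem4p6 R inv qalg Z _ Zsh Zst shReg stReg =
  mk⇔ (Agree⇒RegStar ∘ Reg⇒Agree) (Agree⇒Reg ∘ RegStar⇒Agree) ,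
  mk⇔ (Agree⇒IntSer ∘ Reg⇒Agree) (Agree⇒Reg ∘ IntSer⇒Agree)
  where
  open Equivalence R inv qalg Z Zsh Zst shReg stReg
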